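{- Let $G$ be a planar graph and $\mathcal{M}$ a set of demand pairs in $G$, where every terminal (vertex participating in a pair of $\mathcal{M}$) participates in exactly one pair of $\mathcal{M}$ and has degree $1$ in $G$. Let $k\geq|\mathcal{M}|$ be an integer, let $0<w^*\leq 1$, and suppose there is a multicommodity flow in $G$ in which every pair $(s,t)\in\mathcal{M}$ sends exactly $w^*$ flow units from $s$ to $t$ and the total flow through every vertex is at most $1$. Let $\alpha_{\mathrm{WL}}=\frac{w^*}{512\cdot\alpha_{\mathrm{AKR}}\cdot\log k}$. Then there is a polynomial-time algorithm that computes a collection $G_1,\dots,G_r$ of disjoint subgraphs of $G$ and, for each $1\leq j\leq r$, a set $\mathcal{M}^j\subseteq\mathcal{M}$ of demand pairs whose terminals all lie in $V(G_j)$, such that: (i) for all $1\leq j\leq r$, the set of terminals of $\mathcal{M}^j$ is $\alpha_{\mathrm{WL}}$-well-linked in $G_j$; (ii) for all $1\leq j\neq j'\leq r$, no edge of $G$ has one endpoint in $G_j$ and the other in $G_{j'}$; (iii) $\sum_{j=1}^r|\mathcal{M}^j|\geq 63|\mathcal{M}|/64$; and (iv) $\left|V(G)\setminus\bigcup_{j=1}^rV(G_j)\right|\leq\frac{w^*\cdot|\mathcal{M}|}{64}$.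
   Context: A set $\mathcal{T}'$ of vertices of a graph $H$ is $\alpha$-well-linked in $H$ if for every pair $\mathcal{T}_1,\mathcal{T}_2$ of disjoint equal-sized subsets of $\mathcal{T}'$ there is a set of at least $\alpha\cdot|\mathcal{T}_1|$ node-disjoint paths in $H$ connecting vertices of $\mathcal{T}_1$ to vertices of $\mathcal{T}_2$. $\alpha_{\mathrm{AKR}}$ is the universal constant approximation factor of the polynomial-time algorithm of Amir, Krauthgamer and Rao for the vertex sparsest cut problem in planar graphs.
   Formalization: The flow value w*, the approximation factor α_AKR and the flow values are taken rational instead of real; log is base 2, and k ≥ 2 is required so that α_WL is defined. -}

module Defs where

open import Data.Bool.Base using (Bool; true; false)
open import Data.Fin.Base as Fin using (Fin; toℕ)
open import Data.Fin.Subset using (Subset; ⊤; _∈_; _∉_; _⊆_; _∩_; ∁; ⋃; ∣_∣; Empty)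
import Data.Fin.Properties as Finₚ
open import Data.Fin.Subset.Properties using (∈⊤)
open import Data.Integer.Base as ℤ using (ℤ; +_; -[1+_])
open import Data.List.Base as List using (List; []; _∷_; allFin; concatMap; filter; foldr; length; map)
import Data.List.Membership.DecPropositional as DecMembership
open import Data.List.Relation.Binary.Disjoint.Propositional using (Disjoint)
open import Data.List.Relation.Unary.All using (All)
open import Data.List.Relation.Unary.AllPairs using (AllPairs)
open import Data.List.Relation.Unary.Linked using (Linked)
open import Data.List.Relation.Unary.Unique.Propositional using (Unique)
open import Data.Maybe.Base using (just)
open import Data.Nat.Base as ℕ using (ℕ; zero; suc; NonZero; _⊓_)
open import Data.Nat.Binary.Base as ℕᵇ using (ℕᵇ; 2[1+_]; 1+[2_])
open import Data.Product.Base using (Σ-syntax; ∃-syntax; _×_; _,_; proj₁; proj₂)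
open import Data.Rational.Base as ℚ using (ℚ; 0ℚ; 1ℚ; _/_; ↥_; ↧ₙ_)
open import Data.Sum.Base using (_⊎_)
open import Data.Vec.Base as Vec using (Vec; lookup; tabulate; toList)
open import Relation.Binary.PropositionalEquality.Core using (_≡_; _≢_)

-- The machine model is a variable-free form of Jones' WHILE language:
-- programs transform one binary tree.  Wherever the current tree is used
-- more than once, its size is charged for the copy.  Hence the size of the
-- result is at most the size of the argument plus the running time, and
-- running times agree with those of Turing machines up to a polynomial.

data Tree : Set where
  leaf : Tree
  node : Tree → Tree → Tree

size : Tree → ℕ
size leaf       = 1
size (node x y) = suc (size x ℕ.+ size y)

left right : Tree → Tree
left  leaf       = leaf
left  (node x y) = x
right leaf       = leaf
right (node x y) = y

infixr 5 _⨾_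

data Prog : Set where
  skip nil hd tl     : Prog
  _⨾_                : Prog → Prog → Prog
  ⟨_,_⟩              : Prog → Prog → Prog
  if_then_else_      : Prog → Prog → Prog → Prog
  while_loop_        : Prog → Prog → Prog

infix 4 _∶_⇓_⟨_⟩

-- p ∶ x ⇓ y ⟨ t ⟩: on x, the program p halts with result y after time t.
-- As a test result, leaf is false and every node is true.
data _∶_⇓_⟨_⟩ : Prog → Tree → Tree → ℕ → Set where
  ⇓skip  : ∀ {x} → skip ∶ x ⇓ x ⟨ 1 ⟩
  ⇓nil   : ∀ {x} → nil ∶ x ⇓ leaf ⟨ 1 ⟩
  ⇓hd    : ∀ {x} → hd ∶ x ⇓ left x ⟨ 1 ⟩
  ⇓tl    : ∀ {x} → tl ∶ x ⇓ right x ⟨ 1 ⟩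
  ⇓⨾     : ∀ {p q x y z s t} →
           p ∶ x ⇓ y ⟨ s ⟩ → q ∶ y ⇓ z ⟨ t ⟩ →
           p ⨾ q ∶ x ⇓ z ⟨ suc (s ℕ.+ t) ⟩
  ⇓pair  : ∀ {p q x y z s t} →
           p ∶ x ⇓ y ⟨ s ⟩ → q ∶ x ⇓ z ⟨ t ⟩ →
           ⟨ p , q ⟩ ∶ x ⇓ node y z ⟨ suc (size x ℕ.+ (s ℕ.+ t)) ⟩
  ⇓then  : ∀ {c p q x y z w s t} →
           c ∶ x ⇓ node y z ⟨ s ⟩ → p ∶ x ⇓ w ⟨ t ⟩ →
           if c then p else q ∶ x ⇓ w ⟨ suc (size x ℕ.+ (s ℕ.+ t)) ⟩
  ⇓else  : ∀ {c p q x w s t} →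
           c ∶ x ⇓ leaf ⟨ s ⟩ → q ∶ x ⇓ w ⟨ t ⟩ →
           if c then p else q ∶ x ⇓ w ⟨ suc (size x ℕ.+ (s ℕ.+ t)) ⟩
  ⇓done  : ∀ {c p x s} →
           c ∶ x ⇓ leaf ⟨ s ⟩ →
           while c loop p ∶ x ⇓ x ⟨ suc (size x ℕ.+ s) ⟩
  ⇓again : ∀ {c p x y z v w s t u} →
           c ∶ x ⇓ node y z ⟨ s ⟩ → p ∶ x ⇓ v ⟨ t ⟩ →
           while c loop p ∶ v ⇓ w ⟨ u ⟩ →
           while c loop p ∶ x ⇓ w ⟨ suc (size x ℕ.+ (s ℕ.+ (t ℕ.+ u))) ⟩

-- One program that, on every instance satisfying the promise, halts with an
-- acceptable answer in time polynomial in the size of the encoded instance.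
-- (Sizes are at least 1, so a · size ^ b covers all polynomials.)
PolyTimeSolvable : {I : Set} {O : I → Set} →
                   (I → Tree) → (∀ i → O i → Tree) →
                   (Promise : I → Set) (Accept : ∀ i → O i → Set) → Set
PolyTimeSolvable {I} {O} encI encO Promise Accept =
  Σ[ p ∈ Prog ] Σ[ a ∈ ℕ ] Σ[ b ∈ ℕ ]
    (∀ (i : I) → Promise i →
       Σ[ o ∈ O i ] Σ[ t ∈ ℕ ]
         (p ∶ encI i ⇓ encO i o ⟨ t ⟩
          × t ℕ.≤ a ℕ.* size (encI i) ℕ.^ b
          × Accept i o))

encBool : Bool → Tree
encBool false = leaf
encBool true  = node leaf leaf

encList : {A : Set} → (A → Tree) → List A → Tree
encList f []       = leaf
encList f (x ∷ xs) = node (f x) (encList f xs)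

encVec : {A : Set} {n : ℕ} → (A → Tree) → Vec A n → Tree
encVec f xs = encList f (toList xs)

encℕᵇ : ℕᵇ → Tree
encℕᵇ ℕᵇ.zero  = leaf
encℕᵇ 2[1+ x ] = node leaf (encℕᵇ x)
encℕᵇ 1+[2 x ] = node (node leaf leaf) (encℕᵇ x)

-- Numbers are written in binary.
encℕ : ℕ → Tree
encℕ n = encℕᵇ (ℕᵇ.fromℕ n)

encℤ : ℤ → Tree
encℤ (+ n)    = node leaf (encℕ n)
encℤ -[1+ n ] = node (node leaf leaf) (encℕ n)

encℚ : ℚ → Tree
encℚ q = node (encℤ (↥ q)) (encℕ (↧ₙ q))

-- Vertex names are written in unary; a graph is given by its adjacency
-- matrix, so this changes input sizes only polynomially.
encUnary : ℕ → Tree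
encUnary zero    = leaf
encUnary (suc n) = node leaf (encUnary n)

encFin : {n : ℕ} → Fin n → Tree
encFin v = encUnary (toℕ v)

encSubset : {n : ℕ} → Subset n → Tree
encSubset = encVec encBool

encMatrix : {n : ℕ} → (Fin n → Subset n) → Tree
encMatrix f = encVec encSubset (tabulate f)

record Graph (n : ℕ) : Set where
  field
    nbrs   : Fin n → Subset n
    irrefl : ∀ v → v ∉ nbrs v
    sym    : ∀ {u v} → u ∈ nbrs v → v ∈ nbrs u

open Graph public using (nbrs)

degree : {n : ℕ} → Graph n → Fin n → ℕ
degree G v = ∣ nbrs G v ∣

-- Not necessarily induced.
record Subgraph {n : ℕ} (G : Graph n) : Set where
  field
    verts  : Subset n
    adj    : Fin n → Subset n
    adj⊆   : ∀ v → adj v ⊆ nbrs G v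
    ends   : ∀ {u v} → u ∈ adj v → v ∈ verts
    symm   : ∀ {u v} → u ∈ adj v → v ∈ adj u

open Subgraph public using (verts; adj)

whole : {n : ℕ} (G : Graph n) → Subgraph G
whole G = record
  { verts = ⊤
  ; adj   = nbrs G
  ; adj⊆  = λ _ u∈ → u∈
  ; ends  = λ _ → ∈⊤
  ; symm  = Graph.sym G
  }

record IsPath {n : ℕ} {G : Graph n} (H : Subgraph G)
              (s t : Fin n) (vs : List (Fin n)) : Set where
  field
    starts   : List.head vs ≡ just s
    finishes : List.last vs ≡ just t
    inside   : All (_∈ verts H) vs
    steps    : Linked (λ u v → v ∈ adj H u) vs
    simple   : Unique vs

-- A graph is planar if it can be drawn with edges as simple
-- polygonal arcs.  Coordinates may be taken rational, and two rational
-- segments that meet do so in a rational point, so the rational plane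
-- suffices.

Point : Set
Point = ℚ × ℚ

_∈[_,_] : Point → Point → Point → Set
(x , y) ∈[ (x₀ , y₀) , (x₁ , y₁) ] =
  Σ[ t ∈ ℚ ] (0ℚ ℚ.≤ t × t ℚ.≤ 1ℚ
    × x ≡ x₀ ℚ.+ t ℚ.* (x₁ ℚ.- x₀)
    × y ≡ y₀ ℚ.+ t ℚ.* (y₁ ℚ.- y₀))

-- An arc is the list of its corners.
data _On_ (p : Point) : List Point → Set where
  here  : ∀ {a b ps} → p ∈[ a , b ] → p On (a ∷ b ∷ ps)
  there : ∀ {a ps} → p On ps → p On (a ∷ ps)

data SimpleArc : List Point → Set where
  [-] : ∀ {a} → SimpleArc (a ∷ [])
  _∷_ : ∀ {a b ps} →
        a ≢ b × (∀ p → p ∈[ a , b ] → p On (b ∷ ps) → p ≡ b) →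
        SimpleArc (b ∷ ps) → SimpleArc (a ∷ b ∷ ps)

-- Each edge, listed once.
IsEdge : {n : ℕ} → Graph n → Fin n × Fin n → Set
IsEdge G (u , v) = u Fin.< v × v ∈ nbrs G u

record Drawing {n : ℕ} (G : Graph n) : Set where
  field
    pos       : Fin n → Point
    pos-inj   : ∀ {u v} → pos u ≡ pos v → u ≡ v
    arc       : Fin n × Fin n → List Point
    simple    : ∀ {e} → IsEdge G e → SimpleArc (arc e)
    starts    : ∀ {e} → IsEdge G e → List.head (arc e) ≡ just (pos (proj₁ e))
    finishes  : ∀ {e} → IsEdge G e → List.last (arc e) ≡ just (pos (proj₂ e))
    avoids    : ∀ {e} → IsEdge G e → ∀ x → pos x On arc e →
                x ≡ proj₁ e ⊎ x ≡ proj₂ e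
    crossings : ∀ {e f} → IsEdge G e → IsEdge G f → e ≢ f →
                ∀ p → p On arc e → p On arc f → ∃[ x ] p ≡ pos x

Planar : {n : ℕ} → Graph n → Set
Planar = Drawing

record VertexCut {n : ℕ} (G : Graph n) : Set where
  field
    A X B  : Subset n
    covers : ∀ v → v ∈ A ⊎ v ∈ X ⊎ v ∈ B
    A∩X    : Empty (A ∩ X)
    A∩B    : Empty (A ∩ B)
    X∩B    : Empty (X ∩ B)
    noEdge : ∀ {u v} → u ∈ A → v ∈ B → v ∉ nbrs G u

module _ {n : ℕ} {G : Graph n} (T : Subset n) where

  separated : VertexCut G → ℕ
  separated C = (∣ A ∩ T ∣ ⊓ ∣ B ∩ T ∣) ℕ.+ ∣ X ∩ T ∣
    where open VertexCut C

  -- Sparsity is infinite when separated C is zero.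
  sparsity : (C : VertexCut G) → .{{_ : NonZero (separated C)}} → ℚ
  sparsity C = + ∣ VertexCut.X C ∣ / separated C

  ApproxSparsest : ℚ → VertexCut G → Set
  ApproxSparsest α C =
    ∀ C′ → .{{_ : NonZero (separated C′)}} →
    Σ[ nz ∈ NonZero (separated C) ]
      sparsity C {{nz}} ℚ.≤ α ℚ.* sparsity C′

CutInput : Set
CutInput = Σ[ n ∈ ℕ ] Graph n × Subset n

encCutInput : CutInput → Tree
encCutInput (n , G , T) = node (encMatrix (nbrs G)) (encSubset T)

encCut : (i : CutInput) → VertexCut (proj₁ (proj₂ i)) → Tree
encCut _ C = node (encSubset A) (node (encSubset X) (encSubset B))
  where open VertexCut C

-- α is the approximation factor of some polynomial-time algorithm for
-- vertex sparsest cut in planar graphs.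
SparsestCutFactor : ℚ → Set
SparsestCutFactor α =
  PolyTimeSolvable encCutInput encCut
    (λ (_ , G , _) → Planar G)
    (λ (_ , _ , T) C → ApproxSparsest T α C)

-- A real number α, given by the predicate α ≤ q on rationals q.
UpperCut : Set₁
UpperCut = ℚ → Set

WellLinked : {n : ℕ} {G : Graph n} → Subgraph G → UpperCut → (Fin n → Set) → Set
WellLinked {n} H α≤ IsT =
  ∀ (T₁ T₂ : Subset n) →
  (∀ {v} → v ∈ T₁ → IsT v) → (∀ {v} → v ∈ T₂ → IsT v) →
  Empty (T₁ ∩ T₂) → ∣ T₁ ∣ ≡ ∣ T₂ ∣ →
  -- nothing is demanded of empty sets
  .{{_ : NonZero ∣ T₁ ∣}} →
  Σ[ Ps ∈ List (List (Fin n)) ]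
    (All (λ P → ∃[ s ] ∃[ t ] (s ∈ T₁ × t ∈ T₂ × IsPath H s t P)) Ps
     × AllPairs Disjoint Ps
     × α≤ (+ length Ps / ∣ T₁ ∣))

-- r ≤ s · log₂ k for nonnegative r and s: writing r = a / b and s = c / d,
-- this says a d ≤ c b log₂ k.
_≤_·log₂_ : ℚ → ℚ → ℕ → Set
r ≤ s ·log₂ k =
  2 ℕ.^ (ℤ.∣ ↥ r ∣ ℕ.* ↧ₙ s) ℕ.≤ k ℕ.^ (ℤ.∣ ↥ s ∣ ℕ.* ↧ₙ r)

-- The real w / (512 · α · log₂ k), for w, α > 0 and k ≥ 2; it is only ever
-- compared with nonnegative rationals.
α-WL : (w α : ℚ) (k : ℕ) → UpperCut
α-WL w α k q = w ≤ q ℚ.* ((+ 512 / 1) ℚ.* α) ·log₂ k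

Demands : ℕ → ℕ → Set
Demands n m = Vec (Fin n × Fin n) m

module _ {n m : ℕ} (M : Demands n m) where

  source target : Fin m → Fin n
  source i = proj₁ (lookup M i)
  target i = proj₂ (lookup M i)

  _Endpoint_ : Fin n → Fin m → Set
  v Endpoint i = v ≡ source i ⊎ v ≡ target i

  TerminalOf : Subset m → Fin n → Set
  TerminalOf J v = ∃[ i ] (i ∈ J × v Endpoint i)

sumℚ : List ℚ → ℚ
sumℚ = foldr ℚ._+_ 0ℚ

-- The flow of each pair is given by its decomposition into weighted paths.
record Flow {n m : ℕ} (G : Graph n) (M : Demands n m) (w : ℚ) : Set where
  open DecMembership (Finₚ._≟_ {n}) using (_∈?_)
  field
    paths    : Fin m → List (List (Fin n) × ℚ)
    routes   : ∀ i → All (λ (P , f) → IsPath (whole G) (source M i) (target M i) P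
                                      × 0ℚ ℚ.≤ f) (paths i)
    value    : ∀ i → sumℚ (map proj₂ (paths i)) ≡ w
    capacity : ∀ v → sumℚ (map proj₂ (filter (λ (P , _) → v ∈? P)
                                             (concatMap paths (allFin m)))) ℚ.≤ 1ℚ

record Instance : Set where
  field
    {n} {m} : ℕ
    graph   : Graph n
    pairs   : Demands n m
    k       : ℕ
    w       : ℚ

record Admissible (I : Instance) : Set where
  open Instance I
  field
    planar : Planar graph
    once   : ∀ {v i j} → _Endpoint_ pairs v i → _Endpoint_ pairs v j → i ≡ j
    deg1   : ∀ {v i} → _Endpoint_ pairs v i → degree graph v ≡ 1
    m≤k    : m ℕ.≤ k
    -- log₂ k is nonzero
    2≤k    : 2 ℕ.≤ k
    0<w    : 0ℚ ℚ.< w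
    w≤1    : w ℚ.≤ 1ℚ
    flow   : Flow graph pairs w

-- The subgraphs, each with a set of demand pairs given by their indices.
Clusters : Instance → Set
Clusters I = List (Subgraph graph × Subset m)
  where open Instance I

encInstance : Instance → Tree
encInstance I =
  node (encMatrix (nbrs graph))
  (node (encVec (λ (s , t) → node (encFin s) (encFin t)) pairs)
  (node (encℕ k) (encℚ w)))
  where open Instance I

encClusters : (I : Instance) → Clusters I → Tree
encClusters I =
  encList (λ (H , J) → node (node (encSubset (verts H)) (encMatrix (adj H)))
                            (encSubset J))

record IsDecomposition (α : ℚ) (I : Instance) (Gs : Clusters I) : Set where
  open Instance I

  H : Fin (length Gs) → Subgraph graph
  H j = proj₁ (List.lookup Gs j)

  𝓜 : Fin (length Gs) → Subset m
  𝓜 j = proj₂ (List.lookup Gs j)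

  field
    disjoint   : ∀ {j j′} → j ≢ j′ → Empty (verts (H j) ∩ verts (H j′))
    terminals  : ∀ j {v} → TerminalOf pairs (𝓜 j) v → v ∈ verts (H j)
    wellLinked : ∀ j → WellLinked (H j) (α-WL w α k) (TerminalOf pairs (𝓜 j))
    noEdge     : ∀ {j j′} → j ≢ j′ → ∀ {u v} →
                 u ∈ verts (H j) → v ∈ verts (H j′) → v ∉ nbrs graph u
    manyPairs  : 63 ℕ.* m ℕ.≤ 64 ℕ.* List.sum (map (λ (_ , J) → ∣ J ∣) Gs)
    fewLost    : (+ ∣ ∁ (⋃ (map (λ (H , _) → verts H) Gs)) ∣ / 1)
                 ℚ.≤ w ℚ.* (+ m / 64)

{-# OPTIONS --safe #-}
module Submission where

-- Start with the whole vertex set and keep splitting a cluster S along the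
-- cut (A, X, B) that the sparsest-cut oracle finds for the graph G[S] and the
-- terminals T of the demand pairs inside S, as long as its sparsity is below
-- w / (512 L), where L approximates log₂ k from below.  A cluster that is not
-- split is well-linked: by Menger's theorem, too few disjoint paths between
-- T₁ and T₂ would give a vertex cut sparser than the oracle allows.  A split
-- removes at most w / (512 L) times the number of terminals that are on the
-- smaller side or in X; a terminal is at most log₂ (2m) times on the smaller
-- side, so at most w m / 64 vertices are removed in total.  All the flow of a
-- separated pair passes through removed vertices, each of capacity 1, hence
-- at most m / 64 pairs are separated.
--
-- The only arithmetic on the possibly exponentially large numbers of the
-- input is the test against w / (512 L).

open import Defs
open import Algebra.Properties.CommutativeSemigroup using (interchange)
open import Data.Bool.Base using (Bool; true; false; _∧_; _∨_) renaming (if_then_else_ to ifᵇ_then_else_)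
open import Data.Fin.Base using (Fin; toℕ) renaming (zero to fzero; suc to fsuc)
import Data.Fin.Properties as Finₚ
open import Data.Fin.Subset using (Subset; inside; outside; _∈_; _∉_; _⊆_; _∩_; _∪_; _-_; ∁; ⋃; ⊥; ⊤; ⁅_⁆; ∣_∣)
open import Data.Fin.Subset.Properties
open import Data.Integer.Base as ℤ using (-[1+_])
import Data.Integer.Properties as ℤₚ
open import Data.List.Base as List
  using (List; []; _∷_; _++_; _ʳ++_; allFin; cartesianProduct; concat; concatMap; filter; foldl; length; map; reverse)
open import Data.List.Membership.Propositional using (find; lose) renaming (_∈_ to _∈ᴸ_)
open import Data.List.Membership.Propositional.Properties
  using (∈-++⁻; ∈-allFin; ∈-cartesianProduct⁺; ∈-filter⁺; ∈-filter⁻; ∈-lookup; ∈-map⁺; ∈-map⁻)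
import Data.List.Membership.DecPropositional as DecMembership
open import Data.List.Properties
  using (++-assoc; ++-identityʳ; concatMap-++; length-++; length-map; map-id; map-∘; reverse-involutive; ʳ++-defn)
open import Data.List.Relation.Binary.Disjoint.Propositional using (Disjoint)
open import Data.List.Relation.Unary.All as All using (All; []; _∷_)
import Data.List.Relation.Unary.All.Properties as Allₚ
open import Data.List.Relation.Unary.AllPairs as AllPairs using (AllPairs; []; _∷_)
import Data.List.Relation.Unary.AllPairs.Properties as AllPairsₚ
open import Data.List.Relation.Unary.Any as Any using (Any; here; there)
import Data.List.Relation.Unary.Any.Properties as Anyₚ
open import Data.List.Relation.Unary.Linked using (Linked; []; [-]; _∷_)
open import Data.List.Relation.Unary.Unique.Propositional using (Unique)
import Data.List.Relation.Unary.Unique.Propositional.Properties as Uniqueₚ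
open import Data.Maybe.Base using (just)
open import Data.Nat.Base as ℕ
  using (ℕ; zero; suc; pred; NonZero; _+_; _*_; _∸_; _⊓_; _⊔_; _^_; _≤_; _<_; z≤n; s≤s; ⌊_/2⌋; ⌈_/2⌉)
open import Data.Nat.Binary.Base as ℕᵇ using (ℕᵇ; 2[1+_]; 1+[2_])
import Data.Nat.Binary.Properties as ℕᵇₚ
open import Data.Nat.ListAction using (sum)
open import Data.Nat.Properties as ℕₚ hiding (_≟_)
open import Data.Nat.Tactic.RingSolver using (solve-∀)
open import Data.Product.Base using (Σ; Σ-syntax; ∃-syntax; _×_; _,_; proj₁; proj₂; uncurry)
open import Data.Rational.Base as ℚ using (ℚ; 0ℚ; 1ℚ; ↥_; ↧ₙ_; _/_)
import Data.Rational.Properties as ℚₚ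
open import Data.Rational.Unnormalised.Base as ℚᵘ using (mkℚᵘ; *≤*; *≡*)
import Data.Rational.Unnormalised.Properties as ℚᵘₚ
open import Data.Sum.Base using (_⊎_; inj₁; inj₂; [_,_]′) renaming (map to map-⊎)
open import Data.Unit.Base using (tt) renaming (⊤ to 𝟙)
open import Data.Vec.Base as Vec using (Vec; []; _∷_; lookup; tabulate; toList)
open import Data.Vec.Membership.Propositional.Properties using () renaming (∈-lookup to ∈ⱽ-lookup; ∈-toList⁺ to ∈ⱽ-toList⁺)
open import Data.Vec.Properties using (length-toList; lookup-map; lookup⇒[]=; map-const; toList-map; []=⇒lookup)
open import Function.Base using (_∘_; flip; id)
open import Function.Bundles using (_⇔_; mk⇔; Equivalence)
open import Relation.Binary.PropositionalEquality
open import Relation.Nullary using (¬_; yes; no; contradiction)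

-- Polynomial-time computations

infixl 6 _⊕_
infixl 7 _⊗_

-- The program never consults the factor α. It compares cuts with `w / (512 log k)` alone, and α
-- enters only in the analysis, when the oracle's cut of a cluster that is kept is compared with the
-- cut from Menger's theorem. The constant is `512 = 64 · 2 · 4`: there are at most `2 m` terminals,
-- each is charged at most `4 log k` times, and the total is to be `w m / 64`. Every call of the
-- oracle is made on a graph with all `n` vertices, the discarded ones being isolated. So the vertex
-- type and the drawing persist, and with them planarity. The obstacle to polynomial time is that a
-- loop is polynomial only if its states are, and a round of splitting may double the list of
-- clusters. Hence the number of clusters needs a bound known in advance. It is `2 n + 1` and comes
-- from charging every split to vertices that it removes or separates. The same progress shows that
-- `n` rounds suffice, since each side of a split has fewer vertices than the set that was split.

data Pol : Set where
  con     : ℕ → Pol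
  var     : Pol
  _⊕_ _⊗_ : Pol → Pol → Pol

⟦_⟧ : Pol → ℕ → ℕ
⟦ con c ⟧ n = c
⟦ var   ⟧ n = n
⟦ p ⊕ q ⟧ n = ⟦ p ⟧ n + ⟦ q ⟧ n
⟦ p ⊗ q ⟧ n = ⟦ p ⟧ n * ⟦ q ⟧ n

⟦⟧-mono : ∀ p {m n} → m ≤ n → ⟦ p ⟧ m ≤ ⟦ p ⟧ n
⟦⟧-mono (con c) m≤n = ≤-refl
⟦⟧-mono var     m≤n = m≤n
⟦⟧-mono (p ⊕ q) m≤n = +-mono-≤ (⟦⟧-mono p m≤n) (⟦⟧-mono q m≤n)
⟦⟧-mono (p ⊗ q) m≤n = *-mono-≤ (⟦⟧-mono p m≤n) (⟦⟧-mono q m≤n)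

infixr 9 _⟨_⟩ₚ
-- Substitution is needed because the second of two programs run in sequence is timed by the size of
-- its own input, which is itself bounded by a polynomial in the original size.
_⟨_⟩ₚ : Pol → Pol → Pol
con c   ⟨ r ⟩ₚ = con c
var     ⟨ r ⟩ₚ = r
(p ⊕ q) ⟨ r ⟩ₚ = p ⟨ r ⟩ₚ ⊕ q ⟨ r ⟩ₚ
(p ⊗ q) ⟨ r ⟩ₚ = p ⟨ r ⟩ₚ ⊗ q ⟨ r ⟩ₚ

⟦⟧-subst : ∀ p r n → ⟦ p ⟨ r ⟩ₚ ⟧ n ≡ ⟦ p ⟧ (⟦ r ⟧ n)
⟦⟧-subst (con c) r n = refl
⟦⟧-subst var     r n = refl
⟦⟧-subst (p ⊕ q) r n = cong₂ _+_ (⟦⟧-subst p r n) (⟦⟧-subst q r n)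
⟦⟧-subst (p ⊗ q) r n = cong₂ _*_ (⟦⟧-subst p r n) (⟦⟧-subst q r n)

monomial : ℕ → ℕ → Pol
monomial a zero    = con a
monomial a (suc b) = var ⊗ monomial a b

⟦monomial⟧ : ∀ a b n → ⟦ monomial a b ⟧ n ≡ a * n ^ b
⟦monomial⟧ a zero    n = sym (*-identityʳ a)
⟦monomial⟧ a (suc b) n = begin
  n * ⟦ monomial a b ⟧ n ≡⟨ cong (n *_) (⟦monomial⟧ a b n) ⟩
  n * (a * n ^ b)        ≡⟨ *-assoc n a _ ⟨
  n * a * n ^ b          ≡⟨ cong (_* n ^ b) (*-comm n a) ⟩
  a * n * n ^ b          ≡⟨ *-assoc a n _ ⟩
  a * (n * n ^ b)        ∎
  where open ≡-Reasoning

coeff deg : Pol → ℕ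
coeff (con c) = c
coeff var     = 1
coeff (p ⊕ q) = coeff p + coeff q
coeff (p ⊗ q) = coeff p * coeff q
deg (con c) = 0
deg var     = 1
deg (p ⊕ q) = deg p + deg q
deg (p ⊗ q) = deg p + deg q

-- The form `a * n ^ b` is the one that `PolyTimeSolvable` asks for. Adding the degrees in a sum is
-- wasteful, but for `n ≥ 1` a larger exponent does no harm.
⟦⟧≤monomial : ∀ p n → .{{NonZero n}} → ⟦ p ⟧ n ≤ coeff p * n ^ deg p
⟦⟧≤monomial (con c) n = ≤-reflexive (sym (*-identityʳ c))
⟦⟧≤monomial var     n = ≤-reflexive (sym (trans (*-identityˡ _) (*-identityʳ n)))
⟦⟧≤monomial (p ⊕ q) n = begin
  ⟦ p ⟧ n + ⟦ q ⟧ n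
    ≤⟨ +-mono-≤ (⟦⟧≤monomial p n) (⟦⟧≤monomial q n) ⟩
  coeff p * n ^ deg p + coeff q * n ^ deg q
    ≤⟨ +-mono-≤ (*-monoʳ-≤ (coeff p) (^-monoʳ-≤ n (m≤m+n (deg p) (deg q))))
                (*-monoʳ-≤ (coeff q) (^-monoʳ-≤ n (m≤n+m (deg q) (deg p)))) ⟩
  coeff p * n ^ (deg p + deg q) + coeff q * n ^ (deg p + deg q)
    ≡⟨ *-distribʳ-+ _ (coeff p) (coeff q) ⟨
  (coeff p + coeff q) * n ^ (deg p + deg q) ∎
  where open ≤-Reasoning
⟦⟧≤monomial (p ⊗ q) n = begin
  ⟦ p ⟧ n * ⟦ q ⟧ n
    ≤⟨ *-mono-≤ (⟦⟧≤monomial p n) (⟦⟧≤monomial q n) ⟩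
  (coeff p * n ^ deg p) * (coeff q * n ^ deg q)
    ≡⟨ [m*n]*[o*p]≡[m*o]*[n*p] (coeff p) _ _ _ ⟩
  (coeff p * coeff q) * (n ^ deg p * n ^ deg q)
    ≡⟨ cong (coeff p * coeff q *_) (^-distribˡ-+-* n (deg p) (deg q)) ⟨
  (coeff p * coeff q) * n ^ (deg p + deg q) ∎
  where open ≤-Reasoning

size≥1 : ∀ x → 1 ≤ size x
size≥1 leaf       = s≤s z≤n
size≥1 (node x y) = s≤s z≤n

instance
  size-nonZero : ∀ {x} → NonZero (size x)
  size-nonZero {leaf}     = _
  size-nonZero {node _ _} = _

size-left : ∀ x → size (left x) ≤ size x
size-left leaf       = ≤-refl
size-left (node x y) = m≤n⇒m≤1+n (m≤m+n _ _)

size-right : ∀ x → size (right x) ≤ size x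
size-right leaf       = ≤-refl
size-right (node x y) = m≤n⇒m≤1+n (m≤n+m _ _)

-- Copies are charged by their size, so whatever the output has beyond the size of the input is paid
-- for in time. This bounds the input of the next program in a sequence.
size-result : ∀ {p x y t} → p ∶ x ⇓ y ⟨ t ⟩ → size y ≤ size x + t
size-result {x = x} ⇓skip = m≤m+n _ _
size-result {x = x} ⇓nil  = m≤n+m 1 (size x)
size-result {x = x} ⇓hd   = ≤-trans (size-left x) (m≤m+n _ _)
size-result {x = x} ⇓tl   = ≤-trans (size-right x) (m≤m+n _ _)
size-result {x = x} (⇓⨾ {y = y} {z} {s} {t} d d′) = begin
  size z               ≤⟨ size-result d′ ⟩
  size y + t           ≤⟨ +-monoˡ-≤ t (size-result d) ⟩
  size x + s + t       ≡⟨ +-assoc (size x) s t ⟩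
  size x + (s + t)     ≤⟨ +-monoʳ-≤ (size x) (n≤1+n _) ⟩
  size x + suc (s + t) ∎
  where open ≤-Reasoning
size-result {x = x} (⇓pair {y = y} {z} {s} {t} d d′) = begin
  suc (size y + size z)             ≤⟨ s≤s (+-mono-≤ (size-result d) (size-result d′)) ⟩
  suc (size x + s + (size x + t))   ≡⟨ cong suc (interchange +-commutativeSemigroup (size x) s (size x) t) ⟩
  suc (size x + size x + (s + t))   ≡⟨ cong suc (+-assoc (size x) _ _) ⟩
  suc (size x + (size x + (s + t))) ≡⟨ +-suc (size x) _ ⟨
  size x + suc (size x + (s + t))   ∎
  where open ≤-Reasoning
size-result {x = x} (⇓then {s = s} {t} d d′) =
  ≤-trans (size-result d′) (+-monoʳ-≤ (size x)
    (≤-trans (m≤n+m t s) (m≤n⇒m≤1+n (m≤n+m (s + t) (size x)))))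
size-result {x = x} (⇓else {s = s} {t} d d′) =
  ≤-trans (size-result d′) (+-monoʳ-≤ (size x)
    (≤-trans (m≤n+m t s) (m≤n⇒m≤1+n (m≤n+m (s + t) (size x)))))
size-result {x = x} (⇓done d) = m≤m+n _ _
size-result {x = x} (⇓again {v = v} {w} {s} {t} {u} d d′ d″) = begin
  size w                                ≤⟨ size-result d″ ⟩
  size v + u                            ≤⟨ +-monoˡ-≤ u (size-result d′) ⟩
  size x + t + u                        ≡⟨ +-assoc (size x) t u ⟩
  size x + (t + u)                      ≤⟨ +-monoʳ-≤ (size x) (≤-trans (m≤n+m (t + u) s)
                                             (m≤n⇒m≤1+n (m≤n+m (s + (t + u)) (size x)))) ⟩
  size x + suc (size x + (s + (t + u))) ∎
  where open ≤-Reasoning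

infix 3 _⊢_

-- Uniform polynomial-time computability of x γ from e γ, for γ ranging
-- over an arbitrary index type.  A promise is expressed by the choice of
-- that type.
record _⊢_ {Γ : Set} (e x : Γ → Tree) : Set where
  constructor computes
  field
    prog : Prog
    cost : Pol
    runs : ∀ γ → Σ[ t ∈ ℕ ] (prog ∶ e γ ⇓ x γ ⟨ t ⟩ × t ≤ ⟦ cost ⟧ (size (e γ)))

open _⊢_

private variable
  Γ Δ : Set
  e x y z : Γ → Tree

growth : e ⊢ x → Pol
growth d = var ⊕ cost d

size-growth : (d : e ⊢ x) → ∀ γ → size (x γ) ≤ ⟦ growth d ⟧ (size (e γ))
size-growth {e = e} d γ with t , run , t≤ ← runs d γ =
  ≤-trans (size-result run) (+-monoʳ-≤ (size (e γ)) t≤)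

-- The program sees only the tree `e γ`, so a change of index is free. In particular, further data
-- and proofs in the index may be forgotten.
reindex : (g : Δ → Γ) → e ⊢ x → e ∘ g ⊢ x ∘ g
reindex g d = computes (prog d) (cost d) (λ γ → runs d (g γ))

infixl 5 _then_
_then_ : e ⊢ x → x ⊢ y → e ⊢ y
_then_ {e = e} c d = computes (prog c ⨾ prog d)
  (con 1 ⊕ (cost c ⊕ cost d ⟨ growth c ⟩ₚ)) λ γ →
  let s , r₁ , s≤ = runs c γ
      t , r₂ , t≤ = runs d γ
  in suc (s + t) , ⇓⨾ r₁ r₂ , s≤s (+-mono-≤ s≤ (≤-trans t≤ (≤-trans
       (⟦⟧-mono (cost d) (size-growth c γ))
       (≤-reflexive (sym (⟦⟧-subst (cost d) (growth c) (size (e γ))))))))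

-- Correctness proofs enter here: the combinators produce some expression for the result, and a
-- pointwise equation replaces it by the intended one.
along : (∀ γ → x γ ≡ y γ) → e ⊢ x → e ⊢ y
along {x = x} {e = e} x≡y d = computes (prog d) (cost d) λ γ →
  let t , r , t≤ = runs d γ
  in t , subst (λ z → prog d ∶ e γ ⇓ z ⟨ t ⟩) (x≡y γ) r , t≤

same : e ⊢ e
same = computes skip (con 1) λ _ → 1 , ⇓skip , ≤-refl

empty : e ⊢ (λ _ → leaf)
empty = computes nil (con 1) λ _ → 1 , ⇓nil , ≤-refl

first : e ⊢ x → e ⊢ left ∘ x
first d = d then computes hd (con 1) λ _ → 1 , ⇓hd , ≤-refl

second : e ⊢ x → e ⊢ right ∘ x
second d = d then computes tl (con 1) λ _ → 1 , ⇓tl , ≤-refl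

pair : e ⊢ x → e ⊢ y → e ⊢ (λ γ → node (x γ) (y γ))
pair {e = e} c d = computes ⟨ prog c , prog d ⟩ (con 1 ⊕ (var ⊕ (cost c ⊕ cost d))) λ γ →
  let s , r₁ , s≤ = runs c γ
      t , r₂ , t≤ = runs d γ
  in _ , ⇓pair r₁ r₂ , s≤s (+-monoʳ-≤ (size (e γ)) (+-mono-≤ s≤ t≤))

caseTree : {A : Set} → Tree → A → A → A
caseTree leaf       x y = y
caseTree (node _ _) x y = x

branch : ∀ {c} → e ⊢ c → e ⊢ x → e ⊢ y → e ⊢ (λ γ → caseTree (c γ) (x γ) (y γ))
branch {e = e} {x = x} {y = y} {c = c} dc dx dy =
  computes (if prog dc then prog dx else prog dy)
    (con 1 ⊕ (var ⊕ (cost dc ⊕ (cost dx ⊕ cost dy)))) go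
  where
  go : ∀ γ → Σ[ t ∈ ℕ ] ((if prog dc then prog dx else prog dy) ∶ e γ ⇓ caseTree (c γ) (x γ) (y γ) ⟨ t ⟩
                          × t ≤ ⟦ con 1 ⊕ (var ⊕ (cost dc ⊕ (cost dx ⊕ cost dy))) ⟧ (size (e γ)))
  go γ with c γ | runs dc γ
  ... | leaf     | s , r , s≤ with t , r′ , t≤ ← runs dy γ =
    _ , ⇓else r r′ , s≤s (+-monoʳ-≤ (size (e γ)) (+-mono-≤ s≤ (≤-trans t≤ (m≤n+m _ _))))
  ... | node _ _ | s , r , s≤ with t , r′ , t≤ ← runs dx γ =
    _ , ⇓then r r′ , s≤s (+-monoʳ-≤ (size (e γ)) (+-mono-≤ s≤ (≤-trans t≤ (m≤m+n _ _))))

branchBool : {b : Γ → Bool} → e ⊢ encBool ∘ b → e ⊢ x → e ⊢ y →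
             e ⊢ (λ γ → ifᵇ b γ then x γ else y γ)
branchBool {x = x} {y = y} {b = b} dc dx dy = along (λ γ → eq (b γ)) (branch dc dx dy)
  where
  eq : ∀ {u v : Tree} c → caseTree (encBool c) u v ≡ (ifᵇ c then u else v)
  eq true  = refl
  eq false = refl

const-bool : (b : Bool) → e ⊢ (λ _ → encBool b)
const-bool true  = pair empty empty
const-bool false = empty

length≤size : ∀ {A : Set} (f : A → Tree) xs → length xs ≤ size (encList f xs)
length≤size f []       = z≤n
length≤size f (x ∷ xs) = s≤s (≤-trans (length≤size f xs) (m≤n+m _ _))

size-suffix : ∀ {A : Set} (f : A → Tree) ys {zs} → size (encList f zs) ≤ size (encList f (ys ++ zs))
size-suffix f []       = ≤-refl
size-suffix f (y ∷ ys) = m≤n⇒m≤1+n (≤-trans (size-suffix f ys) (m≤n+m _ _))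

-- A loop over a list is polynomial as soon as all intermediate states
-- have polynomial size.
module Fold {Γ : Set} {e : Γ → Tree}
            {A S : Γ → Set} {eA : ∀ γ → A γ → Tree} {eS : ∀ γ → S γ → Tree}
            {f : ∀ γ → S γ → A γ → S γ} {s₀ : ∀ γ → S γ} {xs : ∀ γ → List (A γ)}
            (d-xs   : e ⊢ (λ γ → encList (eA γ) (xs γ)))
            (d-s₀   : e ⊢ (λ γ → eS γ (s₀ γ)))
            (d-step : _⊢_ {Σ Γ λ γ → S γ × A γ}
                        (λ (γ , s , a) → node (node (e γ) (eS γ s)) (eA γ a))
                        (λ (γ , s , a) → eS γ (f γ s a)))
            (B : Pol)
            (bounded : ∀ γ ys zs → ys ++ zs ≡ xs γ →
                       size (eS γ (foldl (f γ) (s₀ γ) ys)) ≤ ⟦ B ⟧ (size (e γ)))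
  where

  private
    body : _⊢_ {Σ Γ λ γ → S γ × A γ × List (A γ)}
             (λ (γ , s , a , as) → node (encList (eA γ) (a ∷ as)) (node (e γ) (eS γ s)))
             (λ (γ , s , a , as) → node (encList (eA γ) as) (node (e γ) (eS γ (f γ s a))))
    body = pair (second (first same)) (pair (first (second same))
             (pair (second same) (first (first same))
              then reindex (λ (γ , s , a , as) → γ , s , a) d-step))

    loop : Prog
    -- The loop state is the remaining list together with environment and accumulator. The test `hd`
    -- returns the encoded list, which is `leaf` exactly when nothing remains.
    loop = while hd loop prog body

    -- Bounds in terms of the size of the initial loop state: `Mₚ` for the size of any state, `Kₚ`
    -- for the time of one iteration.
    Mₚ Kₚ : Pol
    Mₚ = con 1 ⊕ (var ⊕ (con 1 ⊕ (var ⊕ B)))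
    Kₚ = con 1 ⊕ (Mₚ ⊕ (con 1 ⊕ cost body ⟨ Mₚ ⟩ₚ))

    module _ (γ : Γ) where
      state : List (A γ) → List (A γ) → Tree
      state ys zs = node (encList (eA γ) zs) (node (e γ) (eS γ (foldl (f γ) (s₀ γ) ys)))

      n M K : ℕ
      n = size (state [] (xs γ))
      M = ⟦ Mₚ ⟧ n
      K = ⟦ Kₚ ⟧ n

      size-e : size (e γ) ≤ n
      size-e = m≤n⇒m≤1+n (≤-trans (m≤n⇒m≤1+n (m≤m+n _ _)) (m≤n+m _ (size (encList (eA γ) (xs γ)))))

      size-xs : size (encList (eA γ) (xs γ)) ≤ n
      size-xs = m≤n⇒m≤1+n (m≤m+n _ _)

      size-state : ∀ ys zs → ys ++ zs ≡ xs γ → size (state ys zs) ≤ M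
      size-state ys zs eq = s≤s (+-mono-≤
        (≤-trans (subst (λ l → size (encList (eA γ) zs) ≤ size (encList (eA γ) l)) eq (size-suffix _ ys)) size-xs)
        (s≤s (+-mono-≤ size-e (≤-trans (bounded γ ys zs eq) (⟦⟧-mono B size-e)))))

      foldl-snoc : ∀ s ys z → foldl (f γ) s (ys ++ z ∷ []) ≡ f γ (foldl (f γ) s ys) z
      foldl-snoc s []       z = refl
      foldl-snoc s (y ∷ ys) z = foldl-snoc (f γ s y) ys z

      iterates : ∀ ys zs → ys ++ zs ≡ xs γ →
                 Σ[ t ∈ ℕ ] (loop ∶ state ys zs ⇓ state (xs γ) [] ⟨ t ⟩
                             × t ≤ suc (length zs) * K)
      iterates ys [] eq with refl ← trans (sym (++-identityʳ ys)) eq =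
        _ , ⇓done ⇓hd , ≤-trans
          (s≤s (+-mono-≤ (size-state (xs γ) [] eq) (m≤m+n 1 _))) (m≤m+n K 0)
      iterates ys (z ∷ zs) eq
        with t , r , t≤ ← runs body (γ , foldl (f γ) (s₀ γ) ys , z , zs)
           | u , r′ , u≤ ← iterates (ys ++ z ∷ []) zs (trans (++-assoc ys (z ∷ []) zs) eq) =
        _ , ⇓again ⇓hd r″ r′ , (begin
          suc (size (state ys (z ∷ zs)) + (1 + (t + u)))
            ≤⟨ s≤s (+-mono-≤ (size-state ys (z ∷ zs) eq) (s≤s (+-mono-≤ t≤′ u≤))) ⟩
          suc (M + (1 + (⟦ cost body ⟨ Mₚ ⟩ₚ ⟧ n + suc (length zs) * K)))
            ≡⟨ cong suc (+-assoc M (1 + ⟦ cost body ⟨ Mₚ ⟩ₚ ⟧ n) _) ⟨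
          K + suc (length zs) * K ∎)
        where
        open ≤-Reasoning
        t≤′ : t ≤ ⟦ cost body ⟨ Mₚ ⟩ₚ ⟧ n
        t≤′ = ≤-trans t≤ (≤-trans (⟦⟧-mono (cost body) (size-state ys (z ∷ zs) eq))
                (≤-reflexive (sym (⟦⟧-subst (cost body) Mₚ n))))
        r″ : prog body ∶ state ys (z ∷ zs) ⇓ state (ys ++ z ∷ []) zs ⟨ t ⟩
        r″ = subst (λ w → prog body ∶ state ys (z ∷ zs) ⇓ node (encList (eA γ) zs) (node (e γ) (eS γ w)) ⟨ t ⟩)
               (sym (foldl-snoc (s₀ γ) ys z)) r

    looping : (λ γ → state γ [] (xs γ)) ⊢ (λ γ → state γ (xs γ) [])
    looping = computes loop ((con 1 ⊕ var) ⊗ Kₚ) λ γ →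
      let t , r , t≤ = iterates γ [] (xs γ) refl
      in t , r , ≤-trans t≤ (*-monoˡ-≤ (K γ) (s≤s (≤-trans (length≤size (eA γ) (xs γ)) (size-xs γ))))

  fold : e ⊢ (λ γ → eS γ (foldl (f γ) (s₀ γ) (xs γ)))
  fold = second (second (pair d-xs (pair same d-s₀) then looping))

open Fold public using (fold)

-- Lists and vectors

private variable
  𝔸 𝔹 : Γ → Set
  eA : ∀ γ → 𝔸 γ → Tree
  eB : ∀ γ → 𝔹 γ → Tree

weaken : {x : Γ → Tree} {y z : Σ Γ 𝔸 → Tree} → e ⊢ x →
          (λ (γ , a) → node (node (e γ) (y (γ , a))) (z (γ , a))) ⊢ x ∘ proj₁
weaken d = first (first same) then reindex proj₁ d

size-++ : {𝔸 : Set} (f : 𝔸 → Tree) → ∀ xs ys → size (encList f (xs ++ ys)) ≤ size (encList f xs) + size (encList f ys)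
size-++ f []       ys = n≤1+n _
size-++ f (x ∷ xs) ys = s≤s (≤-trans (+-monoʳ-≤ (size (f x)) (size-++ f xs ys))
                                     (≤-reflexive (sym (+-assoc (size (f x)) _ _))))

module _ {Γ : Set} {e : Γ → Tree}
         {𝔸 S : Γ → Set} {eA : ∀ γ → 𝔸 γ → Tree} {eS : ∀ γ → S γ → Tree}
         {f : ∀ γ → S γ → 𝔸 γ → S γ} {s₀ : ∀ γ → S γ} {xs : ∀ γ → List (𝔸 γ)} where

  -- When the growth in a step depends on the environment and the element but not on the state, the
  -- amounts of all steps merely add up. Most loops below need no other size invariant.
  foldGrowing :
    e ⊢ (λ γ → encList (eA γ) (xs γ)) →
    e ⊢ (λ γ → eS γ (s₀ γ)) →
    _⊢_ {Σ Γ λ γ → S γ × 𝔸 γ}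
        (λ (γ , s , a) → node (node (e γ) (eS γ s)) (eA γ a))
        (λ (γ , s , a) → eS γ (f γ s a)) →
    (P : Pol) →
    (∀ γ s a → size (eS γ (f γ s a)) ≤ size (eS γ s) + ⟦ P ⟧ (size (e γ) + size (eA γ a))) →
    e ⊢ (λ γ → eS γ (foldl (f γ) (s₀ γ) (xs γ)))
  foldGrowing d-xs d-s₀ d-step P grows =
    fold {f = f} d-xs d-s₀ d-step (growth d-s₀ ⊕ growth d-xs ⊗ P ⟨ var ⊕ growth d-xs ⟩ₚ) bounded
    where
    module _ (γ : Γ) where
      N : ℕ
      N = size (e γ)

      K : ℕ → ℕ
      K m = ⟦ P ⟧ (N + m)

      grown : ∀ s ys m → size (encList (eA γ) ys) ≤ m →
              size (eS γ (foldl (f γ) s ys)) ≤ size (eS γ s) + length ys * K m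
      grown s []       m ys≤m = m≤m+n _ _
      grown s (y ∷ ys) m ys≤m = begin
        size (eS γ (foldl (f γ) (f γ s y) ys))
          ≤⟨ grown (f γ s y) ys m (≤-trans (m≤n⇒m≤1+n (m≤n+m _ _)) ys≤m) ⟩
        size (eS γ (f γ s y)) + length ys * K m
          ≤⟨ +-monoˡ-≤ _ (grows γ s y) ⟩
        size (eS γ s) + K (size (eA γ y)) + length ys * K m
          ≤⟨ +-monoˡ-≤ (length ys * K m) (+-monoʳ-≤ (size (eS γ s))
               (⟦⟧-mono P (+-monoʳ-≤ N (≤-trans (m≤n⇒m≤1+n (m≤m+n _ _)) ys≤m)))) ⟩
        size (eS γ s) + K m + length ys * K m
          ≡⟨ +-assoc (size (eS γ s)) _ _ ⟩
        size (eS γ s) + suc (length ys) * K m ∎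
        where open ≤-Reasoning

    bounded : ∀ γ ys zs → ys ++ zs ≡ xs γ → _
    bounded γ ys zs eq = begin
      size (eS γ (foldl (f γ) (s₀ γ) ys))
        ≤⟨ grown γ (s₀ γ) ys m ys≤m ⟩
      size (eS γ (s₀ γ)) + length ys * K γ m
        ≤⟨ +-mono-≤ (size-growth d-s₀ γ) (*-monoˡ-≤ (K γ m)
             (≤-trans (length≤size (eA γ) ys) ys≤m)) ⟩
      ⟦ growth d-s₀ ⟧ (N γ) + m * K γ m
        ≡⟨ cong (λ k → ⟦ growth d-s₀ ⟧ (N γ) + m * k) (⟦⟧-subst P (var ⊕ growth d-xs) (N γ)) ⟨
      ⟦ growth d-s₀ ⊕ growth d-xs ⊗ P ⟨ var ⊕ growth d-xs ⟩ₚ ⟧ (N γ) ∎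
      where
      open ≤-Reasoning
      m : ℕ
      m = ⟦ growth d-xs ⟧ (N γ)
      size-prefix : ∀ us vs → size (encList (eA γ) us) ≤ size (encList (eA γ) (us ++ vs))
      size-prefix []       vs = size≥1 (encList (eA γ) vs)
      size-prefix (u ∷ us) vs = s≤s (+-monoʳ-≤ (size (eA γ u)) (size-prefix us vs))
      ys≤m : size (encList (eA γ) ys) ≤ m
      ys≤m = ≤-trans (size-prefix ys zs)
               (≤-trans (≤-reflexive (cong (size ∘ encList (eA γ)) eq)) (size-growth d-xs γ))

reverseOnto : {xs ys : ∀ γ → List (𝔸 γ)} →
              e ⊢ (λ γ → encList (eA γ) (xs γ)) → e ⊢ (λ γ → encList (eA γ) (ys γ)) →
              e ⊢ (λ γ → encList (eA γ) (xs γ ʳ++ ys γ))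
reverseOnto {e = e} {eA = eA} d-xs d-ys =
  foldGrowing {eS = λ γ → encList (eA γ)} {f = λ _ → flip _∷_} d-xs d-ys
    (pair (second same) (second (first same)))
    (con 1 ⊕ var) λ γ s a →
      let p = size (eA γ a); q = size (encList (eA γ) s) in
      ≤-trans (s≤s (≤-trans (≤-reflexive (+-comm p q)) (+-monoʳ-≤ q (m≤n+m p (size (e γ))))))
              (≤-reflexive (sym (+-suc q _)))

append : {xs ys : ∀ γ → List (𝔸 γ)} →
         e ⊢ (λ γ → encList (eA γ) (xs γ)) → e ⊢ (λ γ → encList (eA γ) (ys γ)) →
         e ⊢ (λ γ → encList (eA γ) (xs γ ++ ys γ))
append {eA = eA} {xs = xs} {ys} d-xs d-ys =
  along (λ γ → cong (encList (eA γ)) (eq (xs γ) (ys γ)))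
    (reverseOnto {eA = eA} (reverseOnto {eA = eA} {ys = λ _ → []} d-xs empty) d-ys)
  where
  eq : {X : Set} (us vs : List X) → reverse us ʳ++ vs ≡ us ++ vs
  eq us vs = trans (ʳ++-defn (reverse us)) (cong (_++ vs) (reverse-involutive us))

mapList : {g : ∀ γ → 𝔸 γ → 𝔹 γ} {xs : ∀ γ → List (𝔸 γ)} →
          _⊢_ {Σ Γ 𝔸} (λ (γ , a) → node (e γ) (eA γ a)) (λ (γ , a) → eB γ (g γ a)) →
          e ⊢ (λ γ → encList (eA γ) (xs γ)) →
          e ⊢ (λ γ → encList (eB γ) (map (g γ) (xs γ)))
mapList {e = e} {eA = eA} {eB = eB} {g = g} {xs} d d-xs =
  along (λ γ → cong (encList (eB γ)) (eq (g γ) (xs γ)))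
    (reverseOnto {eA = eB} {ys = λ _ → []}
      (foldGrowing {eS = λ γ → encList (eB γ)} {f = λ γ bs a → g γ a ∷ bs} {s₀ = λ _ → []} d-xs empty
        (pair (pair (first (first same)) (second same) then reindex (λ (γ , _ , a) → γ , a) d)
              (second (first same)))
        (con 1 ⊕ growth d ⟨ con 1 ⊕ var ⟩ₚ)
        λ γ bs a → let q = size (encList (eB γ) bs) in begin
          suc (size (eB γ (g γ a)) + q)
            ≤⟨ s≤s (+-monoˡ-≤ q (size-growth d (γ , a))) ⟩
          suc (⟦ growth d ⟧ (suc (size (e γ) + size (eA γ a))) + q)
            ≡⟨ cong (λ k → suc (k + q)) (⟦⟧-subst (growth d) (con 1 ⊕ var) _) ⟨
          suc (⟦ growth d ⟨ con 1 ⊕ var ⟩ₚ ⟧ (size (e γ) + size (eA γ a)) + q)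
            ≡⟨ +-comm _ q ⟩
          q + suc (⟦ growth d ⟨ con 1 ⊕ var ⟩ₚ ⟧ (size (e γ) + size (eA γ a))) ∎)
      empty)
  where
  open ≤-Reasoning
  foldl-map : {X Y : Set} (h : X → Y) → ∀ us acc → foldl (λ bs a → h a ∷ bs) acc us ≡ map h us ʳ++ acc
  foldl-map h []       acc = refl
  foldl-map h (u ∷ us) acc = foldl-map h us (h u ∷ acc)
  eq : {X Y : Set} (h : X → Y) → ∀ us → reverse (foldl (λ bs a → h a ∷ bs) [] us) ≡ map h us
  eq h us = trans (cong reverse (foldl-map h us [])) (reverse-involutive (map h us))

concatList : {xss : ∀ γ → List (List (𝔸 γ))} →
             e ⊢ (λ γ → encList (encList (eA γ)) (xss γ)) →
             e ⊢ (λ γ → encList (eA γ) (concat (xss γ)))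
concatList {e = e} {eA = eA} {xss = xss} d =
  along (λ γ → cong (encList (eA γ)) (eq [] (xss γ)))
    (foldGrowing {eA = λ γ → encList (eA γ)} {eS = λ γ → encList (eA γ)} {f = λ _ → _++_} {s₀ = λ _ → []} d empty
      (append {eA = λ (γ , _) → eA γ} (second (first same)) (second same))
      var λ γ s a → ≤-trans (size-++ (eA γ) s a) (+-monoʳ-≤ (size (encList (eA γ) s)) (m≤n+m _ (size (e γ)))))
  where
  eq : {X : Set} (acc : List X) → ∀ uss → foldl _++_ acc uss ≡ acc ++ concat uss
  eq acc []         = sym (++-identityʳ acc)
  eq acc (us ∷ uss) = trans (eq (acc ++ us) uss) (++-assoc acc us (concat uss))

concatMapList : {g : ∀ γ → 𝔸 γ → List (𝔹 γ)} {xs : ∀ γ → List (𝔸 γ)} →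
  _⊢_ {Σ Γ 𝔸} (λ (γ , a) → node (e γ) (eA γ a)) (λ (γ , a) → encList (eB γ) (g γ a)) →
  e ⊢ (λ γ → encList (eA γ) (xs γ)) →
  e ⊢ (λ γ → encList (eB γ) (concatMap (g γ) (xs γ)))
concatMapList {eA = eA} {eB = eB} {g = g} d d-xs =
  concatList {eA = eB} (mapList {eA = eA} {eB = λ γ → encList (eB γ)} {g = g} d d-xs)

mapVec : {n : Γ → ℕ} {g : ∀ γ → 𝔸 γ → 𝔹 γ} {xs : ∀ γ → Vec (𝔸 γ) (n γ)} →
         _⊢_ {Σ Γ 𝔸} (λ (γ , a) → node (e γ) (eA γ a)) (λ (γ , a) → eB γ (g γ a)) →
         e ⊢ (λ γ → encVec (eA γ) (xs γ)) →
         e ⊢ (λ γ → encVec (eB γ) (Vec.map (g γ) (xs γ)))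
mapVec {eA = eA} {eB = eB} {g = g} {xs} d d-xs =
  along (λ γ → cong (encList (eB γ)) (sym (toList-map (g γ) (xs γ))))
    (mapList {eA = eA} {eB = eB} {g = g} d d-xs)

encPair : {X Y : Set} → (X → Tree) → (Y → Tree) → X × Y → Tree
encPair f g (x , y) = node (f x) (g y)

-- A loop over `xs` that carries the encoded rest of `ys` as a bare tree. As `left` and `right` are
-- total on trees, the step needs no case for an empty rest; the equal lengths enter through `tags`.
zipVec : {n : Γ → ℕ} {xs : ∀ γ → Vec (𝔸 γ) (n γ)} {ys : ∀ γ → Vec (𝔹 γ) (n γ)} →
         e ⊢ (λ γ → encVec (eA γ) (xs γ)) → e ⊢ (λ γ → encVec (eB γ) (ys γ)) →
         e ⊢ (λ γ → encVec (encPair (eA γ) (eB γ)) (Vec.zip (xs γ) (ys γ)))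
zipVec {𝔸 = 𝔸} {e = e} {eA = eA} {eB = eB} {xs = xs} {ys} d-xs d-ys =
  along (λ γ → eq (eA γ) (eB γ) (xs γ) (ys γ))
    (reverseOnto {eA = λ γ → encPair (eA γ) id} {ys = λ _ → []}
      (second (foldGrowing {eS = λ γ → encPair id (encList (encPair (eA γ) id))} {f = λ γ → step {𝔸 γ}}
        {s₀ = λ γ → encVec (eB γ) (ys γ) , []} d-xs
        (pair d-ys empty)
        (pair (second (first (second (first same))))
              (pair (pair (second same) (first (first (second (first same))))) (second (second (first same)))))
        (con 3 ⊕ var) grows))
      empty)
  where
  step : {X : Set} → Tree × List (X × Tree) → X → Tree × List (X × Tree)
  step (t , ps) x = right t , (x , left t) ∷ ps
  children : ∀ t → size (right t) + size (left t) ≤ suc (size t)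
  children leaf       = ≤-refl
  children (node x y) = m≤n⇒m≤1+n (m≤n⇒m≤1+n (≤-reflexive (+-comm (size y) (size x))))
  grows : ∀ γ s a → _
  grows γ (t , ps) a = let p = size (encList (encPair (eA γ) id) ps); q = size (eA γ a) in begin
    suc (size (right t) + suc (suc (q + size (left t)) + p))
      ≡⟨ arith (size (right t)) (size (left t)) p q ⟩
    3 + (size (right t) + size (left t) + p + q)
      ≤⟨ +-monoʳ-≤ 3 (+-monoˡ-≤ q (+-monoˡ-≤ p (children t))) ⟩
    3 + (suc (size t) + p + q)
      ≤⟨ +-monoʳ-≤ 3 (+-monoʳ-≤ (suc (size t) + p) (m≤n+m q (size (e γ)))) ⟩
    3 + (suc (size t) + p + (size (e γ) + q))
      ≡⟨ arith′ (size t) p (size (e γ) + q) ⟩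
    suc (size t + p) + (3 + (size (e γ) + q)) ∎
    where
    open ≤-Reasoning
    arith : ∀ r l p q → suc (r + suc (suc (q + l) + p)) ≡ 3 + (r + l + p + q)
    arith = solve-∀
    arith′ : ∀ t p q → 3 + (suc t + p + q) ≡ suc (t + p) + (3 + q)
    arith′ = solve-∀
  eq : {X Y : Set} (f : X → Tree) (g : Y → Tree) → ∀ {n} (us : Vec X n) (vs : Vec Y n) →
       encList (encPair f id) (reverse (proj₂ (foldl step (encVec g vs , []) (toList us))))
       ≡ encVec (encPair f g) (Vec.zip us vs)
  eq {X} f g us vs = trans (cong (encList (encPair f id)) (reverse-foldl us vs [])) (tagged us vs)
    where
    tags : ∀ {n} → Vec X n → Vec _ n → List (X × Tree)
    tags []       []       = []
    tags (u ∷ us) (v ∷ vs) = (u , g v) ∷ tags us vs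
    reverse-foldl : ∀ {n} (us : Vec X n) vs acc →
      reverse (proj₂ (foldl step (encVec g vs , acc) (toList us))) ≡ acc ʳ++ tags us vs
    reverse-foldl []       []       acc = refl
    reverse-foldl (u ∷ us) (v ∷ vs) acc = reverse-foldl us vs ((u , g v) ∷ acc)
    tagged : ∀ {n} (us : Vec X n) vs → encList (encPair f id) (tags us vs) ≡ encVec (encPair f g) (Vec.zip us vs)
    tagged []       []       = refl
    tagged (u ∷ us) (v ∷ vs) = cong (node _) (tagged us vs)

-- Unary numbers and subsets

iter : {S : Set} → ℕ → (S → S) → S → S
iter zero    f s = s
iter (suc k) f s = iter k f (f s)

iter-comm : {S : Set} (f : S → S) → ∀ k s → iter k f (f s) ≡ f (iter k f s)
iter-comm f zero    s = refl
iter-comm f (suc k) s = iter-comm f k (f s)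

-- A unary number is literally the encoding of a list of that many `leaf`s, so counting loops are
-- list loops.
iterate : {S : Γ → Set} {eS : ∀ γ → S γ → Tree} {f : ∀ γ → S γ → S γ} {s₀ : ∀ γ → S γ} {k : Γ → ℕ} →
          e ⊢ encUnary ∘ k → e ⊢ (λ γ → eS γ (s₀ γ)) →
          _⊢_ {Σ Γ S} (λ (γ , s) → node (e γ) (eS γ s)) (λ (γ , s) → eS γ (f γ s)) →
          (P : Pol) →
          (∀ γ s → size (eS γ (f γ s)) ≤ size (eS γ s) + ⟦ P ⟧ (size (e γ))) →
          e ⊢ (λ γ → eS γ (iter (k γ) (f γ) (s₀ γ)))
iterate {e = e} {eS = eS} {f = f} {s₀} {k} d-k d-s₀ d-step P grows =
  along (λ γ → cong (eS γ) (foldl≡iter (f γ) (k γ) (s₀ γ)))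
    (foldGrowing {𝔸 = λ _ → 𝟙} {eA = λ _ _ → leaf} {f = λ γ s _ → f γ s} {xs = λ γ → List.replicate (k γ) tt}
      (along (λ γ → ones (k γ)) d-k) d-s₀
      (first same then reindex (λ (γ , s , _) → γ , s) d-step)
      P λ γ s _ → ≤-trans (grows γ s) (+-monoʳ-≤ (size (eS γ s)) (⟦⟧-mono P (m≤m+n _ _))))
  where
  ones : ∀ k → encUnary k ≡ encList (λ _ → leaf) (List.replicate k tt)
  ones zero    = refl
  ones (suc k) = cong (node leaf) (ones k)
  foldl≡iter : {S : Set} (f : S → S) → ∀ k s → foldl (λ s _ → f s) s (List.replicate k tt) ≡ iter k f s
  foldl≡iter f zero    s = refl
  foldl≡iter f (suc k) s = foldl≡iter f k (f s)

plus : {a b : Γ → ℕ} → e ⊢ encUnary ∘ a → e ⊢ encUnary ∘ b → e ⊢ (λ γ → encUnary (a γ + b γ))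
plus {a = a} {b} d-a d-b = along (λ γ → cong encUnary (eq (a γ) (b γ)))
  (iterate {eS = λ _ → encUnary} {f = λ _ → suc} d-a d-b (pair empty (second same)) (con 2)
    λ γ s → ≤-reflexive (+-comm 2 (size (encUnary s))))
  where
  eq : ∀ a b → iter a suc b ≡ a + b
  eq zero    b = refl
  eq (suc a) b = trans (eq a (suc b)) (+-suc a b)

right-encUnary : ∀ n → right (encUnary n) ≡ encUnary (pred n)
right-encUnary zero    = refl
right-encUnary (suc n) = refl

monus : {a b : Γ → ℕ} → e ⊢ encUnary ∘ a → e ⊢ encUnary ∘ b → e ⊢ (λ γ → encUnary (a γ ∸ b γ))
monus {a = a} {b} d-a d-b = along (λ γ → cong encUnary (eq (b γ) (a γ)))
  (iterate {eS = λ _ → encUnary} {f = λ _ → pred} d-b d-a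
    (along (λ (γ , s) → right-encUnary s) (second (second same))) (con 0)
    λ γ s → ≤-trans (≤-reflexive (cong size (sym (right-encUnary s))))
              (≤-trans (size-right (encUnary s)) (m≤m+n _ 0)))
  where
  eq : ∀ b a → iter b pred a ≡ a ∸ b
  eq zero    a       = refl
  eq (suc b) zero    = trans (eq b 0) (0∸n≡0 b)
  eq (suc b) (suc a) = eq b a

minimum : {a b : Γ → ℕ} → e ⊢ encUnary ∘ a → e ⊢ encUnary ∘ b → e ⊢ (λ γ → encUnary (a γ ⊓ b γ))
minimum {a = a} {b} d-a d-b = along (λ γ → cong encUnary (eq (a γ) (b γ))) (monus d-a (monus d-a d-b))
  where
  eq : ∀ a b → a ∸ (a ∸ b) ≡ a ⊓ b
  eq zero    b       = 0∸n≡0 (0 ∸ b)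
  eq (suc a) zero    = n∸n≡0 a
  eq (suc a) (suc b) = trans (+-∸-assoc 1 (m∸n≤m a b)) (cong suc (eq a b))

size-encUnary : ∀ n → size (encUnary n) ≡ suc (n + n)
size-encUnary zero    = refl
size-encUnary (suc n) = cong suc (trans (cong suc (size-encUnary n)) (cong suc (sym (+-suc n n))))

-- Swapping and incrementing n times turns (0 , 0) into (⌊ n /2⌋ , ⌈ n /2⌉).
halves : {a : Γ → ℕ} → e ⊢ encUnary ∘ a → e ⊢ (λ γ → encPair encUnary encUnary (⌊ a γ /2⌋ , ⌈ a γ /2⌉))
halves {a = a} d-a = along (λ γ → cong (encPair encUnary encUnary) (eq (a γ)))
  (iterate {eS = λ _ → encPair encUnary encUnary} {f = λ _ (p , q) → q , suc p} {s₀ = λ _ → 0 , 0}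
    d-a (pair empty empty)
    (pair (second (second same)) (pair empty (first (second same)))) (con 2)
    λ γ (p , q) → ≤-reflexive (arith (size (encUnary p)) (size (encUnary q))))
  where
  arith : ∀ p q → suc (q + suc (suc p)) ≡ suc (p + q) + 2
  arith = solve-∀
  eq : ∀ n → iter n (λ (p , q) → q , suc p) (0 , 0) ≡ (⌊ n /2⌋ , ⌈ n /2⌉)
  eq zero    = refl
  eq (suc n) = trans (iter-comm (λ (p , q) → q , suc p) n (0 , 0)) (cong (λ (p , q) → q , suc p) (eq n))

positive : ℕ → Bool
positive zero    = false
positive (suc _) = true

isPositive : {a : Γ → ℕ} → e ⊢ encUnary ∘ a → e ⊢ (λ γ → encBool (positive (a γ)))
isPositive {a = a} d = along (λ γ → eq (a γ)) (branch d (const-bool true) (const-bool false))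
  where
  eq : ∀ n → caseTree (encUnary n) (encBool true) (encBool false) ≡ encBool (positive n)
  eq zero    = refl
  eq (suc n) = refl

cardinality : {n : Γ → ℕ} {p : ∀ γ → Subset (n γ)} → e ⊢ (λ γ → encSubset (p γ)) → e ⊢ (λ γ → encUnary ∣ p γ ∣)
cardinality {p = p} d = along (λ γ → cong encUnary (trans (eq (p γ) 0) (+-identityʳ _)))
  (foldGrowing {eS = λ _ → encUnary} {f = λ _ → count} {s₀ = λ _ → 0} d empty
    (along (λ (γ , k , b) → step k b)
      (branch (second same) (pair empty (second (first same))) (second (first same))))
    (con 2) grows)
  where
  count : ℕ → Bool → ℕ
  count k true  = suc k
  count k false = k
  step : ∀ k b → caseTree (encBool b) (encUnary (suc k)) (encUnary k) ≡ encUnary (count k b)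
  step k true  = refl
  step k false = refl
  grows : ∀ γ k b → size (encUnary (count k b)) ≤ size (encUnary k) + 2
  grows γ k true  = ≤-reflexive (+-comm 2 _)
  grows γ k false = m≤m+n _ 2
  eq : ∀ {n} (p : Subset n) k → foldl count k (toList p) ≡ ∣ p ∣ + k
  eq []          k = refl
  eq (true  ∷ p) k = trans (eq p (suc k)) (+-suc ∣ p ∣ k)
  eq (false ∷ p) k = eq p k

zipWithVec : {n : Γ → ℕ} {C : Γ → Set} {eC : ∀ γ → C γ → Tree} {g : ∀ γ → 𝔸 γ → 𝔹 γ → C γ}
             {xs : ∀ γ → Vec (𝔸 γ) (n γ)} {ys : ∀ γ → Vec (𝔹 γ) (n γ)} →
             _⊢_ {Σ Γ λ γ → 𝔸 γ × 𝔹 γ} (λ (γ , a , b) → node (e γ) (node (eA γ a) (eB γ b)))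
                                       (λ (γ , a , b) → eC γ (g γ a b)) →
             e ⊢ (λ γ → encVec (eA γ) (xs γ)) → e ⊢ (λ γ → encVec (eB γ) (ys γ)) →
             e ⊢ (λ γ → encVec (eC γ) (Vec.zipWith (g γ) (xs γ) (ys γ)))
zipWithVec {eA = eA} {eB = eB} {eC = eC} {g} {xs} {ys} d d-xs d-ys =
  along (λ γ → cong (encVec (eC γ)) (eq (g γ) (xs γ) (ys γ)))
    (mapVec {eA = λ γ → encPair (eA γ) (eB γ)} {eB = eC} {g = λ γ → uncurry (g γ)} d
      (zipVec {eA = eA} {eB = eB} d-xs d-ys))
  where
  eq : {X Y Z : Set} (h : X → Y → Z) → ∀ {n} (us : Vec X n) vs →
       Vec.map (uncurry h) (Vec.zip us vs) ≡ Vec.zipWith h us vs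
  eq h []       []       = refl
  eq h (u ∷ us) (v ∷ vs) = cong (h u v ∷_) (eq h us vs)

and : {b c : Γ → Bool} → e ⊢ encBool ∘ b → e ⊢ encBool ∘ c → e ⊢ (λ γ → encBool (b γ ∧ c γ))
and {b = b} {c} d-b d-c = along (λ γ → eq (b γ) (c γ)) (branchBool {b = b} d-b d-c (const-bool false))
  where
  eq : ∀ b c → (ifᵇ b then encBool c else encBool false) ≡ encBool (b ∧ c)
  eq true  c = refl
  eq false c = refl

or : {b c : Γ → Bool} → e ⊢ encBool ∘ b → e ⊢ encBool ∘ c → e ⊢ (λ γ → encBool (b γ ∨ c γ))
or {b = b} {c} d-b d-c = along (λ γ → eq (b γ) (c γ)) (branchBool {b = b} d-b (const-bool true) d-c)
  where
  eq : ∀ b c → (ifᵇ b then encBool true else encBool c) ≡ encBool (b ∨ c)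
  eq true  c = refl
  eq false c = refl

module _ {n : Γ → ℕ} where

  intersection : {p q : ∀ γ → Subset (n γ)} → e ⊢ (λ γ → encSubset (p γ)) → e ⊢ (λ γ → encSubset (q γ)) →
                 e ⊢ (λ γ → encSubset (p γ ∩ q γ))
  intersection = zipWithVec {eC = λ _ → encBool} {g = λ _ → _∧_}
    (and {b = λ (_ , a , b) → a} {c = λ (_ , a , b) → b} (first (second same)) (second (second same)))

  union : {p q : ∀ γ → Subset (n γ)} → e ⊢ (λ γ → encSubset (p γ)) → e ⊢ (λ γ → encSubset (q γ)) →
          e ⊢ (λ γ → encSubset (p γ ∪ q γ))
  union = zipWithVec {eC = λ _ → encBool} {g = λ _ → _∨_}
    (or {b = λ (_ , a , b) → a} {c = λ (_ , a , b) → b} (first (second same)) (second (second same)))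

  constant : (c : Bool) {xs : ∀ γ → Vec (𝔸 γ) (n γ)} → e ⊢ (λ γ → encVec (eA γ) (xs γ)) →
             e ⊢ (λ γ → encSubset (Vec.replicate (n γ) c))
  constant {eA = eA} c {xs} d = along (λ γ → cong encSubset (map-const (xs γ) c))
    (mapVec {eA = eA} {eB = λ _ → encBool} {g = λ _ _ → c} (const-bool c) d)

  lookupAt : {p : ∀ γ → Subset (n γ)} {i : ∀ γ → Fin (n γ)} →
             e ⊢ (λ γ → encSubset (p γ)) → e ⊢ (λ γ → encFin (i γ)) →
             e ⊢ (λ γ → encBool (lookup (p γ) (i γ)))
  lookupAt {p = p} {i} d-p d-i = along (λ γ → eq (p γ) (i γ))
    (first (iterate {eS = λ _ → id} {f = λ _ → right} d-i d-p (second (second same)) (con 0)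
      λ γ s → ≤-trans (size-right s) (m≤m+n _ 0)))
    where
    eq : ∀ {n} (p : Subset n) i → left (iter (toℕ i) right (encSubset p)) ≡ encBool (lookup p i)
    eq (b ∷ p) fzero    = refl
    eq (b ∷ p) (fsuc i) = eq p i

  -- The subset `p` provides the length. The result is put together from `i` entries `false`, one
  -- `true`, and the all-`false` subset with its first `i + 1` entries dropped.
  singleton : {p : ∀ γ → Subset (n γ)} {i : ∀ γ → Fin (n γ)} →
              e ⊢ (λ γ → encSubset (p γ)) → e ⊢ (λ γ → encFin (i γ)) →
              e ⊢ (λ γ → encSubset ⁅ i γ ⁆)
  singleton {p = p} {i} d-p d-i = along (λ γ → eq (i γ))
    (iterate {eS = λ _ → id} {f = λ _ → node leaf} d-i
      (pair (const-bool true)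
            (second (iterate {eS = λ _ → id} {f = λ _ → right} d-i (constant {eA = λ _ → encBool} false d-p)
              (second (second same)) (con 0) λ γ s → ≤-trans (size-right s) (m≤m+n _ 0))))
      (pair empty (second same)) (con 2) λ γ s → ≤-reflexive (+-comm 2 (size s)))
    where
    eq : ∀ {n} (i : Fin n) → iter (toℕ i) (node leaf)
           (node (encBool true) (right (iter (toℕ i) right (encSubset (⊥ {n}))))) ≡ encSubset ⁅ i ⁆
    eq fzero    = refl
    eq (fsuc i) = trans (iter-comm (node leaf) (toℕ i) _) (cong (node leaf) (eq i))

-- In C · val xs < D · val ys, the factors C and D are given in unary.  The
-- digits are processed from the lowest one on, and only the difference of the
-- two carries is kept, so that the carries stay polynomial as well.

-- Bijective base 2 with the lowest digit in front: `true` stands for the digit 1 and `false` for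
-- the digit 2, matching the encoding of `ℕᵇ`.
val : List Bool → ℕ
val []           = 0
val (true  ∷ xs) = 1 + 2 * val xs
val (false ∷ xs) = 2 + 2 * val xs

digits : ℕᵇ → List Bool
digits ℕᵇ.zero  = []
digits 2[1+ x ] = false ∷ digits x
digits 1+[2 x ] = true ∷ digits x

encℕᵇ≡ : ∀ x → encℕᵇ x ≡ encList encBool (digits x)
encℕᵇ≡ ℕᵇ.zero  = refl
encℕᵇ≡ 2[1+ x ] = cong (node _) (encℕᵇ≡ x)
encℕᵇ≡ 1+[2 x ] = cong (node _) (encℕᵇ≡ x)

val-digits : ∀ x → val (digits x) ≡ ℕᵇ.toℕ x
val-digits ℕᵇ.zero  = refl
val-digits 2[1+ x ] = trans (cong (λ k → 2 + 2 * k) (val-digits x)) (sym (*-suc 2 (ℕᵇ.toℕ x)))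
val-digits 1+[2 x ] = cong (λ k → 1 + 2 * k) (val-digits x)

val-digits-fromℕ : ∀ n → val (digits (ℕᵇ.fromℕ n)) ≡ n
val-digits-fromℕ n = trans (val-digits (ℕᵇ.fromℕ n)) (ℕᵇₚ.toℕ-fromℕ n)

lowest : ℕ → List Bool → ℕ
lowest C []          = 0
lowest C (true  ∷ _) = C
lowest C (false ∷ _) = C + C

tail : {X : Set} → List X → List X
tail []       = []
tail (_ ∷ xs) = xs

lowest-tail : ∀ C xs → lowest C xs + 2 * (C * val (tail xs)) ≡ C * val xs
lowest-tail C []           = trans (cong (2 *_) (*-zeroʳ C)) (sym (*-zeroʳ C))
lowest-tail C (true  ∷ xs) = arith C (val xs)
  where
  arith : ∀ C v → C + 2 * (C * v) ≡ C * (1 + 2 * v)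
  arith = solve-∀
lowest-tail C (false ∷ xs) = arith C (val xs)
  where
  arith : ∀ C v → C + C + 2 * (C * v) ≡ C * (2 + 2 * v)
  arith = solve-∀

module Comparison (C D : ℕ) where

  State : Set
  State = List Bool × List Bool × ℕ × ℕ

  Less : State → Set
  Less (xs , ys , c , d) = c + C * val xs < d + D * val ys

  step : State → State
  step (xs , ys , c , d) = tail xs , tail ys , ⌊ a ∸ b /2⌋ , ⌈ b ∸ a /2⌉
    where
    a b : ℕ
    a = c + lowest C xs
    b = d + lowest D ys

  -- Once the smaller carry is subtracted from both sides, at least one side is even. A surplus on
  -- the left may then be rounded down to an even number, and one on the right rounded up, without
  -- affecting the strict inequality.
  halve : ∀ a b X Y → (a + 2 * X < b + 2 * Y) ⇔ (⌊ a ∸ b /2⌋ + X < ⌈ b ∸ a /2⌉ + Y)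
  halve zero zero X Y = mk⇔ (*-cancelˡ-< 2 X Y) (*-monoʳ-< 2)
  halve (suc a) (suc b) X Y = mk⇔ (λ { (s≤s p) → to p }) (λ p → s≤s (from p))
    where open Equivalence (halve a b X Y)
  halve (suc a) zero X Y = mk⇔ (λ p → *-cancelˡ-< 2 _ _ (≤-<-trans (doubled (suc a)) p))
                               (λ p → <-≤-trans (doubled′ (suc a)) (*-monoʳ-≤ 2 p))
    where
    2⌊n/2⌋≤n : ∀ n → 2 * ⌊ n /2⌋ ≤ n
    2⌊n/2⌋≤n zero = z≤n
    2⌊n/2⌋≤n (suc zero) = z≤n
    2⌊n/2⌋≤n (suc (suc n)) = ≤-trans (≤-reflexive (*-suc 2 ⌊ n /2⌋)) (s≤s (s≤s (2⌊n/2⌋≤n n)))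
    n<2+2⌊n/2⌋ : ∀ n → n < 2 + 2 * ⌊ n /2⌋
    n<2+2⌊n/2⌋ zero = s≤s z≤n
    n<2+2⌊n/2⌋ (suc zero) = s≤s (s≤s z≤n)
    n<2+2⌊n/2⌋ (suc (suc n)) = s≤s (s≤s (≤-trans (n<2+2⌊n/2⌋ n) (≤-reflexive (sym (*-suc 2 ⌊ n /2⌋)))))
    doubled : ∀ n → 2 * (⌊ n /2⌋ + X) ≤ n + 2 * X
    doubled n = ≤-trans (≤-reflexive (*-distribˡ-+ 2 ⌊ n /2⌋ X)) (+-monoˡ-≤ (2 * X) (2⌊n/2⌋≤n n))
    doubled′ : ∀ n → n + 2 * X < 2 * suc (⌊ n /2⌋ + X)
    doubled′ n = ≤-trans (+-monoˡ-≤ (2 * X) (n<2+2⌊n/2⌋ n)) (≤-reflexive (arith ⌊ n /2⌋ X))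
      where
      arith : ∀ h X → 2 + 2 * h + 2 * X ≡ 2 * suc (h + X)
      arith = solve-∀
  halve zero (suc b) X Y = mk⇔ (λ p → to′ (suc b) p) (λ p → from′ (suc b) p)
    where
    n≤2⌈n/2⌉ : ∀ n → n ≤ 2 * ⌈ n /2⌉
    n≤2⌈n/2⌉ zero = z≤n
    n≤2⌈n/2⌉ (suc zero) = s≤s z≤n
    n≤2⌈n/2⌉ (suc (suc n)) = ≤-trans (s≤s (s≤s (n≤2⌈n/2⌉ n))) (≤-reflexive (sym (*-suc 2 ⌈ n /2⌉)))
    2⌈n/2⌉≤1+n : ∀ n → 2 * ⌈ n /2⌉ ≤ suc n
    2⌈n/2⌉≤1+n zero = z≤n
    2⌈n/2⌉≤1+n (suc zero) = ≤-refl
    2⌈n/2⌉≤1+n (suc (suc n)) = ≤-trans (≤-reflexive (*-suc 2 ⌈ n /2⌉)) (s≤s (s≤s (2⌈n/2⌉≤1+n n)))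
    to′ : ∀ n → 2 * X < n + 2 * Y → X < ⌈ n /2⌉ + Y
    to′ n p = *-cancelˡ-< 2 _ _ (<-≤-trans p (≤-trans (+-monoˡ-≤ (2 * Y) (n≤2⌈n/2⌉ n))
                (≤-reflexive (sym (*-distribˡ-+ 2 ⌈ n /2⌉ Y)))))
    from′ : ∀ n → X < ⌈ n /2⌉ + Y → 2 * X < n + 2 * Y
    from′ n p = ≤-pred (begin
      2 + 2 * X              ≡⟨ *-suc 2 X ⟨
      2 * suc X              ≤⟨ *-monoʳ-≤ 2 p ⟩
      2 * (⌈ n /2⌉ + Y)      ≡⟨ *-distribˡ-+ 2 ⌈ n /2⌉ Y ⟩
      2 * ⌈ n /2⌉ + 2 * Y    ≤⟨ +-monoˡ-≤ (2 * Y) (2⌈n/2⌉≤1+n n) ⟩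
      suc n + 2 * Y          ∎)
      where open ≤-Reasoning

  step-Less : ∀ s → Less s ⇔ Less (step s)
  step-Less (xs , ys , c , d) = subst₂ (λ p q → (p < q) ⇔ Less (step (xs , ys , c , d)))
    (split c C xs) (split d D ys)
    (halve (c + lowest C xs) (d + lowest D ys) (C * val (tail xs)) (D * val (tail ys)))
    where
    split : ∀ c C xs → c + lowest C xs + 2 * (C * val (tail xs)) ≡ c + C * val xs
    split c C xs = trans (+-assoc c _ _) (cong (c +_) (lowest-tail C xs))

  run : List Bool → State → State
  run = flip (foldl λ s _ → step s)

  run-Less : ∀ fuel s → Less s ⇔ Less (run fuel s)
  run-Less []         s = mk⇔ id id
  run-Less (_ ∷ fuel) s = mk⇔ (λ p → N.to (O.to p)) (λ p → O.from (N.from p))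
    where
    module O = Equivalence (step-Less s)
    module N = Equivalence (run-Less fuel (step s))

  -- A step consumes a digit of each nonempty list, so fuel as long as both lists together suffices.
  -- Afterwards only the carries remain to be compared.
  exhausted : ∀ fuel xs ys c d → length xs + length ys ≤ length fuel →
              let (xs′ , ys′ , _) = run fuel (xs , ys , c , d) in xs′ ≡ [] × ys′ ≡ []
  exhausted []         []       []       c d le = refl , refl
  exhausted (_ ∷ fuel) []       []       c d le = exhausted fuel [] [] _ _ z≤n
  exhausted (_ ∷ fuel) []       (_ ∷ ys) c d (s≤s le) = exhausted fuel [] ys _ _ le
  exhausted (_ ∷ fuel) (_ ∷ xs) []       c d (s≤s le) = exhausted fuel xs [] _ _ le
  exhausted (_ ∷ fuel) (_ ∷ xs) (_ ∷ ys) c d (s≤s le) = exhausted fuel xs ys _ _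
    (≤-trans (+-monoʳ-≤ (length xs) (n≤1+n _)) le)

  lessᵇ : List Bool → List Bool → Bool
  lessᵇ xs ys = let (_ , _ , c , d) = run (xs ++ ys) (xs , ys , 0 , 0) in positive (d ∸ c)

open Comparison using (lessᵇ)

positive-∸ : ∀ c d → (positive (d ∸ c) ≡ true) ⇔ (c < d)
positive-∸ zero    zero    = mk⇔ (λ ()) (λ ())
positive-∸ (suc c) zero    = mk⇔ (λ ()) (λ ())
positive-∸ zero    (suc d) = mk⇔ (λ _ → s≤s z≤n) (λ _ → refl)
positive-∸ (suc c) (suc d) = mk⇔ (λ p → s≤s (to p)) (λ { (s≤s p) → from p })
  where open Equivalence (positive-∸ c d)

lessᵇ-correct : ∀ C D xs ys → (lessᵇ C D xs ys ≡ true) ⇔ (C * val xs < D * val ys)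
lessᵇ-correct C D xs ys = mk⇔ (λ p → R.from (sub→ (P.to p))) (λ p → P.from (sub← (R.to p)))
  where
  open Comparison C D
  s = run (xs ++ ys) (xs , ys , 0 , 0)
  c = proj₁ (proj₂ (proj₂ s))
  d = proj₂ (proj₂ (proj₂ s))
  module R = Equivalence (run-Less (xs ++ ys) (xs , ys , 0 , 0))
  module P = Equivalence (positive-∸ c d)
  done = exhausted (xs ++ ys) xs ys 0 0 (≤-reflexive (sym (length-++ xs)))
  eqˡ : c + C * val (proj₁ s) ≡ c
  eqˡ = trans (cong (λ l → c + C * val l) (proj₁ done)) (trans (cong (c +_) (*-zeroʳ C)) (+-identityʳ c))
  eqʳ : d + D * val (proj₁ (proj₂ s)) ≡ d
  eqʳ = trans (cong (λ l → d + D * val l) (proj₂ done)) (trans (cong (d +_) (*-zeroʳ D)) (+-identityʳ d))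
  sub→ : c < d → Less s
  sub→ = subst₂ _<_ (sym eqˡ) (sym eqʳ)
  sub← : Less s → c < d
  sub← = subst₂ _<_ eqˡ eqʳ

private
  enc : List Bool → Tree
  enc = encList encBool

  encState : List Bool × List Bool × ℕ × ℕ → Tree
  encState = encPair enc (encPair enc (encPair encUnary encUnary))

  right-enc : ∀ xs → right (enc xs) ≡ enc (tail xs)
  right-enc []       = refl
  right-enc (_ ∷ xs) = refl

  module _ {Γ : Set} {e : Γ → Tree} where

    tail-⊢ : {xs : Γ → List Bool} → e ⊢ enc ∘ xs → e ⊢ enc ∘ tail ∘ xs
    tail-⊢ {xs} d = along (λ γ → right-enc (xs γ)) (second d)

    lowest-⊢ : {C : Γ → ℕ} {xs : Γ → List Bool} → e ⊢ encUnary ∘ C → e ⊢ enc ∘ xs →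
               e ⊢ (λ γ → encUnary (lowest (C γ) (xs γ)))
    lowest-⊢ {C} {xs} d-C d-xs = along (λ γ → eq (C γ) (xs γ))
      (branch d-xs (branch (first d-xs) d-C (plus d-C d-C)) empty)
      where
      eq : ∀ C xs → caseTree (enc xs) (caseTree (left (enc xs)) (encUnary C) (encUnary (C + C))) leaf
                    ≡ encUnary (lowest C xs)
      eq C []           = refl
      eq C (true  ∷ xs) = refl
      eq C (false ∷ xs) = refl

    step-⊢ : {C D : Γ → ℕ} {xs ys : Γ → List Bool} {c d : Γ → ℕ} →
             e ⊢ encUnary ∘ C → e ⊢ encUnary ∘ D → e ⊢ enc ∘ xs → e ⊢ enc ∘ ys →
             e ⊢ encUnary ∘ c → e ⊢ encUnary ∘ d →
             e ⊢ (λ γ → encState (Comparison.step (C γ) (D γ) (xs γ , ys γ , c γ , d γ)))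
    step-⊢ {C} {D} {xs} {ys} {c} {d} d-C d-D d-xs d-ys d-c d-d =
      pair (tail-⊢ {xs} d-xs) (pair (tail-⊢ {ys} d-ys) (pair
        (first (halves {a = λ γ → (c γ + lowest (C γ) (xs γ)) ∸ (d γ + lowest (D γ) (ys γ))}
          (monus (plus d-c (lowest-⊢ {C} {xs} d-C d-xs)) (plus d-d (lowest-⊢ {D} {ys} d-D d-ys)))))
        (second (halves {a = λ γ → (d γ + lowest (D γ) (ys γ)) ∸ (c γ + lowest (C γ) (xs γ))}
          (monus (plus d-d (lowest-⊢ {D} {ys} d-D d-ys)) (plus d-c (lowest-⊢ {C} {xs} d-C d-xs)))))))

module _ {Γ : Set} {e : Γ → Tree} where

  less : {C D : Γ → ℕ} {xs ys : Γ → List Bool} →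
         e ⊢ encUnary ∘ C → e ⊢ encUnary ∘ D → e ⊢ enc ∘ xs → e ⊢ enc ∘ ys →
         e ⊢ (λ γ → encBool (lessᵇ (C γ) (D γ) (xs γ) (ys γ)))
  less {C} {D} {xs} {ys} d-C d-D d-xs d-ys =
    isPositive (monus (second (second (second final))) (first (second (second final))))
    where
    open ≤-Reasoning
    P : Pol
    P = con 2 ⊗ growth d-C ⊕ con 2 ⊗ growth d-D
    lowest≤ : ∀ C xs → lowest C xs ≤ C + C
    lowest≤ C []          = z≤n
    lowest≤ C (true  ∷ _) = m≤m+n C C
    lowest≤ C (false ∷ _) = ≤-refl
    -- The crude bound before halving suffices: a step adds at most `2 C` to a carry, and linear
    -- growth is what `foldGrowing` allows.
    size-carry : ∀ c C xs n → n ≤ c + lowest C xs →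
                 size (encUnary n) ≤ size (encUnary c) + 2 * size (encUnary C)
    size-carry c C xs n n≤ = begin
      size (encUnary n)                         ≡⟨ size-encUnary n ⟩
      suc (n + n)                               ≤⟨ s≤s (+-mono-≤ n≤′ n≤′) ⟩
      suc (c + (C + C) + (c + (C + C)))         ≡⟨ arith c C ⟩
      suc (c + c) + 2 * (C + C)                 ≤⟨ +-monoʳ-≤ (suc (c + c)) (*-monoʳ-≤ 2 (n≤1+n (C + C))) ⟩
      suc (c + c) + 2 * suc (C + C)             ≡⟨ cong₂ (λ p q → p + 2 * q) (size-encUnary c) (size-encUnary C) ⟨
      size (encUnary c) + 2 * size (encUnary C) ∎
      where
      n≤′ = ≤-trans n≤ (+-monoʳ-≤ c (lowest≤ C xs))
      arith : ∀ c C → suc (c + (C + C) + (c + (C + C))) ≡ suc (c + c) + 2 * (C + C)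
      arith = solve-∀
    size-tail : ∀ xs → size (enc (tail xs)) ≤ size (enc xs)
    size-tail xs = subst (λ t → size t ≤ size (enc xs)) (right-enc xs) (size-right (enc xs))
    grows : ∀ γ s (b : Bool) → size (encState (Comparison.step (C γ) (D γ) s))
              ≤ size (encState s) + ⟦ P ⟧ (size (e γ) + size (encBool b))
    grows γ (us , vs , c , d) b = begin
      size (encState (Comparison.step (C γ) (D γ) (us , vs , c , d)))
        ≤⟨ s≤s (+-mono-≤ (size-tail us) (s≤s (+-mono-≤ (size-tail vs) (s≤s (+-mono-≤
             (size-carry c (C γ) us _ (≤-trans (⌊n/2⌋≤n (a ∸ b′)) (m∸n≤m a b′)))
             (size-carry d (D γ) vs _ (≤-trans (⌈n/2⌉≤n (b′ ∸ a)) (m∸n≤m b′ a)))))))) ⟩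
      suc (size (enc us) + suc (size (enc vs) + suc (size (encUnary c) + 2 * p + (size (encUnary d) + 2 * q))))
        ≡⟨ arith (size (enc us)) (size (enc vs)) (size (encUnary c)) (size (encUnary d)) (2 * p) (2 * q) ⟩
      size (encState (us , vs , c , d)) + (2 * p + 2 * q)
        ≤⟨ +-monoʳ-≤ (size (encState (us , vs , c , d))) (≤-trans
             (+-mono-≤ (*-monoʳ-≤ 2 (size-growth d-C γ)) (*-monoʳ-≤ 2 (size-growth d-D γ)))
             (⟦⟧-mono P (m≤m+n (size (e γ)) (size (encBool b))))) ⟩
      size (encState (us , vs , c , d)) + ⟦ P ⟧ (size (e γ) + size (encBool b)) ∎
      where
      a = c + lowest (C γ) us
      b′ = d + lowest (D γ) vs
      p = size (encUnary (C γ))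
      q = size (encUnary (D γ))
      arith : ∀ u v c d p q → suc (u + suc (v + suc (c + p + (d + q)))) ≡ suc (u + suc (v + suc (c + d))) + (p + q)
      arith = solve-∀
    final : e ⊢ (λ γ → encState (Comparison.run (C γ) (D γ) (xs γ ++ ys γ) (xs γ , ys γ , 0 , 0)))
    final = foldGrowing {eA = λ _ → encBool} {eS = λ _ → encState} {f = λ γ s _ → Comparison.step (C γ) (D γ) s}
      {s₀ = λ γ → xs γ , ys γ , 0 , 0}
      (append {eA = λ _ → encBool} d-xs d-ys) (pair d-xs (pair d-ys (pair empty empty)))
      (step-⊢ {C = C ∘ proj₁} {D ∘ proj₁} {λ (_ , s , _) → proj₁ s} {λ (_ , s , _) → proj₁ (proj₂ s)}
              {λ (_ , s , _) → proj₁ (proj₂ (proj₂ s))} {λ (_ , s , _) → proj₂ (proj₂ (proj₂ s))}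
        (weaken {y = λ (_ , s , _) → encState s} {z = λ (_ , _ , b) → encBool b} d-C)
        (weaken {y = λ (_ , s , _) → encState s} {z = λ (_ , _ , b) → encBool b} d-D)
        (first state) (first (second state))
        (first (second (second state))) (second (second (second state))))
      P grows
      where
      state : _⊢_ {Σ Γ λ _ → (List Bool × List Bool × ℕ × ℕ) × Bool}
                (λ (γ , s , b) → node (node (e γ) (encState s)) (encBool b)) (λ (γ , s , b) → encState s)
      state = second (first same)

-- The decomposition algorithm

-- The vertices outside S stay in the graph, without edges.
restrict : ∀ {n} → (Fin n → Subset n) → Subset n → Fin n → Subset n
restrict r S u = ifᵇ lookup S u then r u ∩ S else ⊥

∈-restrict⁺ : ∀ {n} (r : Fin n → Subset n) {S u v} → u ∈ S → v ∈ S → v ∈ r u → v ∈ restrict r S u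
∈-restrict⁺ r u∈S v∈S v∈r rewrite []=⇒lookup u∈S = x∈p∩q⁺ (v∈r , v∈S)

∈-restrict⁻ : ∀ {n} (r : Fin n → Subset n) {S} u {v} → v ∈ restrict r S u → u ∈ S × v ∈ S × v ∈ r u
∈-restrict⁻ r {S} u v∈ with lookup S u in eq
... | true  = let v∈r , v∈S = x∈p∩q⁻ (r u) S v∈ in lookup⇒[]= u S eq , v∈S , v∈r
... | false = contradiction v∈ ∉⊥

restrictGraph : ∀ {n} → Graph n → Subset n → Graph n
restrictGraph G S = record
  { nbrs   = restrict (nbrs G) S
  ; irrefl = λ v v∈ → Graph.irrefl G v (proj₂ (proj₂ (∈-restrict⁻ (nbrs G) v v∈)))
  ; sym    = λ {u} {v} u∈ → let v∈S , u∈S , u∈r = ∈-restrict⁻ (nbrs G) v u∈ in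
               ∈-restrict⁺ (nbrs G) u∈S v∈S (Graph.sym G u∈r)
  }

induced : ∀ {n} (G : Graph n) → Subset n → Subgraph G
induced G S = record
  { verts = S
  ; adj   = restrict (nbrs G) S
  ; adj⊆  = λ v v∈ → proj₂ (proj₂ (∈-restrict⁻ (nbrs G) v v∈))
  ; ends  = λ {u} {v} u∈ → proj₁ (∈-restrict⁻ (nbrs G) v u∈)
  ; symm  = Graph.sym (restrictGraph G S)
  }

-- The same drawing serves, as no vertex disappears and every remaining edge is an edge of `G`.
planar-restrict : ∀ {n} (G : Graph n) S → Planar G → Planar (restrictGraph G S)
planar-restrict G S D = record
  { pos       = pos
  ; pos-inj   = pos-inj
  ; arc       = arc
  ; simple    = λ e → simple (edge e)
  ; starts    = λ e → starts (edge e)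
  ; finishes  = λ e → finishes (edge e)
  ; avoids    = λ e → avoids (edge e)
  ; crossings = λ e f → crossings (edge e) (edge f)
  }
  where
  open Drawing D
  edge : ∀ {e} → IsEdge (restrictGraph G S) e → IsEdge G e
  edge {u , v} (u<v , v∈) = u<v , proj₂ (proj₂ (∈-restrict⁻ (nbrs G) u v∈))

module _ {n m : ℕ} (M : Demands n m) (S : Subset n) where

  within : Fin n × Fin n → Bool
  within (s , t) = lookup S s ∧ lookup S t

  innerPairs : Subset m
  innerPairs = Vec.map within M

  addPair : Subset n → Fin n × Fin n → Subset n
  addPair T (s , t) = ifᵇ within (s , t) then T ∪ (⁅ s ⁆ ∪ ⁅ t ⁆) else T

  innerTerminals : Subset n
  innerTerminals = foldl addPair ⊥ (toList M)

digitsℕ : ℕ → List Bool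
digitsℕ n = digits (ℕᵇ.fromℕ n)

-- One less than the length of the bijective binary numeral, but at least 1.
-- Then 2 ^ log k ≤ k < 2 ^ (4 * log k ∸ 1) for k ≥ 2.
log : ℕ → ℕ
log k = suc (length (digitsℕ k) ∸ 2)

module Splitting (I : Instance)
                 (cut : ∀ S → VertexCut (restrictGraph (Instance.graph I) S)) where

  open Instance I

  num den : ℕ
  num = ℤ.∣ ↥ w ∣
  den = ↧ₙ w

  sep : Subset n → ℕ
  sep S = separated (innerTerminals pairs S) (cut S)

  -- The sparsity of the cut is compared with `w / (512 log k)` after clearing denominators. For
  -- `sep S ≡ 0`, where the sparsity counts as infinite, the test fails. Of the four factors only
  -- `den` and `num` can be exponentially large, so these are given by digits.
  sparse : Subset n → Bool
  sparse S = lessᵇ (∣ VertexCut.X (cut S) ∣ * (512 * log k)) (sep S) (digitsℕ den) (digitsℕ num)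

  split : Subset n → List (Subset n)
  split S = ifᵇ sparse S then VertexCut.A (cut S) ∩ S ∷ VertexCut.B (cut S) ∩ S ∷ [] else S ∷ []

  pieces : ℕ → Subset n → List (Subset n)
  pieces zero    S = S ∷ []
  pieces (suc d) S = concatMap (pieces d) (split S)

  cluster : Subset n → Subgraph graph × Subset m
  cluster S = induced graph S , innerPairs pairs S

  decomposition : Clusters I
  decomposition = map cluster (pieces n ⊤)

  -- The program works round by round on the whole list, while the proofs follow the recursion tree
  -- of a single set. Both orders give the same list.
  foldl-pieces : ∀ {A : Set} (fuel : List A) Ss →
    foldl (λ Ss _ → concatMap split Ss) Ss fuel ≡ concatMap (pieces (length fuel)) Ss
  foldl-pieces []         Ss = sym (singletons Ss)
    where
    singletons : {A : Set} (xs : List A) → concatMap (_∷ []) xs ≡ xs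
    singletons []       = refl
    singletons (x ∷ xs) = cong (x ∷_) (singletons xs)
  foldl-pieces (_ ∷ fuel) Ss = trans (foldl-pieces fuel (concatMap split Ss)) (twice (pieces (length fuel)) Ss)
    where
    twice : {X : Set} (f : Subset n → List X) → ∀ Ss →
            concatMap f (concatMap split Ss) ≡ concatMap (concatMap f ∘ split) Ss
    twice f []       = refl
    twice f (S ∷ Ss) = trans (concatMap-++ f (split S) (concatMap split Ss))
                             (cong (concatMap f (split S) ++_) (twice f Ss))

-- Running time of the decomposition algorithm

size-encSubset : ∀ {n} (p : Subset n) → size (encSubset p) ≤ 1 + 4 * n
size-encSubset {zero}  []      = ≤-refl
size-encSubset {suc n} (b ∷ p) = begin
  suc (size (encBool b) + size (encSubset p)) ≤⟨ s≤s (+-mono-≤ (bool b) (size-encSubset p)) ⟩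
  suc (3 + (1 + 4 * n))                       ≡⟨ arith n ⟩
  1 + 4 * suc n                               ∎
  where
  open ≤-Reasoning
  bool : ∀ b → size (encBool b) ≤ 3
  bool true  = ≤-refl
  bool false = s≤s z≤n
  arith : ∀ n → suc (3 + (1 + 4 * n)) ≡ 1 + 4 * suc n
  arith = solve-∀

n≤size-encVec : ∀ {A : Set} {n} (f : A → Tree) (xs : Vec A n) → n ≤ size (encVec f xs)
n≤size-encVec f []       = z≤n
n≤size-encVec f (x ∷ xs) = s≤s (≤-trans (n≤size-encVec f xs) (m≤n+m _ _))

times : {a b : Γ → ℕ} → e ⊢ encUnary ∘ a → e ⊢ encUnary ∘ b → e ⊢ (λ γ → encUnary (a γ * b γ))
times {e = e} {a = a} {b} d-a d-b = along (λ γ → cong encUnary (trans (eq (a γ) (b γ) 0) (+-identityʳ _)))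
  (iterate {eS = λ _ → encUnary} {f = λ γ s → b γ + s} {s₀ = λ _ → 0} d-a empty
    (plus {b = proj₂} (first same then reindex proj₁ d-b) (second same)) (growth d-b)
    λ γ s → ≤-trans (size-+ (b γ) s) (+-monoʳ-≤ (size (encUnary s)) (size-growth d-b γ)))
  where
  eq : ∀ a b c → iter a (λ s → b + s) c ≡ a * b + c
  eq zero    b c = refl
  eq (suc a) b c = trans (eq a b (b + c)) (arith (a * b) b c)
    where
    arith : ∀ ab b c → ab + (b + c) ≡ b + ab + c
    arith = solve-∀
  size-+ : ∀ b s → size (encUnary (b + s)) ≤ size (encUnary s) + size (encUnary b)
  size-+ zero    s = m≤m+n _ 1
  size-+ (suc b) s = ≤-trans (s≤s (s≤s (size-+ b s))) (≤-reflexive (arith (size (encUnary s)) (size (encUnary b))))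
    where
    arith : ∀ s b → suc (suc (s + b)) ≡ s + suc (suc b)
    arith = solve-∀

constUnary : ∀ k → e ⊢ (λ _ → encUnary k)
constUnary zero    = empty
constUnary (suc k) = pair empty (constUnary k)

lengthUnary : {A : Γ → Set} {eA : ∀ γ → A γ → Tree} {xs : ∀ γ → List (A γ)} →
              e ⊢ (λ γ → encList (eA γ) (xs γ)) → e ⊢ (λ γ → encUnary (length (xs γ)))
lengthUnary {xs = xs} d = along (λ γ → cong encUnary (trans (eq (xs γ) 0) (+-identityʳ _)))
  (foldGrowing {eS = λ _ → encUnary} {f = λ _ k _ → suc k} {s₀ = λ _ → 0} d empty
    (pair empty (second (first same))) (con 2) λ γ k _ → ≤-reflexive (+-comm 2 _))
  where
  eq : {X : Set} (us : List X) → ∀ k → foldl (λ k _ → suc k) k us ≡ length us + k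
  eq []       k = refl
  eq (u ∷ us) k = trans (eq us (suc k)) (+-suc (length us) k)

-- The promise is part of the index, because planarity is needed to call the oracle and `0 < w` to
-- read off the numerator of `w`.
AdmissibleInstance : Set
AdmissibleInstance = Σ Instance Admissible

Cluster : Set
Cluster = Σ AdmissibleInstance λ (I , _) → Subset (Instance.n I)

encCluster : Cluster → Tree
encCluster ((I , _) , S) = node (encInstance I) (encSubset S)

module _ where
  open Instance

  private
    set-⊢ : encCluster ⊢ λ (_ , S) → encSubset S
    set-⊢ = second same

    matrix-⊢ : encCluster ⊢ λ ((I , _) , S) → encMatrix (nbrs (graph I))
    matrix-⊢ = first (first same)

    pairs-⊢ : encCluster ⊢ λ ((I , _) , S) → encVec (λ (s , t) → node (encFin s) (encFin t)) (pairs I)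
    pairs-⊢ = first (second (first same))

    digits-⊢ : {k : Γ → ℕ} → e ⊢ encℕ ∘ k → e ⊢ encList encBool ∘ digitsℕ ∘ k
    digits-⊢ {k = k} = along (λ γ → encℕᵇ≡ (ℕᵇ.fromℕ (k γ)))

    log-⊢ : encCluster ⊢ λ ((I , _) , S) → encUnary (log (k I))
    log-⊢ = pair empty (monus
      (lengthUnary {eA = λ _ → encBool} (digits-⊢ {k = λ ((I , _) , S) → k I} (first (second (second (first same))))))
      (constUnary 2))

    den-⊢ : encCluster ⊢ λ ((I , _) , S) → encList encBool (digitsℕ (↧ₙ (w I)))
    den-⊢ = digits-⊢ {k = λ ((I , _) , S) → ↧ₙ (w I)} (second (second (second (second (first same)))))

    -- An encoded integer has its sign on the left. The number on the right is the absolute value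
    -- for nonnegative integers, but one less for negative ones; hence the appeal to `0<w`.
    num-⊢ : encCluster ⊢ λ ((I , _) , S) → encList encBool (digitsℕ ℤ.∣ ↥ (w I) ∣)
    num-⊢ = digits-⊢ {k = λ ((I , _) , S) → ℤ.∣ ↥ (w I) ∣} (along
      (λ ((I , adm) , S) → numerator (w I) (Admissible.0<w adm))
      (second (first (second (second (second (first same)))))))
      where
      numerator : ∀ w → 0ℚ ℚ.< w → right (encℤ (↥ w)) ≡ encℕ ℤ.∣ ↥ w ∣
      numerator (ℚ.mkℚ (ℤ.+ n) d c)    0<w = refl
      numerator (ℚ.mkℚ -[1+ n ] d c) 0<w with () ← ℚ.positive 0<w

  restrict-⊢ : encCluster ⊢ λ ((I , _) , S) → encMatrix (restrict (nbrs (graph I)) S)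
  restrict-⊢ = along (λ ((I , _) , S) → cong (encVec encSubset) (eq (λ b r → ifᵇ b then r ∩ S else ⊥) S (nbrs (graph I))))
    (zipWithVec {eA = λ _ → encBool} {eB = λ _ → encSubset} {eC = λ _ → encSubset}
      {g = λ (_ , S) b r → ifᵇ b then r ∩ S else ⊥}
      (along (λ ((_ , S) , b , r) → step b (r ∩ S))
        (branchBool {b = λ (_ , b , _) → b} (first (second same))
          (intersection (second (second same)) (second (first same)))
          (constant {eA = λ _ → encBool} false (second (second same)))))
      set-⊢ matrix-⊢)
    where
    step : ∀ {n} b (p : Subset n) → (ifᵇ b then encSubset p else encSubset ⊥) ≡ encSubset (ifᵇ b then p else ⊥)
    step true  p = refl
    step false p = refl
    eq : {X Y Z : Set} (g : X → Y → Z) → ∀ {n} (us : Vec X n) (r : Fin n → Y) →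
         Vec.zipWith g us (tabulate r) ≡ tabulate (λ i → g (lookup us i) (r i))
    eq g []       r = refl
    eq g (u ∷ us) r = cong (g u (r fzero) ∷_) (eq g us (r ∘ fsuc))

  within-⊢ : _⊢_ {Σ Cluster λ ((I , _) , S) → Fin (n I) × Fin (n I)}
               (λ (γ , s , t) → node (encCluster γ) (node (encFin s) (encFin t)))
               (λ (((I , _) , S) , p) → encBool (within (pairs I) S p))
  within-⊢ = and {b = λ ((_ , S) , s , t) → lookup S s} {c = λ ((_ , S) , s , t) → lookup S t}
    (lookupAt {p = λ ((_ , S) , _) → S} {i = λ (_ , s , t) → s} (second (first same)) (first (second same)))
    (lookupAt {p = λ ((_ , S) , _) → S} {i = λ (_ , s , t) → t} (second (first same)) (second (second same)))

  innerPairs-⊢ : encCluster ⊢ λ ((I , _) , S) → encSubset (innerPairs (pairs I) S)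
  innerPairs-⊢ = mapVec {eB = λ _ → encBool} {g = λ ((I , _) , S) → within (pairs I) S} within-⊢ pairs-⊢

  innerTerminals-⊢ : encCluster ⊢ λ ((I , _) , S) → encSubset (innerTerminals (pairs I) S)
  innerTerminals-⊢ =
    fold {eA = λ _ (s , t) → node (encFin s) (encFin t)} {eS = λ _ → encSubset} {f = λ ((I , _) , S) → addPair (pairs I) S}
      {s₀ = λ _ → ⊥}
      pairs-⊢ (constant {eA = λ _ → encBool} false set-⊢)
      (along (λ (((I , _) , S) , T , p) → step (within (pairs I) S p) (T ∪ _) T)
        (branchBool {b = λ (((I , _) , S) , T , p) → within (pairs I) S p}
          (pair (first (first same)) (second same) then reindex (λ (γ , T , p) → γ , p) within-⊢)
          (union (second (first same))
            (union (singleton {p = λ (_ , T , _) → T} {i = λ (_ , _ , s , t) → s} (second (first same)) (first (second same)))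
                   (singleton {p = λ (_ , T , _) → T} {i = λ (_ , _ , s , t) → t} (second (first same)) (second (second same)))))
          (second (first same))))
      (con 1 ⊕ con 4 ⊗ var)
      λ ((I , _) , S) ys zs _ → ≤-trans (size-encSubset (foldl (addPair (pairs I) S) ⊥ ys))
        (s≤s (*-monoʳ-≤ 4 (m≤n⇒m≤1+n (≤-trans (n≤size-encVec encBool S) (m≤n+m _ (size (encInstance I)))))))
    where
    step : ∀ {n} b (p q : Subset n) → (ifᵇ b then encSubset p else encSubset q) ≡ encSubset (ifᵇ b then p else q)
    step true  p q = refl
    step false p q = refl

  module Oracle (oracle : (i : CutInput) → Planar (proj₁ (proj₂ i)) → VertexCut (proj₁ (proj₂ i)))
                (oracle-⊢ : _⊢_ {Σ CutInput λ (_ , G , _) → Planar G}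
                              (λ (i , _) → encCutInput i) (λ (i , D) → encCut i (oracle i D)))
    where

    cutOf : ((I , _) : AdmissibleInstance) → (S : Subset (n I)) → VertexCut (restrictGraph (graph I) S)
    cutOf (I , adm) S = oracle (n I , restrictGraph (graph I) S , innerTerminals (pairs I) S)
                               (planar-restrict (graph I) S (Admissible.planar adm))

    module Split (γ : AdmissibleInstance) = Splitting (proj₁ γ) (cutOf γ)

    private
      cut-⊢ : encCluster ⊢ λ (γ , S) → encCut (n (proj₁ γ) , restrictGraph (graph (proj₁ γ)) S , innerTerminals (pairs (proj₁ γ)) S) (cutOf γ S)
      cut-⊢ = pair restrict-⊢ innerTerminals-⊢ then reindex (λ ((I , adm) , S) → _ , planar-restrict (graph I) S (Admissible.planar adm)) oracle-⊢

      A-⊢ : encCluster ⊢ λ (γ , S) → encSubset (VertexCut.A (cutOf γ S))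
      A-⊢ = first cut-⊢
      X-⊢ : encCluster ⊢ λ (γ , S) → encSubset (VertexCut.X (cutOf γ S))
      X-⊢ = first (second cut-⊢)
      B-⊢ : encCluster ⊢ λ (γ , S) → encSubset (VertexCut.B (cutOf γ S))
      B-⊢ = second (second cut-⊢)

    sep-⊢ : encCluster ⊢ λ (γ , S) → encUnary (Split.sep γ S)
    sep-⊢ = plus
      (minimum (cardinality (intersection A-⊢ innerTerminals-⊢)) (cardinality (intersection B-⊢ innerTerminals-⊢)))
      (cardinality (intersection X-⊢ innerTerminals-⊢))

    sparse-⊢ : encCluster ⊢ λ (γ , S) → encBool (Split.sparse γ S)
    sparse-⊢ = less {C = λ (γ , S) → ∣ VertexCut.X (cutOf γ S) ∣ * (512 * log (k (proj₁ γ)))} {D = λ (γ , S) → Split.sep γ S}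
      {xs = λ (γ , S) → digitsℕ (↧ₙ (w (proj₁ γ)))} {ys = λ (γ , S) → digitsℕ ℤ.∣ ↥ (w (proj₁ γ)) ∣}
      (times (cardinality X-⊢) (times {a = λ _ → 512} (constUnary 512) log-⊢)) sep-⊢ den-⊢ num-⊢

    split-⊢ : encCluster ⊢ λ (γ , S) → encList encSubset (Split.split γ S)
    split-⊢ = along (λ (γ , S) → eq (Split.sparse γ S) _ _)
      (branchBool {b = λ (γ , S) → Split.sparse γ S} sparse-⊢
        (pair (intersection A-⊢ set-⊢) (pair (intersection B-⊢ set-⊢) empty))
        (pair set-⊢ empty))
      where
      eq : ∀ {n} b (p q : List (Subset n)) → (ifᵇ b then encList encSubset p else encList encSubset q)
             ≡ encList encSubset (ifᵇ b then p else q)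
      eq true  p q = refl
      eq false p q = refl

    module _ (short : ∀ γ d → length (Split.pieces γ d ⊤) ≤ suc (n (proj₁ γ) + n (proj₁ γ))) where

      -- A round may double the list, so the bound `short` on the number of sets is what keeps all
      -- intermediate states polynomial.
      pieces-⊢ : (λ (I , _) → encInstance I) ⊢ λ γ → encList encSubset (Split.pieces γ (n (proj₁ γ)) ⊤)
      pieces-⊢ = along (λ γ → cong (encList encSubset) (eq γ))
        (fold {eA = λ _ → encSubset} {eS = λ _ → encList encSubset} {f = λ γ Ss _ → concatMap (Split.split γ) Ss}
          {s₀ = λ _ → ⊤ ∷ []} {xs = λ (I , _) → rows I}
          (first same) (pair (constant {eA = λ _ → encSubset} true {λ (I , _) → tabulate (nbrs (graph I))} (first same)) empty)
          (concatMapList {eA = λ _ → encSubset} {eB = λ _ → encSubset} {g = λ (γ , _) → Split.split γ}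
            (pair (first (first (first same))) (second same) then reindex (λ ((γ , _) , S) → γ , S) split-⊢)
            (second (first same)))
          (con 1 ⊕ (con 1 ⊕ (var ⊕ var)) ⊗ (con 2 ⊕ con 4 ⊗ var))
          λ γ ys zs _ → bounded γ ys)
        where
        -- The `n` rows of the adjacency matrix serve as the counter for the rounds.
        rows : (I : Instance) → List (Subset (n I))
        rows I = toList (tabulate (nbrs (graph I)))
        iterated : ∀ γ {A : Set} (fuel : List A) →
                   foldl (λ Ss _ → concatMap (Split.split γ) Ss) (⊤ ∷ []) fuel ≡ Split.pieces γ (length fuel) ⊤
        iterated γ fuel = trans (Split.foldl-pieces γ fuel (⊤ ∷ [])) (++-identityʳ _)
        eq : ∀ γ → foldl (λ Ss _ → concatMap (Split.split γ) Ss) (⊤ ∷ []) (rows (proj₁ γ)) ≡ Split.pieces γ (n (proj₁ γ)) ⊤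
        eq γ = trans (iterated γ (rows (proj₁ γ)))
                     (cong (λ d → Split.pieces γ d ⊤) (length-toList (tabulate (nbrs (graph (proj₁ γ))))))
        size-list : ∀ {n} (Ss : List (Subset n)) → size (encList encSubset Ss) ≤ 1 + length Ss * (2 + 4 * n)
        size-list []       = ≤-refl
        size-list {n} (S ∷ Ss) = s≤s (≤-trans (+-mono-≤ (size-encSubset S) (size-list Ss)) (≤-reflexive (+-suc (1 + 4 * n) _)))
        bounded : ∀ γ (ys : List (Subset (n (proj₁ γ)))) → _
        bounded γ@(I , _) ys = begin
          size (encList encSubset (foldl (λ Ss _ → concatMap (Split.split γ) Ss) (⊤ ∷ []) ys))
            ≡⟨ cong (size ∘ encList encSubset) (iterated γ ys) ⟩
          size (encList encSubset (Split.pieces γ (length ys) ⊤))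
            ≤⟨ size-list (Split.pieces γ (length ys) ⊤) ⟩
          1 + length (Split.pieces γ (length ys) ⊤) * (2 + 4 * n I)
            ≤⟨ s≤s (*-mono-≤ (≤-trans (short γ (length ys)) (s≤s (+-mono-≤ n≤ n≤)))
                             (+-monoʳ-≤ 2 (*-monoʳ-≤ 4 n≤))) ⟩
          1 + (1 + (N + N)) * (2 + 4 * N) ∎
          where
          open ≤-Reasoning
          N : ℕ
          N = size (encInstance I)
          n≤ : n I ≤ N
          n≤ = ≤-trans (n≤size-encVec encSubset (tabulate (nbrs (graph I)))) (m≤n⇒m≤1+n (m≤m+n _ _))

      decomposition-⊢ : (λ (I , _) → encInstance I) ⊢ λ γ → encClusters (proj₁ γ) (Split.decomposition γ)
      decomposition-⊢ = mapList {eA = λ _ → encSubset}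
        {eB = λ _ (H , J) → node (node (encSubset (verts H)) (encMatrix (adj H))) (encSubset J)}
        {g = λ γ → Split.cluster γ}
        (pair (pair set-⊢ restrict-⊢) innerPairs-⊢) pieces-⊢

-- Menger’s theorem

elements : ∀ {n} → Subset n → List (Fin n)
elements []            = []
elements (inside  ∷ p) = fzero ∷ map fsuc (elements p)
elements (outside ∷ p) = map fsuc (elements p)

length-elements : ∀ {n} (p : Subset n) → length (elements p) ≡ ∣ p ∣
length-elements []            = refl
length-elements (inside  ∷ p) = cong suc (trans (length-map fsuc (elements p)) (length-elements p))
length-elements (outside ∷ p) = trans (length-map fsuc (elements p)) (length-elements p)

∈-elements⁺ : ∀ {n} (p : Subset n) {v} → v ∈ p → v ∈ᴸ elements p
∈-elements⁺ (inside  ∷ p) Vec.here         = here refl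
∈-elements⁺ (inside  ∷ p) (Vec.there v∈p) = there (∈-map⁺ fsuc (∈-elements⁺ p v∈p))
∈-elements⁺ (outside ∷ p) (Vec.there v∈p) = ∈-map⁺ fsuc (∈-elements⁺ p v∈p)

∈-elements⁻ : ∀ {n} (p : Subset n) {v} → v ∈ᴸ elements p → v ∈ p
∈-elements⁻ (inside  ∷ p) (here refl) = Vec.here
∈-elements⁻ (inside  ∷ p) (there v∈) with u , u∈ , refl ← ∈-map⁻ fsuc v∈ = Vec.there (∈-elements⁻ p u∈)
∈-elements⁻ (outside ∷ p) v∈         with u , u∈ , refl ← ∈-map⁻ fsuc v∈ = Vec.there (∈-elements⁻ p u∈)

unique-elements : ∀ {n} (p : Subset n) → Unique (elements p)
unique-elements []            = []
unique-elements (inside  ∷ p) =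
  All.tabulate (λ { v∈ refl → let _ , _ , eq = ∈-map⁻ fsuc v∈ in Finₚ.0≢1+n eq })
  ∷ Uniqueₚ.map⁺ Finₚ.suc-injective (unique-elements p)
unique-elements (outside ∷ p) = Uniqueₚ.map⁺ Finₚ.suc-injective (unique-elements p)

unique-length : ∀ {n} (p : Subset n) {vs} → Unique vs → All (_∈ p) vs → length vs ≤ ∣ p ∣
unique-length p []       []         = z≤n
unique-length p (v∉ ∷ u) (v∈p ∷ vs) = ≤-trans
  (s≤s (unique-length (p - _) u (All.zipWith (λ (v≢w , w∈p) → x∈p∧x≢y⇒x∈p-y w∈p (v≢w ∘ sym)) (v∉ , vs))))
  (x∈p⇒∣p-x∣<∣p∣ v∈p)

∣p∪q∣≤∣p∣+∣q∣ : ∀ {n} (p q : Subset n) → ∣ p ∪ q ∣ ≤ ∣ p ∣ + ∣ q ∣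
∣p∪q∣≤∣p∣+∣q∣ []            []            = z≤n
∣p∪q∣≤∣p∣+∣q∣ (inside  ∷ p) (inside  ∷ q) = s≤s (≤-trans (∣p∪q∣≤∣p∣+∣q∣ p q) (+-monoʳ-≤ ∣ p ∣ (n≤1+n _)))
∣p∪q∣≤∣p∣+∣q∣ (inside  ∷ p) (outside ∷ q) = s≤s (∣p∪q∣≤∣p∣+∣q∣ p q)
∣p∪q∣≤∣p∣+∣q∣ (outside ∷ p) (inside  ∷ q) = ≤-trans (s≤s (∣p∪q∣≤∣p∣+∣q∣ p q)) (≤-reflexive (sym (+-suc ∣ p ∣ ∣ q ∣)))
∣p∪q∣≤∣p∣+∣q∣ (outside ∷ p) (outside ∷ q) = ∣p∪q∣≤∣p∣+∣q∣ p q

module _ {n : ℕ} where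

  private
    V : Set
    V = Fin n

  open DecMembership (Finₚ._≟_ {n}) using () renaming (_∈?_ to _∈ᴸ?_)

  -- Edges are directed and listed, so that an induction can remove them one by one. In the
  -- application an undirected edge is listed in both directions.
  data Walk (E : List (V × V)) : V → V → List V → Set where
    [-] : ∀ {s} → Walk E s s (s ∷ [])
    _∷_ : ∀ {u v t vs} → (u , v) ∈ᴸ E → Walk E v t vs → Walk E u t (u ∷ vs)

  module _ {E : List (V × V)} where

    walk-head : ∀ {s t vs} → Walk E s t vs → ∃[ us ] vs ≡ s ∷ us
    walk-head [-]     = _ , refl
    walk-head (_ ∷ _) = _ , refl

    source∈ : ∀ {s t vs} → Walk E s t vs → s ∈ᴸ vs
    source∈ [-]     = here refl
    source∈ (_ ∷ _) = here refl

    target∈ : ∀ {s t vs} → Walk E s t vs → t ∈ᴸ vs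
    target∈ [-]     = here refl
    target∈ (_ ∷ w) = there (target∈ w)

    source-unique : ∀ {s t s′ t′ vs} → Walk E s t vs → Walk E s′ t′ vs → s ≡ s′
    source-unique [-]     [-]     = refl
    source-unique (_ ∷ _) (_ ∷ _) = refl
    source-unique [-]     (_ ∷ ())
    source-unique (_ ∷ ()) [-]

    target-unique : ∀ {s t s′ t′ vs} → Walk E s t vs → Walk E s′ t′ vs → t ≡ t′
    target-unique [-]     [-]      = refl
    target-unique (_ ∷ v) (_ ∷ w)  = target-unique v w
    target-unique [-]     (_ ∷ ())
    target-unique (_ ∷ ()) [-]

    join : ∀ {s t r vs us} → Walk E s t vs → Walk E t r (t ∷ us) → Walk E s r (vs ++ us)
    join [-]     w′ = w′
    join (e ∷ w) w′ = e ∷ join w w′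

    bridge : ∀ {s t t′ r vs us} → Walk E s t vs → (t , t′) ∈ᴸ E → Walk E t′ r us → Walk E s r (vs ++ us)
    bridge [-]     e w′ = e ∷ w′
    bridge (f ∷ w) e w′ = f ∷ bridge w e w′

  walk-mono : ∀ {E F s t vs} → (∀ {e} → e ∈ᴸ E → e ∈ᴸ F) → Walk E s t vs → Walk F s t vs
  walk-mono E⊆F [-]     = [-]
  walk-mono E⊆F (e ∷ w) = E⊆F e ∷ walk-mono E⊆F w

  PathBetween : List (V × V) → Subset n → Subset n → List V → Set
  PathBetween E A B vs = ∃[ s ] ∃[ t ] (s ∈ A × t ∈ B × Walk E s t vs × Unique vs)

  Linkage : List (V × V) → Subset n → Subset n → List (List V) → Set
  Linkage E A B Ps = All (PathBetween E A B) Ps × AllPairs Disjoint Ps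

  linkage-mono : ∀ {E F A B Ps} → (∀ {e} → e ∈ᴸ E → e ∈ᴸ F) → Linkage E A B Ps → Linkage F A B Ps
  linkage-mono E⊆F (ps , d) = All.map (λ (s , t , s∈ , t∈ , w , u) → s , t , s∈ , t∈ , walk-mono E⊆F w , u) ps , d

  -- A certificate that X separates A from B: the set R contains everything
  -- that can be reached from A outside X.
  record Separation (E : List (V × V)) (A B X : Subset n) : Set where
    field
      R      : Subset n
      avoids : ∀ {v} → v ∈ R → v ∉ X
      from   : ∀ {v} → v ∈ A → v ∈ R ⊎ v ∈ X
      to     : ∀ {v} → v ∈ B → v ∉ R
      closed : ∀ {u v} → (u , v) ∈ᴸ E → u ∈ R → v ∈ R ⊎ v ∈ X

  open Separation

  module _ {E : List (V × V)} {A B S : Subset n} (sep : Separation E A B S) (x y : V) where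

    -- A walk from `A` to `B` crosses `S` or uses the new edge and so visits `x`. Its part up to the
    -- first vertex of `S ∪ ⁅ x ⁆` uses old edges only and therefore meets `X`.
    separate-source : ∀ {X} → Separation E A (S ∪ ⁅ x ⁆) X → Separation ((x , y) ∷ E) A B X
    separate-source {X} sep′ = record
      { R      = R sep′ ∩ R sep
      ; avoids = λ v∈ → avoids sep′ (proj₁ (split v∈))
      ; from   = λ v∈ → both (from sep′ v∈) (from sep v∈)
      ; to     = λ v∈B v∈ → to sep v∈B (proj₂ (split v∈))
      ; closed = λ { (here refl) u∈ → contradiction (proj₁ (split u∈)) (to sep′ (x∈p∪q⁺ (inj₂ (x∈⁅x⁆ x))))
                   ; (there e) u∈ → both (closed sep′ e (proj₁ (split u∈))) (closed sep e (proj₂ (split u∈))) }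
      }
      where
      split : ∀ {v} → v ∈ R sep′ ∩ R sep → v ∈ R sep′ × v ∈ R sep
      split = x∈p∩q⁻ (R sep′) (R sep)
      both : ∀ {v} → v ∈ R sep′ ⊎ v ∈ X → v ∈ R sep ⊎ v ∈ S → v ∈ R sep′ ∩ R sep ⊎ v ∈ X
      both (inj₂ v∈X) _          = inj₂ v∈X
      both (inj₁ v∈R) (inj₁ v∈R′) = inj₁ (x∈p∩q⁺ (v∈R , v∈R′))
      both (inj₁ v∈R) (inj₂ v∈S)  = contradiction v∈R (to sep′ (x∈p∪q⁺ (inj₁ v∈S)))

    -- The mirror image: from its last vertex in `S ∪ ⁅ y ⁆` on, a walk to `B` uses old edges only.
    -- The set `R sep` may contain vertices of `X`, so these have to be taken out of the
    -- certificate.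
    separate-target : ∀ {X} → Separation E (S ∪ ⁅ y ⁆) B X → Separation ((x , y) ∷ E) A B X
    separate-target {X} sep′ = record
      { R      = (R sep′ ∪ R sep) ∩ ∁ X
      ; avoids = λ v∈ → x∈∁p⇒x∉p (proj₂ (x∈p∩q⁻ _ (∁ X) v∈))
      ; from   = λ v∈ → old (from sep v∈)
      ; to     = λ v∈B v∈ → [ to sep′ v∈B , to sep v∈B ]′ (split v∈)
      ; closed = λ { (here refl) u∈ → reached (from sep′ (x∈p∪q⁺ (inj₂ (x∈⁅x⁆ y))))
                   ; (there e) u∈ → [ (λ u∈R′ → reached (closed sep′ e u∈R′))
                                    , (λ u∈R → old (closed sep e u∈R)) ]′ (split u∈) }
      }
      where
      split : ∀ {v} → v ∈ (R sep′ ∪ R sep) ∩ ∁ X → v ∈ R sep′ ⊎ v ∈ R sep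
      split v∈ = x∈p∪q⁻ (R sep′) (R sep) (proj₁ (x∈p∩q⁻ _ (∁ X) v∈))
      inner : ∀ {v} → v ∈ R sep′ ∪ R sep → v ∈ (R sep′ ∪ R sep) ∩ ∁ X ⊎ v ∈ X
      inner {v} v∈ with v ∈? X
      ... | yes v∈X = inj₂ v∈X
      ... | no  v∉X = inj₁ (x∈p∩q⁺ (v∈ , x∉p⇒x∈∁p v∉X))
      reached : ∀ {v} → v ∈ R sep′ ⊎ v ∈ X → v ∈ (R sep′ ∪ R sep) ∩ ∁ X ⊎ v ∈ X
      reached (inj₂ v∈X) = inj₂ v∈X
      reached (inj₁ v∈R) = inner (x∈p∪q⁺ (inj₁ v∈R))
      old : ∀ {v} → v ∈ R sep ⊎ v ∈ S → v ∈ (R sep′ ∪ R sep) ∩ ∁ X ⊎ v ∈ X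
      old (inj₁ v∈R) = inner (x∈p∪q⁺ (inj₂ v∈R))
      old (inj₂ v∈S) = reached (from sep′ (x∈p∪q⁺ (inj₁ v∈S)))

    separate-edge : Separation ((x , y) ∷ E) A B (S ∪ ⁅ x ⁆)
    separate-edge = record
      { R      = R sep - x
      ; avoids = λ v∈ v∈X → [ avoids sep (p─q⊆p _ _ v∈) , (λ v∈x → x∉p-x v∈ (x∈⁅y⁆⇒x≡y x v∈x)) ]′ (x∈p∪q⁻ S ⁅ x ⁆ v∈X)
      ; from   = λ v∈ → shrink (from sep v∈)
      ; to     = λ v∈B v∈ → to sep v∈B (p─q⊆p _ _ v∈)
      ; closed = λ { (here refl) u∈ → contradiction refl (x∉p-x u∈)
                   ; (there e) u∈ → shrink (closed sep e (p─q⊆p _ _ u∈)) }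
      }
      where
      x∉p-x : ∀ {v} → v ∈ R sep - x → v ≢ x
      -- If `x` were still in `R sep - x`, removing it once more would make the set smaller; but
      -- removal is idempotent.
      x∉p-x {v} v∈ refl = <⇒≱ (p⊂q⇒∣p∣<∣q∣ {p = R sep - x - x} {R sep - x} (x∈p⇒p-x⊂p v∈))
                               (≤-reflexive (cong ∣_∣ (sym (p─q─q≡p─q (R sep) ⁅ x ⁆))))
      shrink : ∀ {v} → v ∈ R sep ⊎ v ∈ S → v ∈ R sep - x ⊎ v ∈ S ∪ ⁅ x ⁆
      shrink (inj₂ v∈S) = inj₂ (x∈p∪q⁺ (inj₁ v∈S))
      shrink {v} (inj₁ v∈R) with v Finₚ.≟ x
      ... | yes refl = inj₂ (x∈p∪q⁺ (inj₂ (x∈⁅x⁆ x)))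
      ... | no  v≢x  = inj₁ (x∈p∧x≢y⇒x∈p-y v∈R v≢x)

    -- A path from `A` that meets `S` at most in its end cannot leave `R` earlier. Together with
    -- `after`, its counterpart for the paths to `B`, this confines the intersections of the two
    -- families to `S`.
    before : ∀ {a t vs} → Walk E a t vs → Unique vs → a ∈ R sep ⊎ a ∈ S →
             (∀ {v} → v ∈ᴸ vs → v ∈ S → v ≡ t) →
             ∀ {v} → v ∈ᴸ vs → v ∈ R sep ⊎ v ∈ S × v ≡ t
    before [-] u (inj₁ a∈R) end (here refl) = inj₁ a∈R
    before [-] u (inj₂ a∈S) end (here refl) = inj₂ (a∈S , refl)
    before {a} (e ∷ w) (a∉ ∷ u) a∈ end v∈ with a∈
    ... | inj₂ a∈S = contradiction (subst (_∈ᴸ _) (sym (end (here refl) a∈S)) (target∈ w)) (Allₚ.All¬⇒¬Any a∉)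
    ... | inj₁ a∈R with v∈
    ...   | here refl = inj₁ a∈R
    ...   | there v∈′ = before w u (closed sep e a∈R) (end ∘ there) v∈′

    after : ∀ {s b vs} → Walk E s b vs → Unique vs → b ∈ B →
            (∀ {v} → v ∈ᴸ vs → v ∈ S → v ≡ s) →
            ∀ {v} → v ∈ᴸ vs → v ∉ R sep
    after [-]     u        b∈B start (here refl) = to sep b∈B
    after (e ∷ w) (s∉ ∷ u) b∈B start v∈ with v∈
    ... | there v∈′ = after w u b∈B
                        (λ w∈ w∈S → contradiction (subst (_∈ᴸ _) (start (there w∈) w∈S) w∈) (Allₚ.All¬⇒¬Any s∉)) v∈′
    ... | here refl = λ s∈R → [ after w u b∈B (λ w∈ w∈S → contradiction (subst (_∈ᴸ _) (start (there w∈) w∈S) w∈) (Allₚ.All¬⇒¬Any s∉)) (source∈ w)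
                              , (λ v∈S → contradiction (subst (_∈ᴸ _) (start (there (source∈ w)) v∈S) (source∈ w)) (Allₚ.All¬⇒¬Any s∉)) ]′
                              (closed sep e s∈R)

  disjoint⇒≡ : ∀ {Ps} → AllPairs Disjoint Ps → ∀ {p p′ : List V} → p ∈ᴸ Ps → p′ ∈ᴸ Ps → ∀ {v} → v ∈ᴸ p → v ∈ᴸ p′ → p ≡ p′
  disjoint⇒≡ (d ∷ ds) (here refl) (here refl) v∈ v∈′ = refl
  disjoint⇒≡ (d ∷ ds) (here refl) (there p∈)  v∈ v∈′ = contradiction (v∈ , v∈′) (All.lookup d p∈)
  disjoint⇒≡ (d ∷ ds) (there p∈)  (here refl) v∈ v∈′ = contradiction (v∈′ , v∈) (All.lookup d p∈)
  disjoint⇒≡ (d ∷ ds) (there p∈)  (there p∈′) v∈ v∈′ = disjoint⇒≡ ds p∈ p∈′ v∈ v∈′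

  module Marked (Q : List V → V → Set) (T : Subset n) where

    IsMarked : List V → Set
    IsMarked p = ∃[ t ] (t ∈ᴸ p × t ∈ T × Q p t)

    marks : ∀ Ps → (∀ {p} → p ∈ᴸ Ps → IsMarked p) → AllPairs Disjoint Ps →
            ∃[ ts ] (length ts ≡ length Ps × Unique ts × All (_∈ T) ts
                     × All (λ t → ∃[ p ] (p ∈ᴸ Ps × t ∈ᴸ p × Q p t)) ts)
    marks []       marked []       = [] , refl , [] , [] , []
    marks (p ∷ Ps) marked (d ∷ ds) with marks Ps (marked ∘ there) ds | marked (here refl)
    ... | ts , len , u , ts∈T , ts∈ | t , t∈p , t∈T , q =
      t ∷ ts , cong suc len
      , All.map (λ { (p′ , p′∈ , t′∈ , _) refl → All.lookup d p′∈ (t∈p , t′∈) }) ts∈ ∷ u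
      , t∈T ∷ ts∈T
      , (p , here refl , t∈p , q) ∷ All.map (λ (p′ , p′∈ , r) → p′ , there p′∈ , r) ts∈

    module _ {Ps} (marked : ∀ {p} → p ∈ᴸ Ps → IsMarked p) (disjoint : AllPairs Disjoint Ps) where

      length-marked : length Ps ≤ ∣ T ∣
      length-marked with ts , len , u , ts∈T , _ ← marks Ps marked disjoint =
        ≤-trans (≤-reflexive (sym len)) (unique-length T u ts∈T)

      -- Disjoint paths have distinct marks, so `∣ T ∣` or more of them use up all of `T`.
      covering : ∣ T ∣ ≤ length Ps → ∀ {t} → t ∈ T → ∃[ p ] (p ∈ᴸ Ps × t ∈ᴸ p × Q p t)
      covering T≤ {t} t∈T with marks Ps marked disjoint
      ... | ts , len , u , ts∈T , ts∈ with t ∈ᴸ? ts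
      ...   | yes t∈ = All.lookup ts∈ t∈
      ...   | no  t∉ = contradiction (≤-trans T≤ (≤-reflexive (sym len)))
                         (<⇒≱ (unique-length T (Allₚ.¬Any⇒All¬ ts t∉ ∷ u) (t∈T ∷ ts∈T)))

  -- Göring’s proof: S separates A from B once the edge (x , y) is deleted.
  -- Unless ∣ S ∣ vertices suffice with that edge as well, there are more than
  -- ∣ S ∣ disjoint paths onto S ∪ ⁅ x ⁆ and from S ∪ ⁅ y ⁆.  These meet in S
  -- only, so they can be joined along S and the edge (x , y).
  module Joining {E : List (V × V)} {A B S : Subset n} (sep : Separation E A B S) {x y : V}
                 {P₁ P₂ : List (List V)}
                 (L₁ : Linkage E A (S ∪ ⁅ x ⁆) P₁) (L₂ : Linkage E (S ∪ ⁅ y ⁆) B P₂)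
                 (S<P₁ : ∣ S ∣ < length P₁) (S<P₂ : ∣ S ∣ < length P₂) where

    private
      Q₁ Q₂ : List V → V → Set
      Q₁ p t = ∃[ s ] (s ∈ A × Walk E s t p × Unique p)
      Q₂ q s = ∃[ t ] (t ∈ B × Walk E s t q × Unique q)

      ∣S∪z∣≤ : ∀ z → ∣ S ∪ ⁅ z ⁆ ∣ ≤ suc ∣ S ∣
      ∣S∪z∣≤ z = ≤-trans (∣p∪q∣≤∣p∣+∣q∣ S ⁅ z ⁆)
        (≤-reflexive (trans (cong (∣ S ∣ +_) (∣⁅x⁆∣≡1 z)) (trans (+-suc ∣ S ∣ 0) (cong suc (+-identityʳ ∣ S ∣)))))

      marked₁ : ∀ {p} → p ∈ᴸ P₁ → ∃[ t ] (t ∈ᴸ p × t ∈ S ∪ ⁅ x ⁆ × Q₁ p t)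
      marked₁ p∈ = let s , t , s∈ , t∈ , w , u = All.lookup (proj₁ L₁) p∈ in t , target∈ w , t∈ , s , s∈ , w , u

      marked₂ : ∀ {q} → q ∈ᴸ P₂ → ∃[ s ] (s ∈ᴸ q × s ∈ S ∪ ⁅ y ⁆ × Q₂ q s)
      marked₂ q∈ = let s , t , s∈ , t∈ , w , u = All.lookup (proj₁ L₂) q∈ in s , source∈ w , s∈ , t , t∈ , w , u

      -- The set `S ∪ ⁅ x ⁆` has at most `∣ S ∣ + 1` vertices, and at least that many disjoint paths
      -- end in it.
      cover₁ : ∀ {t} → t ∈ S ∪ ⁅ x ⁆ → ∃[ p ] (p ∈ᴸ P₁ × t ∈ᴸ p × Q₁ p t)
      cover₁ = Marked.covering Q₁ _ marked₁ (proj₂ L₁) (≤-trans (∣S∪z∣≤ x) S<P₁)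

      cover₂ : ∀ {s} → s ∈ S ∪ ⁅ y ⁆ → ∃[ q ] (q ∈ᴸ P₂ × s ∈ᴸ q × Q₂ q s)
      cover₂ = Marked.covering Q₂ _ marked₂ (proj₂ L₂) (≤-trans (∣S∪z∣≤ y) S<P₂)

      -- By `cover₁` every vertex of `S ∪ ⁅ x ⁆` is the end of some path of `P₁`, and by
      -- disjointness this is the path on which it lies.
      only-end : ∀ {p t} → p ∈ᴸ P₁ → Q₁ p t → ∀ {v} → v ∈ᴸ p → v ∈ S ∪ ⁅ x ⁆ → v ≡ t
      only-end p∈ (_ , _ , w , _) v∈p v∈ with cover₁ v∈
      ... | p′ , p′∈ , v∈p′ , _ , _ , w′ , _ with refl ← disjoint⇒≡ (proj₂ L₁) p∈ p′∈ v∈p v∈p′ = target-unique w′ w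

      only-start : ∀ {q s} → q ∈ᴸ P₂ → Q₂ q s → ∀ {v} → v ∈ᴸ q → v ∈ S ∪ ⁅ y ⁆ → v ≡ s
      only-start q∈ (_ , _ , w , _) v∈q v∈ with cover₂ v∈
      ... | q′ , q′∈ , v∈q′ , _ , _ , w′ , _ with refl ← disjoint⇒≡ (proj₂ L₂) q∈ q′∈ v∈q v∈q′ = source-unique w′ w

      ∣S∪z∣≤∣S∣ : ∀ {z} → z ∈ S → ∣ S ∪ ⁅ z ⁆ ∣ ≤ ∣ S ∣
      ∣S∪z∣≤∣S∣ {z} z∈S = p⊆q⇒∣p∣≤∣q∣ λ v∈ →
        [ id , (λ v∈z → subst (_∈ S) (sym (x∈⁅y⁆⇒x≡y z v∈z)) z∈S) ]′ (x∈p∪q⁻ S ⁅ z ⁆ v∈)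

      -- Otherwise more than `∣ S ∣` disjoint paths would start in a set of only `∣ S ∣` vertices.
      y∉S : y ∉ S
      y∉S y∈S = <⇒≱ S<P₂ (≤-trans (Marked.length-marked Q₂ _ marked₂ (proj₂ L₂)) (∣S∪z∣≤∣S∣ y∈S))

      x∉S : x ∉ S
      x∉S x∈S = <⇒≱ S<P₁ (≤-trans (Marked.length-marked Q₁ _ marked₁ (proj₂ L₁)) (∣S∪z∣≤∣S∣ x∈S))

      meet : ∀ {p t q s} → p ∈ᴸ P₁ → Q₁ p t → q ∈ᴸ P₂ → Q₂ q s →
             ∀ {v} → v ∈ᴸ p → v ∈ᴸ q → v ∈ S × v ≡ t × v ≡ s
      meet p∈ Qp@(_ , a∈ , w , u) q∈ Qq@(_ , b∈ , w′ , u′) v∈p v∈q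
        with before sep x y w u (from sep a∈) (λ v∈ v∈S → only-end p∈ Qp v∈ (x∈p∪q⁺ (inj₁ v∈S))) v∈p
      ... | inj₁ v∈R = contradiction v∈R
            (after sep x y w′ u′ b∈ (λ v∈ v∈S → only-start q∈ Qq v∈ (x∈p∪q⁺ (inj₁ v∈S))) v∈q)
      ... | inj₂ (v∈S , v≡t) = v∈S , v≡t , only-start q∈ Qq v∈q (x∈p∪q⁺ (inj₁ v∈S))

      Joined : List V → List V → Set
      Joined p r = ∃[ q ] ∃[ t ] ∃[ s ] (q ∈ᴸ P₂ × Q₁ p t × Q₂ q s × (t ≡ s × t ∈ S ⊎ t ≡ x × s ≡ y)
                                         × (∀ {v} → v ∈ᴸ r → v ∈ᴸ p ⊎ v ∈ᴸ q))

      Connection : List V → Set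
      Connection p = ∃[ r ] (PathBetween ((x , y) ∷ E) A B r × Joined p r)

      connect-through : ∀ {p t} → p ∈ᴸ P₁ → Q₁ p t → t ∈ S → Connection p
      connect-through {p} {t} p∈ Qp@(a , a∈ , w , u) t∈S
        with q , q∈ , _ , Qq@(b , b∈ , w′ , u′) ← cover₂ (x∈p∪q⁺ (inj₁ t∈S))
        with q′ , refl ← walk-head w′
        with t∉q′ ∷ u″ ← u′ =
        p ++ q′
        , (a , b , a∈ , b∈ , walk-mono there (join w w′) , Uniqueₚ.++⁺ u u″ λ (v∈p , v∈q′) →
             let _ , v≡t , _ = meet p∈ Qp q∈ Qq v∈p (there v∈q′)
             in contradiction (subst (_∈ᴸ q′) v≡t v∈q′) (Allₚ.All¬⇒¬Any t∉q′))
        , t ∷ q′ , t , t , q∈ , Qp , Qq , inj₁ (refl , t∈S)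
        , λ v∈ → [ inj₁ , inj₂ ∘ there ]′ (∈-++⁻ p v∈)

      connect-across : ∀ {p} → p ∈ᴸ P₁ → Q₁ p x → Connection p
      connect-across {p} p∈ Qp@(a , a∈ , w , u)
        with q , q∈ , _ , Qq@(b , b∈ , w′ , u′) ← cover₂ {y} (x∈p∪q⁺ (inj₂ (x∈⁅x⁆ y))) =
        p ++ q
        , (a , b , a∈ , b∈ , bridge (walk-mono there w) (here refl) (walk-mono there w′) , Uniqueₚ.++⁺ u u′ λ (v∈p , v∈q) →
             let v∈S , v≡x , _ = meet p∈ Qp q∈ Qq v∈p v∈q
             in x∉S (subst (_∈ S) v≡x v∈S))
        , q , x , y , q∈ , Qp , Qq , inj₂ (refl , refl) , ∈-++⁻ p

      connect : ∀ {p} → p ∈ᴸ P₁ → Connection p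
      connect p∈ with t , _ , t∈ , Qp ← marked₁ p∈ with x∈p∪q⁻ S ⁅ x ⁆ t∈
      ... | inj₁ t∈S = connect-through p∈ Qp t∈S
      ... | inj₂ t∈x = connect-across p∈ (subst (Q₁ _) (x∈⁅y⁆⇒x≡y x t∈x) Qp)

      -- A continuation that starts at `s` and meets another path of `P₁` does so in `s` itself.
      -- Then `s` is in `S`, hence different from `y`, so the path that it continues ends in the
      -- same vertex.
      crossing : ∀ {p t t′ s v} → Q₁ p t → t ≡ s × t ∈ S ⊎ t ≡ x × s ≡ y → v ∈ S × v ≡ t′ × v ≡ s → v ∈ᴸ p
      crossing (_ , _ , w , _) (inj₁ (refl , _)) (_ , _ , refl)   = target∈ w
      crossing Qp              (inj₂ (_ , refl)) (v∈S , _ , refl) = contradiction v∈S y∉S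

      joined-disjoint : ∀ {p p′ r r′} → p ∈ᴸ P₁ → p′ ∈ᴸ P₁ → Disjoint p p′ → Joined p r → Joined p′ r′ → Disjoint r r′
      joined-disjoint {p} {p′} p∈ p′∈ d (q , t , s , q∈ , Qp , Qq , link , r⊆) (q′ , t′ , s′ , q′∈ , Qp′ , Qq′ , link′ , r′⊆) (v∈r , v∈r′)
        with r⊆ v∈r | r′⊆ v∈r′
      ... | inj₁ v∈p | inj₁ v∈p′ = d (v∈p , v∈p′)
      ... | inj₁ v∈p | inj₂ v∈q′ = d (v∈p , crossing Qp′ link′ (meet p∈ Qp q′∈ Qq′ v∈p v∈q′))
      ... | inj₂ v∈q | inj₁ v∈p′ = d (crossing Qp link (meet p′∈ Qp′ q∈ Qq v∈p′ v∈q) , v∈p′)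
      -- Two joined paths with the same continuation enter it at the same vertex, and either both
      -- through `S` or both across the new edge, since `y` is not in `S`. So their first parts
      -- share an end, contrary to disjointness.
      ... | inj₂ v∈q | inj₂ v∈q′ with refl ← disjoint⇒≡ (proj₂ L₂) q∈ q′∈ v∈q v∈q′
          | _ , _ , w , _ ← Qq | _ , _ , w′ , _ ← Qq′ | _ , _ , u , _ ← Qp | _ , _ , u′ , _ ← Qp′
          with refl ← source-unique w w′ with link | link′
      ...   | inj₁ (refl , _)   | inj₁ (refl , _)   = d (target∈ u , target∈ u′)
      ...   | inj₂ (refl , _)   | inj₂ (refl , _)   = d (target∈ u , target∈ u′)
      ...   | inj₁ (refl , s∈S) | inj₂ (_ , refl)   = y∉S s∈S
      ...   | inj₂ (_ , refl)   | inj₁ (refl , s∈S) = y∉S s∈S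

      connectAll : ∀ Ps → (∀ {p} → p ∈ᴸ Ps → p ∈ᴸ P₁) → AllPairs Disjoint Ps →
                   ∃[ Rs ] (length Rs ≡ length Ps × All (PathBetween ((x , y) ∷ E) A B) Rs × AllPairs Disjoint Rs
                            × All (λ r → ∃[ p ] (p ∈ᴸ Ps × Joined p r)) Rs)
      connectAll []       Ps⊆ []       = [] , refl , [] , [] , []
      connectAll (p ∷ Ps) Ps⊆ (d ∷ ds)
        with Rs , len , paths , disjoint , from ← connectAll Ps (Ps⊆ ∘ there) ds
           | r , path , j ← connect (Ps⊆ (here refl)) =
        r ∷ Rs , cong suc len , path ∷ paths
        , All.map {Q = Disjoint r} (λ { (p′ , p′∈ , j′) {v} → joined-disjoint (Ps⊆ (here refl)) (Ps⊆ (there p′∈)) (All.lookup d p′∈) j j′ {v} }) from ∷ disjoint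
        , (p , here refl , j) ∷ All.map (λ (p′ , p′∈ , j′) → p′ , there p′∈ , j′) from

    joined : ∃[ Rs ] (length Rs ≡ length P₁ × Linkage ((x , y) ∷ E) A B Rs)
    joined with Rs , len , paths , disjoint , _ ← connectAll P₁ id (proj₂ L₁) = Rs , len , paths , disjoint

  -- Induction on the edges, for all `A` and `B` at once: the step also treats `A` with `S ∪ ⁅ x ⁆`,
  -- and `S ∪ ⁅ y ⁆` with `B`. Linkage and separator certify each other, so no maximum or minimum
  -- has to be mentioned.
  menger : ∀ E A B → ∃[ X ] ∃[ Ps ] (Linkage E A B Ps × ∣ X ∣ ≤ length Ps × Separation E A B X)
  menger [] A B = A ∩ B , map (_∷ []) (elements (A ∩ B)) , (paths , disjoint)
    , ≤-reflexive (sym (trans (length-map (_∷ []) (elements (A ∩ B))) (length-elements (A ∩ B))))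
    , record
      { R      = A ∩ ∁ B
      ; avoids = λ v∈ v∈X → x∈∁p⇒x∉p (proj₂ (x∈p∩q⁻ A (∁ B) v∈)) (proj₂ (x∈p∩q⁻ A B v∈X))
      ; from   = start
      ; to     = λ v∈B v∈ → x∈∁p⇒x∉p (proj₂ (x∈p∩q⁻ A (∁ B) v∈)) v∈B
      ; closed = λ ()
      }
    where
    start : ∀ {v} → v ∈ A → v ∈ A ∩ ∁ B ⊎ v ∈ A ∩ B
    start {v} v∈A with v ∈? B
    ... | yes v∈B = inj₂ (x∈p∩q⁺ (v∈A , v∈B))
    ... | no  v∉B = inj₁ (x∈p∩q⁺ (v∈A , x∉p⇒x∈∁p v∉B))
    paths : All (PathBetween [] A B) (map (_∷ []) (elements (A ∩ B)))
    paths = All.tabulate λ p∈ → let v , v∈ , eq = ∈-map⁻ (_∷ []) p∈ in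
      subst (PathBetween [] A B) (sym eq)
        (v , v , proj₁ (x∈p∩q⁻ A B (∈-elements⁻ (A ∩ B) v∈)) , proj₂ (x∈p∩q⁻ A B (∈-elements⁻ (A ∩ B) v∈)) , [-] , [] ∷ [])
    disjoint : AllPairs Disjoint (map (_∷ []) (elements (A ∩ B)))
    disjoint = AllPairsₚ.map⁺ (AllPairs.map (λ u≢v → λ { (here refl , here refl) → u≢v refl }) (unique-elements (A ∩ B)))
  menger ((x , y) ∷ E) A B
    with S , Ps , L , S≤ , sep ← menger E A B
    with X₁ , P₁ , L₁ , le₁ , sep₁ ← menger E A (S ∪ ⁅ x ⁆)
       | X₂ , P₂ , L₂ , le₂ , sep₂ ← menger E (S ∪ ⁅ y ⁆) B
    -- A separator of at most `∣ S ∣` vertices for either auxiliary problem also works with the new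
    -- edge, and the old linkage is long enough for it. Otherwise both auxiliary linkages have more
    -- than `∣ S ∣` paths.
    with ∣ X₁ ∣ ≤? ∣ S ∣ | ∣ X₂ ∣ ≤? ∣ S ∣
  ... | yes X₁≤ | _       = X₁ , Ps , linkage-mono there L , ≤-trans X₁≤ S≤ , separate-source sep x y sep₁
  ... | no _    | yes X₂≤ = X₂ , Ps , linkage-mono there L , ≤-trans X₂≤ S≤ , separate-target sep x y sep₂
  ... | no X₁≰  | no X₂≰  with Rs , len , L′ ← Joining.joined sep L₁ L₂ (≤-trans (≰⇒> X₁≰) le₁) (≤-trans (≰⇒> X₂≰) le₂) =
    S ∪ ⁅ x ⁆ , Rs , L′
    , ≤-trans (≤-trans (∣p∪q∣≤∣p∣+∣q∣ S ⁅ x ⁆) (≤-reflexive (trans (cong (∣ S ∣ +_) (∣⁅x⁆∣≡1 x)) (trans (+-suc ∣ S ∣ 0) (cong suc (+-identityʳ ∣ S ∣))))))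
              (≤-trans (≤-trans (≰⇒> X₁≰) le₁) (≤-reflexive (sym len)))
    , separate-edge sep x y

-- Analysis of the splitting

∣p∩q∣+∣∁p∩q∣≡∣q∣ : ∀ {n} (p q : Subset n) → ∣ p ∩ q ∣ + ∣ ∁ p ∩ q ∣ ≡ ∣ q ∣
∣p∩q∣+∣∁p∩q∣≡∣q∣ []          []          = refl
∣p∩q∣+∣∁p∩q∣≡∣q∣ (true  ∷ p) (true  ∷ q) = cong suc (∣p∩q∣+∣∁p∩q∣≡∣q∣ p q)
∣p∩q∣+∣∁p∩q∣≡∣q∣ (true  ∷ p) (false ∷ q) = ∣p∩q∣+∣∁p∩q∣≡∣q∣ p q
∣p∩q∣+∣∁p∩q∣≡∣q∣ (false ∷ p) (true  ∷ q) = trans (+-suc ∣ p ∩ q ∣ _) (cong suc (∣p∩q∣+∣∁p∩q∣≡∣q∣ p q))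
∣p∩q∣+∣∁p∩q∣≡∣q∣ (false ∷ p) (false ∷ q) = ∣p∩q∣+∣∁p∩q∣≡∣q∣ p q

disjoint-∣∣ : ∀ {n} {p q r : Subset n} → p ⊆ r → q ⊆ r → (∀ {v} → v ∈ p → v ∉ q) → ∣ p ∣ + ∣ q ∣ ≤ ∣ r ∣
disjoint-∣∣ {p = p} {q} {r} p⊆r q⊆r disjoint = begin
  ∣ p ∣ + ∣ q ∣           ≤⟨ +-mono-≤ (p⊆q⇒∣p∣≤∣q∣ λ v∈p → x∈p∩q⁺ (v∈p , p⊆r v∈p))
                                      (p⊆q⇒∣p∣≤∣q∣ λ v∈q → x∈p∩q⁺ (x∉p⇒x∈∁p (λ v∈p → disjoint v∈p v∈q) , q⊆r v∈q)) ⟩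
  ∣ p ∩ r ∣ + ∣ ∁ p ∩ r ∣ ≡⟨ ∣p∩q∣+∣∁p∩q∣≡∣q∣ p r ⟩
  ∣ r ∣                   ∎
  where open ≤-Reasoning

module _ {n : ℕ} {G : Graph n} (C : VertexCut G) (T : Subset n) where
  open VertexCut C

  ∣cut∣ : ∣ A ∩ T ∣ + ∣ B ∩ T ∣ + ∣ X ∩ T ∣ ≤ ∣ T ∣
  ∣cut∣ = begin
    ∣ A ∩ T ∣ + ∣ B ∩ T ∣ + ∣ X ∩ T ∣   ≡⟨ +-assoc (∣ A ∩ T ∣) _ _ ⟩
    ∣ A ∩ T ∣ + (∣ B ∩ T ∣ + ∣ X ∩ T ∣) ≤⟨ +-monoʳ-≤ (∣ A ∩ T ∣) (disjoint-∣∣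
                                             (λ v∈ → x∈p∩q⁺ (x∉p⇒x∈∁p (λ v∈A → A∩B (_ , x∈p∩q⁺ (v∈A , ∩ˡ B v∈))) , ∩ʳ B v∈))
                                             (λ v∈ → x∈p∩q⁺ (x∉p⇒x∈∁p (λ v∈A → A∩X (_ , x∈p∩q⁺ (v∈A , ∩ˡ X v∈))) , ∩ʳ X v∈))
                                             (λ v∈ v∈′ → X∩B (_ , x∈p∩q⁺ (∩ˡ X v∈′ , ∩ˡ B v∈)))) ⟩
    ∣ A ∩ T ∣ + ∣ ∁ A ∩ T ∣             ≡⟨ ∣p∩q∣+∣∁p∩q∣≡∣q∣ A T ⟩
    ∣ T ∣                               ∎
    where
    open ≤-Reasoning
    ∩ˡ : ∀ p {v} → v ∈ p ∩ T → v ∈ p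
    ∩ˡ p v∈ = proj₁ (x∈p∩q⁻ p T v∈)
    ∩ʳ : ∀ p {v} → v ∈ p ∩ T → v ∈ T
    ∩ʳ p v∈ = proj₂ (x∈p∩q⁻ p T v∈)

  -- The progress of a split, on which the bounds on the number of sets and on the number of rounds
  -- rest: `X` or both sides must contain a terminal, and terminals lie in `S`.
  separates : ∀ {S} → T ⊆ S → 1 ≤ separated T C →
              1 ≤ ∣ X ∩ S ∣ ⊎ 1 ≤ ∣ A ∩ S ∣ × 1 ≤ ∣ B ∩ S ∣
  separates {S} T⊆S 1≤ = bounds (∣ A ∩ T ∣) (∣ B ∩ T ∣) (∣ X ∩ T ∣) (mono A) (mono B) (mono X) 1≤
    where
    mono : ∀ p → ∣ p ∩ T ∣ ≤ ∣ p ∩ S ∣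
    mono p = p⊆q⇒∣p∣≤∣q∣ λ v∈ → let v∈p , v∈T = x∈p∩q⁻ p T v∈ in x∈p∩q⁺ (v∈p , T⊆S v∈T)
    bounds : ∀ a b x {a′ b′ x′} → a ≤ a′ → b ≤ b′ → x ≤ x′ → 1 ≤ (a ⊓ b) + x → 1 ≤ x′ ⊎ 1 ≤ a′ × 1 ≤ b′
    bounds (suc a) (suc b) x       a≤ b≤ x≤ _  = inj₂ (≤-trans (s≤s z≤n) a≤ , ≤-trans (s≤s z≤n) b≤)
    bounds zero    b       (suc x) a≤ b≤ x≤ _  = inj₁ (≤-trans (s≤s z≤n) x≤)
    bounds (suc a) zero    (suc x) a≤ b≤ x≤ _  = inj₁ (≤-trans (s≤s z≤n) x≤)
    bounds zero    b       zero    a≤ b≤ x≤ ()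
    bounds (suc a) zero    zero    a≤ b≤ x≤ ()

∧-true : ∀ {b c} → b ∧ c ≡ true → b ≡ true × c ≡ true
∧-true {true} {true} _ = refl , refl

module _ {n m : ℕ} (M : Demands n m) where

  module _ {S : Subset n} where

    within⁺ : ∀ {s t} → s ∈ S → t ∈ S → within M S (s , t) ≡ true
    within⁺ s∈S t∈S = cong₂ _∧_ ([]=⇒lookup s∈S) ([]=⇒lookup t∈S)

    within⁻ : ∀ {s t} → within M S (s , t) ≡ true → s ∈ S × t ∈ S
    within⁻ {s} {t} eq = let eq₁ , eq₂ = ∧-true eq in lookup⇒[]= s S eq₁ , lookup⇒[]= t S eq₂

    ∈-innerPairs⁺ : ∀ {i} → source M i ∈ S → target M i ∈ S → i ∈ innerPairs M S
    ∈-innerPairs⁺ {i} s∈S t∈S = lookup⇒[]= i _ (trans (lookup-map i (within M S) M) (within⁺ s∈S t∈S))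

    ∈-innerPairs⁻ : ∀ {i} → i ∈ innerPairs M S → source M i ∈ S × target M i ∈ S
    ∈-innerPairs⁻ {i} i∈ = within⁻ (trans (sym (lookup-map i (within M S) M)) ([]=⇒lookup i∈))

    terminal∈ : ∀ {v} → TerminalOf M (innerPairs M S) v → v ∈ S
    terminal∈ (i , i∈ , inj₁ refl) = proj₁ (∈-innerPairs⁻ i∈)
    terminal∈ (i , i∈ , inj₂ refl) = proj₂ (∈-innerPairs⁻ i∈)

    Inner : List (Fin n × Fin n) → Fin n → Set
    Inner ps v = Any (λ (s , t) → s ∈ S × t ∈ S × (v ≡ s ⊎ v ≡ t)) ps

    ∈-addPair⁻ : ∀ T s t {v} → v ∈ addPair M S T (s , t) → v ∈ T ⊎ s ∈ S × t ∈ S × (v ≡ s ⊎ v ≡ t)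
    ∈-addPair⁻ T s t v∈ with within M S (s , t) in eq
    ... | false = inj₁ v∈
    ... | true  = map-⊎ id (λ v∈st → let s∈S , t∈S = within⁻ eq in s∈S , t∈S ,
                    map-⊎ (x∈⁅y⁆⇒x≡y s) (x∈⁅y⁆⇒x≡y t) (x∈p∪q⁻ ⁅ s ⁆ ⁅ t ⁆ v∈st)) (x∈p∪q⁻ T _ v∈)

    ∈-addPair⁺ˡ : ∀ T p {v} → v ∈ T → v ∈ addPair M S T p
    ∈-addPair⁺ˡ T p v∈ with within M S p
    ... | false = v∈
    ... | true  = x∈p∪q⁺ (inj₁ v∈)

    ∈-addPair⁺ʳ : ∀ T s t {v} → s ∈ S → t ∈ S → v ≡ s ⊎ v ≡ t → v ∈ addPair M S T (s , t)
    ∈-addPair⁺ʳ T s t s∈S t∈S v≡ rewrite within⁺ s∈S t∈S = x∈p∪q⁺ (inj₂ (x∈p∪q⁺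
      (map-⊎ (λ { refl → x∈⁅x⁆ s }) (λ { refl → x∈⁅x⁆ t }) v≡)))

    ∈-foldl⁻ : ∀ T ps {v} → v ∈ foldl (addPair M S) T ps → v ∈ T ⊎ Inner ps v
    ∈-foldl⁻ T []             v∈ = inj₁ v∈
    ∈-foldl⁻ T ((s , t) ∷ ps) v∈ with ∈-foldl⁻ (addPair M S T (s , t)) ps v∈
    ... | inj₂ inner = inj₂ (there inner)
    ... | inj₁ v∈′   = map-⊎ id here (∈-addPair⁻ T s t v∈′)

    ∈-foldl⁺ˡ : ∀ T ps {v} → v ∈ T → v ∈ foldl (addPair M S) T ps
    ∈-foldl⁺ˡ T []       v∈ = v∈
    ∈-foldl⁺ˡ T (p ∷ ps) v∈ = ∈-foldl⁺ˡ _ ps (∈-addPair⁺ˡ T p v∈)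

    ∈-foldl⁺ʳ : ∀ T ps {v} → Inner ps v → v ∈ foldl (addPair M S) T ps
    ∈-foldl⁺ʳ T ((s , t) ∷ ps) (here (s∈S , t∈S , v≡)) = ∈-foldl⁺ˡ _ ps (∈-addPair⁺ʳ T s t s∈S t∈S v≡)
    ∈-foldl⁺ʳ T (p ∷ ps)       (there inner)           = ∈-foldl⁺ʳ _ ps inner

    ∈-innerTerminals⁻ : ∀ {v} → v ∈ innerTerminals M S → Inner (toList M) v
    ∈-innerTerminals⁻ v∈ = [ (λ v∈⊥ → contradiction v∈⊥ ∉⊥) , id ]′ (∈-foldl⁻ ⊥ (toList M) v∈)

    innerTerminals⊆ : innerTerminals M S ⊆ S
    innerTerminals⊆ v∈ with _ , s∈S , t∈S , v≡ ← Any.satisfied (∈-innerTerminals⁻ v∈) with v≡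
    ... | inj₁ refl = s∈S
    ... | inj₂ refl = t∈S

    TerminalOf⇒∈ : ∀ {v} → TerminalOf M (innerPairs M S) v → v ∈ innerTerminals M S
    TerminalOf⇒∈ (i , i∈ , v≡) = let s∈S , t∈S = ∈-innerPairs⁻ i∈ in
      ∈-foldl⁺ʳ ⊥ (toList M) (Any.map (λ { refl → s∈S , t∈S , v≡ }) (∈ⱽ-toList⁺ (∈ⱽ-lookup i M)))

    ∣innerTerminals∣≤ : ∣ innerTerminals M S ∣ ≤ 2 * m
    ∣innerTerminals∣≤ = ≤-trans (count M ⊥) (≤-reflexive (cong (_+ 2 * m) (∣⊥∣≡0 n)))
      where
      addPair≤ : ∀ T p → ∣ addPair M S T p ∣ ≤ ∣ T ∣ + 2
      addPair≤ T (s , t) with within M S (s , t)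
      ... | false = m≤m+n _ 2
      ... | true  = begin
        ∣ T ∪ (⁅ s ⁆ ∪ ⁅ t ⁆) ∣           ≤⟨ ∣p∪q∣≤∣p∣+∣q∣ T _ ⟩
        ∣ T ∣ + ∣ ⁅ s ⁆ ∪ ⁅ t ⁆ ∣         ≤⟨ +-monoʳ-≤ ∣ T ∣ (∣p∪q∣≤∣p∣+∣q∣ ⁅ s ⁆ ⁅ t ⁆) ⟩
        ∣ T ∣ + (∣ ⁅ s ⁆ ∣ + ∣ ⁅ t ⁆ ∣)   ≡⟨ cong₂ (λ a b → ∣ T ∣ + (a + b)) (∣⁅x⁆∣≡1 s) (∣⁅x⁆∣≡1 t) ⟩
        ∣ T ∣ + 2                         ∎
        where open ≤-Reasoning
      count : ∀ {l} (ps : Vec (Fin n × Fin n) l) T → ∣ foldl (addPair M S) T (toList ps) ∣ ≤ ∣ T ∣ + 2 * l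
      count []           T = m≤m+n _ _
      count {suc l} (p ∷ ps) T = begin
        ∣ foldl (addPair M S) (addPair M S T p) (toList ps) ∣ ≤⟨ count ps (addPair M S T p) ⟩
        ∣ addPair M S T p ∣ + 2 * l                           ≤⟨ +-monoˡ-≤ (2 * l) (addPair≤ T p) ⟩
        ∣ T ∣ + 2 + 2 * l                                     ≡⟨ +-assoc ∣ T ∣ 2 _ ⟩
        ∣ T ∣ + (2 + 2 * l)                                   ≡⟨ cong (∣ T ∣ +_) (*-suc 2 l) ⟨
        ∣ T ∣ + 2 * suc l                                     ∎
        where open ≤-Reasoning

  innerTerminals-mono : ∀ {S S′} → S ⊆ S′ → innerTerminals M S ⊆ innerTerminals M S′
  innerTerminals-mono S⊆S′ v∈ = ∈-foldl⁺ʳ ⊥ (toList M)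
    (Any.map (λ (s∈S , t∈S , v≡) → S⊆S′ s∈S , S⊆S′ t∈S , v≡) (∈-innerTerminals⁻ v∈))

∈-⋃⁺ : ∀ {n} {Ss : List (Subset n)} {v} → Any (v ∈_) Ss → v ∈ ⋃ Ss
∈-⋃⁺ (here v∈)  = x∈p∪q⁺ (inj₁ v∈)
∈-⋃⁺ (there v∈) = x∈p∪q⁺ (inj₂ (∈-⋃⁺ v∈))

∈-⋃⁻ : ∀ {n} (Ss : List (Subset n)) {v} → v ∈ ⋃ Ss → Any (v ∈_) Ss
∈-⋃⁻ []       v∈ = contradiction v∈ ∉⊥
∈-⋃⁻ (S ∷ Ss) v∈ = [ here , there ∘ ∈-⋃⁻ Ss ]′ (x∈p∪q⁻ S (⋃ Ss) v∈)

-- Empty sides stay in the list, so a set of `s` vertices is allowed `1 ⊔ 2 s` pieces. If a side is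
-- empty, a removed vertex pays for it with its allowance of two.
split-count : ∀ a b {x s} → a + b + x ≤ s → 1 ≤ x ⊎ 1 ≤ a × 1 ≤ b →
              (1 ⊔ (a + a)) + (1 ⊔ (b + b)) ≤ 1 ⊔ (s + s)
split-count zero    zero    {suc x} {suc s} le _ = s≤s (≤-trans (s≤s z≤n) (m≤n+m (suc s) s))
split-count zero    (suc b) {suc x} {s} le _ = ≤-trans
  (≤-trans (s≤s (n≤1+n _)) (≤-reflexive (arith b)))
  (≤-trans (+-mono-≤ (≤-trans (m≤m+n (suc (suc b)) x) (≤-trans (≤-reflexive (sym (+-suc (suc b) x))) le))
                     (≤-trans (m≤m+n (suc (suc b)) x) (≤-trans (≤-reflexive (sym (+-suc (suc b) x))) le)))
           (m≤n⊔m 1 (s + s)))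
  where
  arith : ∀ b → suc (suc (suc (b + suc b))) ≡ suc (suc b) + suc (suc b)
  arith = solve-∀
split-count (suc a) zero    {suc x} {s} le _ = ≤-trans
  (≤-trans (n≤1+n _) (≤-reflexive (arith a)))
  (≤-trans (+-mono-≤ (≤-trans (≤-trans (m≤m+n (suc (suc a)) x) (≤-reflexive (arith′ a x))) le)
                     (≤-trans (≤-trans (m≤m+n (suc (suc a)) x) (≤-reflexive (arith′ a x))) le))
           (m≤n⊔m 1 (s + s)))
  where
  arith : ∀ a → suc (suc (a + suc a) + 1) ≡ suc (suc a) + suc (suc a)
  arith = solve-∀
  arith′ : ∀ a x → suc (suc a) + x ≡ suc a + 0 + suc x
  arith′ = solve-∀
split-count (suc a) (suc b) {x} {s} le _ = ≤-trans
  (≤-reflexive (arith (suc a) (suc b)))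
  (≤-trans (+-mono-≤ (≤-trans (m≤m+n _ x) le) (≤-trans (m≤m+n _ x) le)) (m≤n⊔m 1 (s + s)))
  where
  arith : ∀ a b → (a + a) + (b + b) ≡ (a + b) + (a + b)
  arith = solve-∀
split-count zero    zero    {zero} le (inj₁ ())
split-count zero    zero    {zero} le (inj₂ ())
split-count zero    zero    {suc x} {zero} () _
split-count zero    (suc b) {zero} le (inj₁ ())
split-count zero    (suc b) {zero} le (inj₂ ())
split-count (suc a) zero    {zero} le (inj₁ ())
split-count (suc a) zero    {zero} le (inj₂ (_ , ()))

split-smaller : ∀ a b {x s d} → a + b + x ≤ s → 1 ≤ x ⊎ 1 ≤ a × 1 ≤ b → s ≤ suc d → a ≤ d × b ≤ d
split-smaller a b {x} {s} {d} le progress s≤ = ≤-pred (≤-trans a< (≤-trans le s≤)) , ≤-pred (≤-trans b< (≤-trans le s≤))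
  where
  a< : suc a ≤ a + b + x
  a< = [ (λ 1≤x → ≤-trans (≤-reflexive (+-comm 1 a)) (+-mono-≤ (m≤m+n a b) 1≤x))
       , (λ (_ , 1≤b) → ≤-trans (≤-trans (≤-reflexive (+-comm 1 a)) (+-monoʳ-≤ a 1≤b)) (m≤m+n _ x)) ]′ progress
  b< : suc b ≤ a + b + x
  b< = [ (λ 1≤x → ≤-trans (≤-reflexive (+-comm 1 b)) (+-mono-≤ (m≤n+m b a) 1≤x))
       , (λ (1≤a , _) → ≤-trans (+-monoˡ-≤ b 1≤a) (m≤m+n _ x)) ]′ progress

-- Halving argument: the terminals on the smaller side pay for the cut and
-- at least halve in number.
charge : ∀ a b {x t} ℓ → a + b + x ≤ t → t < 2 ^ suc ℓ → a ≤ b →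
         a < 2 ^ ℓ × (a + x) + (a * ℓ + b * suc ℓ) ≤ t * suc ℓ
charge a b {x} {t} ℓ le t< a≤b =
  *-cancelˡ-< 2 a (2 ^ ℓ) (≤-<-trans (≤-trans (≤-reflexive (cong (a +_) (+-identityʳ a)))
    (≤-trans (+-monoʳ-≤ a a≤b) (≤-trans (m≤m+n _ x) le))) t<) ,
  (begin
    (a + x) + (a * ℓ + b * suc ℓ)  ≡⟨ arith a b x ℓ ⟩
    (a + b) * suc ℓ + x            ≤⟨ +-monoʳ-≤ _ (m≤m*n x (suc ℓ)) ⟩
    (a + b) * suc ℓ + x * suc ℓ    ≡⟨ *-distribʳ-+ (suc ℓ) (a + b) x ⟨
    (a + b + x) * suc ℓ            ≤⟨ *-monoˡ-≤ (suc ℓ) le ⟩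
    t * suc ℓ                      ∎)
  where
  open ≤-Reasoning
  arith : ∀ a b x ℓ → (a + x) + (a * ℓ + b * suc ℓ) ≡ (a + b) * suc ℓ + x
  arith = solve-∀

module Pieces (I : Instance)
              (cut : ∀ S → VertexCut (restrictGraph (Instance.graph I) S)) where

  open Instance I

  open Splitting I cut

  K : ℕ
  K = 512 * log k * den

  sparse⇒< : ∀ S → sparse S ≡ true → ∣ VertexCut.X (cut S) ∣ * K < sep S * num
  sparse⇒< S eq = subst₂ _<_
    (trans (cong (∣ VertexCut.X (cut S) ∣ * (512 * log k) *_) (val-digits-fromℕ den)) (*-assoc ∣ VertexCut.X (cut S) ∣ _ den))
    (cong (sep S *_) (val-digits-fromℕ num))
    (Equivalence.to (lessᵇ-correct (∣ VertexCut.X (cut S) ∣ * (512 * log k)) (sep S) (digitsℕ den) (digitsℕ num)) eq)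

  dense⇒≤ : ∀ S → sparse S ≡ false → sep S * num ≤ ∣ VertexCut.X (cut S) ∣ * K
  dense⇒≤ S eq = ≮⇒≥ λ lt → case (trans (sym eq) (Equivalence.from
      (lessᵇ-correct (∣ VertexCut.X (cut S) ∣ * (512 * log k)) (sep S) (digitsℕ den) (digitsℕ num))
      (subst₂ _<_
        (sym (trans (cong (∣ VertexCut.X (cut S) ∣ * (512 * log k) *_) (val-digits-fromℕ den)) (*-assoc ∣ VertexCut.X (cut S) ∣ _ den)))
        (sym (cong (sep S *_) (val-digits-fromℕ num))) lt)))
    where
    case : ¬ (false ≡ true)
    case ()

  module _ (S : Subset n) where
    open VertexCut (cut S)
    A′ B′ : Subset n
    A′ = A ∩ S
    B′ = B ∩ S

    progress : sparse S ≡ true → 1 ≤ ∣ X ∩ S ∣ ⊎ 1 ≤ ∣ A′ ∣ × 1 ≤ ∣ B′ ∣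
    progress eq = separates (cut S) _ (innerTerminals⊆ pairs) (positive-sep (sep S) (sparse⇒< S eq))
      where
      positive-sep : ∀ s {c} → c < s * num → 1 ≤ s
      positive-sep (suc s) _ = s≤s z≤n

    split-sparse : sparse S ≡ true → split S ≡ A′ ∷ B′ ∷ []
    split-sparse eq = cong (ifᵇ_then A′ ∷ B′ ∷ [] else S ∷ []) eq

    split-dense : sparse S ≡ false → split S ≡ S ∷ []
    split-dense eq = cong (ifᵇ_then A′ ∷ B′ ∷ [] else S ∷ []) eq

  pieces-sparse : ∀ d S → sparse S ≡ true → pieces (suc d) S ≡ pieces d (A′ S) ++ pieces d (B′ S)
  pieces-sparse d S eq = trans (cong (concatMap (pieces d)) (split-sparse S eq))
                               (cong (pieces d (A′ S) ++_) (++-identityʳ _))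

  pieces-dense : ∀ d S → sparse S ≡ false → pieces d S ≡ S ∷ []
  pieces-dense zero    S eq = refl
  pieces-dense (suc d) S eq = trans (cong (concatMap (pieces d)) (split-dense S eq))
                                    (trans (++-identityʳ _) (pieces-dense d S eq))

  -- Isolates the case distinction on the test. The case `stop` cannot assume a dense set, since the
  -- depth may run out before all sets are dense.
  pieces-induction : (P : ℕ → Subset n → List (Subset n) → Set) →
    (∀ d S → sparse S ≡ false → P d S (S ∷ [])) →
    (∀ S → P zero S (S ∷ [])) →
    (∀ d S → sparse S ≡ true → P d (A′ S) (pieces d (A′ S)) → P d (B′ S) (pieces d (B′ S)) →
             P (suc d) S (pieces d (A′ S) ++ pieces d (B′ S))) →
    ∀ d S → P d S (pieces d S)
  pieces-induction P dense stop step zero    S = stop S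
  pieces-induction P dense stop step (suc d) S = by-cases (sparse S) refl
    where
    by-cases : ∀ b → sparse S ≡ b → P (suc d) S (pieces (suc d) S)
    by-cases true  eq = subst (P (suc d) S) (sym (pieces-sparse d S eq))
      (step d S eq (pieces-induction P dense stop step d (A′ S)) (pieces-induction P dense stop step d (B′ S)))
    by-cases false eq = subst (P (suc d) S) (sym (pieces-dense (suc d) S eq)) (dense (suc d) S eq)

  length-pieces : ∀ d S → length (pieces d S) ≤ 1 ⊔ (∣ S ∣ + ∣ S ∣)
  length-pieces = pieces-induction (λ _ S Ss → length Ss ≤ 1 ⊔ (∣ S ∣ + ∣ S ∣))
    (λ _ S _ → m≤m⊔n 1 (∣ S ∣ + ∣ S ∣)) (λ S → m≤m⊔n 1 (∣ S ∣ + ∣ S ∣))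
    λ d S eq a b → ≤-trans (≤-reflexive (length-++ (pieces d (A′ S))))
      (≤-trans (+-mono-≤ a b) (split-count ∣ A′ S ∣ ∣ B′ S ∣ (∣cut∣ (cut S) S) (progress S eq)))

  -- Each side of a split has fewer vertices than the set that is split, so only an empty set can be
  -- left when the depth runs out along splits, and an empty set has no sparse cut.
  dense-pieces : ∀ d S → ∣ S ∣ ≤ d → All (λ S → sparse S ≡ false) (pieces d S)
  dense-pieces = pieces-induction (λ d S Ss → ∣ S ∣ ≤ d → All (λ S → sparse S ≡ false) Ss)
    (λ _ S eq _ → eq ∷ [])
    (λ S ∣S∣≤0 → tiny S ∣S∣≤0 ∷ [])
    λ d S eq a b ∣S∣≤ →
      let a≤ , b≤ = split-smaller ∣ A′ S ∣ ∣ B′ S ∣ (∣cut∣ (cut S) S) (progress S eq) ∣S∣≤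
      in Allₚ.++⁺ (a a≤) (b b≤)
    where
    tiny : ∀ S → ∣ S ∣ ≤ 0 → sparse S ≡ false
    tiny S ∣S∣≤0 = by-cases (sparse S) refl
      where
      by-cases : ∀ b → sparse S ≡ b → sparse S ≡ false
      by-cases false eq = eq
      by-cases true  eq = contradiction
        ([ (λ p → ≤-trans p (≤-trans (∣p∩q∣≤∣q∣ (VertexCut.X (cut S)) S) ∣S∣≤0))
         , (λ (p , _) → ≤-trans p (≤-trans (∣p∩q∣≤∣q∣ (VertexCut.A (cut S)) S) ∣S∣≤0)) ]′ (progress S eq)) λ ()

  pieces⊆ : ∀ d S → All (_⊆ S) (pieces d S)
  pieces⊆ = pieces-induction (λ _ S Ss → All (_⊆ S) Ss)
    (λ _ S _ → id ∷ []) (λ S → id ∷ [])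
    λ d S eq a b → Allₚ.++⁺ (All.map (λ {P} P⊆ {v} v∈ → p∩q⊆q _ S (P⊆ v∈)) a)
                            (All.map (λ {P} P⊆ {v} v∈ → p∩q⊆q _ S (P⊆ v∈)) b)

  Apart : Subset n → Subset n → Set
  Apart P Q = ∀ {u v} → u ∈ P → v ∈ Q → u ≢ v × v ∉ nbrs graph u

  apart-pieces : ∀ d S → AllPairs Apart (pieces d S)
  apart-pieces = pieces-induction (λ _ _ Ss → AllPairs Apart Ss)
    (λ _ S _ → [] ∷ []) (λ S → [] ∷ [])
    λ d S eq a b → AllPairsₚ.++⁺ a b
      (All.map (λ {P} P⊆ → All.map {Q = Apart P} (λ {Q} Q⊆ {u} {v} u∈ v∈ → sides S (P⊆ u∈) (Q⊆ v∈)) (pieces⊆ d (B′ S))) (pieces⊆ d (A′ S)))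
    where
    sides : ∀ S → Apart (A′ S) (B′ S)
    sides S u∈ v∈ with u∈A , u∈S ← x∈p∩q⁻ _ S u∈ | v∈B , v∈S ← x∈p∩q⁻ _ S v∈ =
      (λ { refl → VertexCut.A∩B (cut S) (_ , x∈p∩q⁺ (u∈A , v∈B)) }) ,
      λ v∈nbrs → VertexCut.noEdge (cut S) u∈A v∈B (∈-restrict⁺ (nbrs graph) u∈S v∈S v∈nbrs)

  lost : List (Subset n) → Subset n → Subset n
  lost Ss S = S ∩ ∁ (⋃ Ss)

  -- In fractions, with `T` the inner terminals: at most `∣ T ∣ ℓ w / (512 log k)` vertices are
  -- lost. Each terminal holds `ℓ` units of credit. A sparse cut is paid for by one unit from every
  -- terminal in `X` or on the smaller side; the latter continue with `ℓ - 1` units, as their number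
  -- is at most half.
  loss : ∀ d S ℓ → ∣ innerTerminals pairs S ∣ < 2 ^ ℓ →
         ∣ lost (pieces d S) S ∣ * K ≤ ∣ innerTerminals pairs S ∣ * ℓ * num
  loss = pieces-induction (λ _ S Ss → ∀ ℓ → ∣ innerTerminals pairs S ∣ < 2 ^ ℓ →
                             ∣ lost Ss S ∣ * K ≤ ∣ innerTerminals pairs S ∣ * ℓ * num)
    (λ _ S _ ℓ _ → unsplit S) (λ S ℓ _ → unsplit S) step
    where
    -- An inequality only, as a terminal in `C` stops counting when its partner is not in `C`.
    terminals≤ : ∀ S (C : Subset n) → ∣ innerTerminals pairs (C ∩ S) ∣ ≤ ∣ C ∩ innerTerminals pairs S ∣
    terminals≤ S C = p⊆q⇒∣p∣≤∣q∣ λ v∈ → x∈p∩q⁺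
      (p∩q⊆p C S (innerTerminals⊆ pairs v∈) , innerTerminals-mono pairs (p∩q⊆q C S) v∈)

    step : ∀ d S → sparse S ≡ true →
      (∀ ℓ → ∣ innerTerminals pairs (A′ S) ∣ < 2 ^ ℓ →
        ∣ lost (pieces d (A′ S)) (A′ S) ∣ * K ≤ ∣ innerTerminals pairs (A′ S) ∣ * ℓ * num) →
      (∀ ℓ → ∣ innerTerminals pairs (B′ S) ∣ < 2 ^ ℓ →
        ∣ lost (pieces d (B′ S)) (B′ S) ∣ * K ≤ ∣ innerTerminals pairs (B′ S) ∣ * ℓ * num) →
      ∀ ℓ → ∣ innerTerminals pairs S ∣ < 2 ^ ℓ →
      ∣ lost (pieces d (A′ S) ++ pieces d (B′ S)) S ∣ * K ≤ ∣ innerTerminals pairs S ∣ * ℓ * num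
    step d S eq lossA lossB = bound
      where
      open VertexCut (cut S)
      open ≤-Reasoning
      T : Subset n
      T = innerTerminals pairs S
      a b xT t x′ lA lB tA tB : ℕ
      a = ∣ A ∩ T ∣
      b = ∣ B ∩ T ∣
      xT = ∣ X ∩ T ∣
      t = ∣ T ∣
      -- The test bounds the whole of `X`, including vertices outside `S`; charging for these too
      -- only weakens the estimate.
      x′ = ∣ X ∣
      lA = ∣ lost (pieces d (A′ S)) (A′ S) ∣
      lB = ∣ lost (pieces d (B′ S)) (B′ S) ∣
      tA = ∣ innerTerminals pairs (A′ S) ∣
      tB = ∣ innerTerminals pairs (B′ S) ∣

      a+b+x≤t : a + b + xT ≤ t
      a+b+x≤t = ∣cut∣ (cut S) T

      tA≤a : tA ≤ a
      tA≤a = terminals≤ S A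

      tB≤b : tB ≤ b
      tB≤b = terminals≤ S B

      lost⊆ : lost (pieces d (A′ S) ++ pieces d (B′ S)) S
              ⊆ (X ∪ lost (pieces d (A′ S)) (A′ S)) ∪ lost (pieces d (B′ S)) (B′ S)
      lost⊆ {v} v∈ with v∈S , v∉′ ← x∈p∩q⁻ S _ v∈ with v∉ ← x∈∁p⇒x∉p v∉′ with covers v
      ... | inj₁ v∈A = x∈p∪q⁺ (inj₁ (x∈p∪q⁺ (inj₂ (x∈p∩q⁺ (x∈p∩q⁺ (v∈A , v∈S) ,
              x∉p⇒x∈∁p λ v∈⋃ → v∉ (∈-⋃⁺ (Anyₚ.++⁺ˡ (∈-⋃⁻ (pieces d (A′ S)) v∈⋃))))))))
      ... | inj₂ (inj₁ v∈X) = x∈p∪q⁺ (inj₁ (x∈p∪q⁺ (inj₁ v∈X)))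
      ... | inj₂ (inj₂ v∈B) = x∈p∪q⁺ (inj₂ (x∈p∩q⁺ (x∈p∩q⁺ (v∈B , v∈S) ,
              x∉p⇒x∈∁p λ v∈⋃ → v∉ (∈-⋃⁺ (Anyₚ.++⁺ʳ (pieces d (A′ S)) (∈-⋃⁻ (pieces d (B′ S)) v∈⋃))))))

      ∣lost∣ : ∣ lost (pieces d (A′ S) ++ pieces d (B′ S)) S ∣ ≤ x′ + lA + lB
      ∣lost∣ = ≤-trans (p⊆q⇒∣p∣≤∣q∣ lost⊆)
        (≤-trans (∣p∪q∣≤∣p∣+∣q∣ (X ∪ lost (pieces d (A′ S)) (A′ S)) (lost (pieces d (B′ S)) (B′ S)))
                 (+-monoˡ-≤ lB (∣p∪q∣≤∣p∣+∣q∣ X (lost (pieces d (A′ S)) (A′ S)))))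

      total : ∀ {c ℓA ℓB} → lA * K ≤ tA * ℓA * num → lB * K ≤ tB * ℓB * num →
              sep S + (a * ℓA + b * ℓB) ≤ c →
              ∣ lost (pieces d (A′ S) ++ pieces d (B′ S)) S ∣ * K ≤ c * num
      total {c} {ℓA} {ℓB} hA hB hc = begin
        ∣ lost (pieces d (A′ S) ++ pieces d (B′ S)) S ∣ * K ≤⟨ *-monoˡ-≤ K ∣lost∣ ⟩
        (x′ + lA + lB) * K                                  ≡⟨ distrib x′ lA lB K ⟩
        x′ * K + (lA * K + lB * K)                          ≤⟨ +-mono-≤ (<⇒≤ (sparse⇒< S eq)) (+-mono-≤ hA hB) ⟩
        sep S * num + (tA * ℓA * num + tB * ℓB * num)       ≤⟨ +-monoʳ-≤ (sep S * num) (+-mono-≤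
                                                                 (*-monoˡ-≤ num (*-monoˡ-≤ ℓA tA≤a))
                                                                 (*-monoˡ-≤ num (*-monoˡ-≤ ℓB tB≤b))) ⟩
        sep S * num + (a * ℓA * num + b * ℓB * num)         ≡⟨ factor (sep S) (a * ℓA) (b * ℓB) num ⟩
        (sep S + (a * ℓA + b * ℓB)) * num                   ≤⟨ *-monoˡ-≤ num hc ⟩
        c * num                                             ∎
        where
        distrib : ∀ c a b k → (c + a + b) * k ≡ c * k + (a * k + b * k)
        distrib = solve-∀
        factor : ∀ s a b k → s * k + (a * k + b * k) ≡ (s + (a + b)) * k
        factor = solve-∀

      bound : ∀ ℓ → t < 2 ^ ℓ → ∣ lost (pieces d (A′ S) ++ pieces d (B′ S)) S ∣ * K ≤ t * ℓ * num
      -- No terminal is left, so nothing is separated and the cut cannot have passed the test.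
      bound zero t<1 = contradiction (sparse⇒< S eq) (≤⇒≯ (≤-trans (*-monoˡ-≤ num sep≤0) z≤n))
        where
        sep≤0 : sep S ≤ 0
        sep≤0 = ≤-trans (+-monoˡ-≤ xT (≤-trans (m⊓n≤m a b) (m≤m+n a b))) (≤-trans a+b+x≤t (≤-pred t<1))
      bound (suc ℓ) t< with ≤-total a b
      ... | inj₁ a≤b with a< , le ← charge a b ℓ a+b+x≤t t< a≤b =
        total (lossA ℓ (≤-<-trans tA≤a a<)) (lossB (suc ℓ) (≤-<-trans (≤-trans tB≤b (≤-trans (m≤n+m b a) (m≤m+n _ xT))) (≤-<-trans a+b+x≤t t<)))
          (subst (λ s → s + xT + (a * ℓ + b * suc ℓ) ≤ t * suc ℓ) (sym (m≤n⇒m⊓n≡m a≤b)) le)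
      ... | inj₂ b≤a with b< , le ← charge b a ℓ (≤-trans (≤-reflexive (cong (_+ xT) (+-comm b a))) a+b+x≤t) t< b≤a =
        total (lossA (suc ℓ) (≤-<-trans (≤-trans tA≤a (≤-trans (m≤m+n a b) (m≤m+n _ xT))) (≤-<-trans a+b+x≤t t<))) (lossB ℓ (≤-<-trans tB≤b b<))
          (subst₂ (λ s r → s + xT + r ≤ t * suc ℓ) (sym (m≥n⇒m⊓n≡n b≤a)) (+-comm (b * ℓ) (a * suc ℓ)) le)

    unsplit : ∀ S {c} → ∣ lost (S ∷ []) S ∣ * K ≤ c
    unsplit S = ≤-trans (*-monoˡ-≤ K (≤-trans (p⊆q⇒∣p∣≤∣q∣ {q = ⊥} λ v∈ →
      let v∈S , v∉ = x∈p∩q⁻ S (∁ (⋃ (S ∷ []))) v∈ in contradiction (∈-⋃⁺ {Ss = S ∷ []} (here v∈S)) (x∈∁p⇒x∉p v∉)) (≤-reflexive (∣⊥∣≡0 n)))) z≤n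

-- Fractions and flows

-- In scope, this makes sections such as (a +_) ambiguous; hence so late.
open import Data.Integer.Base using (+_)

toℚᵘ-/ : ∀ a b → ℚ.toℚᵘ (+ a / suc b) ℚᵘ.≃ mkℚᵘ (+ a) b
toℚᵘ-/ a b = ℚₚ.toℚᵘ-fromℚᵘ (mkℚᵘ (+ a) b)

/-mono-≤ : ∀ a b c d .{{_ : NonZero b}} .{{_ : NonZero d}} → a ℕ.* d ℕ.≤ c ℕ.* b → + a / b ℚ.≤ + c / d
/-mono-≤ a (suc b) c (suc d) le = ℚₚ.toℚᵘ-cancel-≤
  (ℚᵘₚ.≤-respˡ-≃ (ℚᵘₚ.≃-sym (toℚᵘ-/ a b)) (ℚᵘₚ.≤-respʳ-≃ (ℚᵘₚ.≃-sym (toℚᵘ-/ c d))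
    (*≤* (subst₂ ℤ._≤_ (ℤₚ.pos-* a (suc d)) (ℤₚ.pos-* c (suc b)) (ℤ.+≤+ le)))))

/-cancel-≤ : ∀ a b c d .{{_ : NonZero b}} .{{_ : NonZero d}} → + a / b ℚ.≤ + c / d → a ℕ.* d ℕ.≤ c ℕ.* b
/-cancel-≤ a (suc b) c (suc d) le
  with *≤* le′ ← ℚᵘₚ.≤-respˡ-≃ (toℚᵘ-/ a b) (ℚᵘₚ.≤-respʳ-≃ (toℚᵘ-/ c d) (ℚₚ.toℚᵘ-mono-≤ le)) =
  ℤₚ.drop‿+≤+ (subst₂ ℤ._≤_ (sym (ℤₚ.pos-* a (suc d))) (sym (ℤₚ.pos-* c (suc b))) le′)

/-*-/ : ∀ a b c d .{{_ : NonZero b}} .{{_ : NonZero d}} →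
        (+ a / b) ℚ.* (+ c / d) ≡ (+ (a ℕ.* c) / (b ℕ.* d)) {{ℕₚ.m*n≢0 b d}}
/-*-/ a (suc b) c (suc d) = ℚₚ.toℚᵘ-injective
  (ℚᵘₚ.≃-trans (ℚₚ.toℚᵘ-homo-* (+ a / suc b) (+ c / suc d))
    (ℚᵘₚ.≃-trans (ℚᵘₚ.*-cong (toℚᵘ-/ a b) (toℚᵘ-/ c d))
      (ℚᵘₚ.≃-trans (ℚᵘₚ.≃-reflexive (cong (λ i → mkℚᵘ i _) (sym (ℤₚ.pos-* a c))))
        (ℚᵘₚ.≃-sym (toℚᵘ-/ (a ℕ.* c) _)))))

/-nonNegative : ∀ a b .{{_ : NonZero b}} → 0ℚ ℚ.≤ + a / b
/-nonNegative a b = ℚₚ.nonNegative⁻¹ (+ a / b) {{ℚₚ.normalize-nonNeg a b}}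

nonNegative≡/ : ∀ q → 0ℚ ℚ.≤ q → q ≡ + ℤ.∣ ↥ q ∣ / ↧ₙ q
nonNegative≡/ q@(ℚ.mkℚ (+ n) d c)    0≤q = sym (ℚₚ.↥p/↧p≡p q)
nonNegative≡/ (ℚ.mkℚ -[1+ n ] d c) 0≤q with () ← ℚ.nonNegative 0≤q

multiple : ℕ → ℚ → ℚ
multiple zero    q = 0ℚ
multiple (suc k) q = q ℚ.+ multiple k q

multiple≡* : ∀ k q → multiple k q ≡ (+ k / 1) ℚ.* q
multiple≡* zero    q = sym (ℚₚ.*-zeroˡ q)
multiple≡* (suc k) q = begin
  q ℚ.+ multiple k q              ≡⟨ cong₂ ℚ._+_ (sym (ℚₚ.*-identityˡ q)) (multiple≡* k q) ⟩
  1ℚ ℚ.* q ℚ.+ (+ k / 1) ℚ.* q    ≡⟨ ℚₚ.*-distribʳ-+ q 1ℚ (+ k / 1) ⟨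
  (1ℚ ℚ.+ (+ k / 1)) ℚ.* q        ≡⟨ cong (ℚ._* q) 1+k ⟩
  (+ suc k / 1) ℚ.* q             ∎
  where
  open ≡-Reasoning
  1+k : 1ℚ ℚ.+ (+ k / 1) ≡ + suc k / 1
  1+k = ℚₚ.toℚᵘ-injective (ℚᵘₚ.≃-trans (ℚₚ.toℚᵘ-homo-+ 1ℚ (+ k / 1))
    (ℚᵘₚ.≃-trans (ℚᵘₚ.+-congʳ (ℚ.toℚᵘ 1ℚ) (toℚᵘ-/ k 0))
      (ℚᵘₚ.≃-trans (*≡* (cong (λ i → i ℤ.* + 1) (trans (cong (λ i → + 1 ℤ.+ i) (ℤₚ.*-identityʳ (+ k))) refl))) (ℚᵘₚ.≃-sym (toℚᵘ-/ (suc k) 0)))))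

multiple-mono : ∀ {q} → 0ℚ ℚ.≤ q → ∀ {j k} → j ℕ.≤ k → multiple j q ℚ.≤ multiple k q
multiple-mono {q} 0≤q {k = zero}  z≤n       = ℚₚ.≤-refl
multiple-mono {q} 0≤q {k = suc k} z≤n       = subst (ℚ._≤ multiple (suc k) q) (ℚₚ.+-identityˡ 0ℚ)
                                                (ℚₚ.+-mono-≤ 0≤q (multiple-mono 0≤q {k = k} z≤n))
multiple-mono {q} 0≤q (s≤s j≤k) = ℚₚ.+-monoʳ-≤ q (multiple-mono 0≤q j≤k)

≤-+ˡ : ∀ {p q} → 0ℚ ℚ.≤ p → q ℚ.≤ p ℚ.+ q
≤-+ˡ {p} {q} 0≤p = subst (ℚ._≤ p ℚ.+ q) (ℚₚ.+-identityˡ q) (ℚₚ.+-monoˡ-≤ q 0≤p)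

length-covers : ∀ {n} (p : Subset n) vs → (∀ {v} → v ∈ p → v ∈ᴸ vs) → ∣ p ∣ ℕ.≤ length vs
length-covers {n} p []       covers = ℕₚ.≤-trans (p⊆q⇒∣p∣≤∣q∣ {q = ⊥} λ v∈ → contradiction (covers v∈) λ ()) (ℕₚ.≤-reflexive (∣⊥∣≡0 n))
length-covers p (v ∷ vs) covers = begin
  ∣ p ∣                   ≤⟨ p⊆q⇒∣p∣≤∣q∣ p⊆ ⟩
  ∣ ⁅ v ⁆ ∪ (p - v) ∣     ≤⟨ ∣p∪q∣≤∣p∣+∣q∣ ⁅ v ⁆ (p - v) ⟩
  ∣ ⁅ v ⁆ ∣ ℕ.+ ∣ p - v ∣ ≡⟨ cong (ℕ._+ ∣ p - v ∣) (∣⁅x⁆∣≡1 v) ⟩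
  suc ∣ p - v ∣           ≤⟨ s≤s (length-covers (p - v) vs λ u∈ → rest u∈ (covers (p─q⊆p p ⁅ v ⁆ u∈))) ⟩
  suc (length vs)         ∎
  where
  open ℕₚ.≤-Reasoning
  p⊆ : p ⊆ ⁅ v ⁆ ∪ (p - v)
  p⊆ {u} u∈ with u Finₚ.≟ v
  ... | yes refl = x∈p∪q⁺ (inj₁ (x∈⁅x⁆ u))
  ... | no  u≢v  = x∈p∪q⁺ (inj₂ (x∈p∧x≢y⇒x∈p-y u∈ u≢v))
  rest : ∀ {u} → u ∈ p - v → u ∈ᴸ v ∷ vs → u ∈ᴸ vs
  rest u∈ (there u∈vs) = u∈vs
  rest u∈ (here refl)  = contradiction (x∈p⇒∣p-x∣<∣p∣ u∈) (ℕₚ.<-irrefl (cong ∣_∣ (p─q─q≡p─q p ⁅ v ⁆)))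

module _ {n m : ℕ} {G : Graph n} {M : Demands n m} {w : ℚ} (0≤w : 0ℚ ℚ.≤ w) (F : Flow G M w) where
  open Flow F
  open DecMembership (Finₚ._≟_ {n}) using () renaming (_∈?_ to _∈ᴸ?_)

  private
    Weighted : Set
    Weighted = List (Fin n) × ℚ

    weight : List Weighted → ℚ
    weight Q = sumℚ (map proj₂ Q)

    load : Fin n → List Weighted → ℚ
    load v Q = weight (filter (λ (P , _) → v ∈ᴸ? P) Q)

    loads : List (Fin n) → List Weighted → ℚ
    loads xs Q = sumℚ (map (λ v → load v Q) xs)

    Positive : List Weighted → Set
    Positive = All (λ (_ , f) → 0ℚ ℚ.≤ f)

    Hits : List (Fin n) → List (Fin n) → Set
    Hits xs P = Any (_∈ᴸ P) xs

    load-hit : ∀ {v P f Q} → v ∈ᴸ P → load v ((P , f) ∷ Q) ≡ f ℚ.+ load v Q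
    load-hit {v} {P} v∈P with v ∈ᴸ? P
    ... | yes _   = refl
    ... | no  v∉P = contradiction v∈P v∉P

    load-mono : ∀ v {P f Q} → 0ℚ ℚ.≤ f → load v Q ℚ.≤ load v ((P , f) ∷ Q)
    load-mono v {P} 0≤f with v ∈ᴸ? P
    ... | yes _ = ≤-+ˡ 0≤f
    ... | no  _ = ℚₚ.≤-refl

    loads-mono : ∀ xs {P f Q} → 0ℚ ℚ.≤ f → loads xs Q ℚ.≤ loads xs ((P , f) ∷ Q)
    loads-mono []              0≤f = ℚₚ.≤-refl
    loads-mono (v ∷ xs) {P} {f} {Q} 0≤f = ℚₚ.+-mono-≤ (load-mono v {P} {f} {Q} 0≤f) (loads-mono xs {P} {f} {Q} 0≤f)

    -- A path is counted at every vertex of `xs` that it visits, so at least once.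
    loads-hit : ∀ {xs P f Q} → Hits xs P → 0ℚ ℚ.≤ f → f ℚ.+ loads xs Q ℚ.≤ loads xs ((P , f) ∷ Q)
    loads-hit {v ∷ xs} {P} {f} {Q} (here v∈P) 0≤f = begin
      f ℚ.+ (load v Q ℚ.+ loads xs Q)                   ≡⟨ ℚₚ.+-assoc f (load v Q) (loads xs Q) ⟨
      f ℚ.+ load v Q ℚ.+ loads xs Q                     ≤⟨ ℚₚ.+-mono-≤ (ℚₚ.≤-reflexive (sym (load-hit {v} {P} {f} {Q} v∈P))) (loads-mono xs {P} {f} {Q} 0≤f) ⟩
      load v ((P , f) ∷ Q) ℚ.+ loads xs ((P , f) ∷ Q)   ∎
      where open ℚₚ.≤-Reasoning
    loads-hit {v ∷ xs} {P} {f} {Q} (there hit) 0≤f = begin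
      f ℚ.+ (load v Q ℚ.+ loads xs Q)                   ≡⟨ ℚₚ.+-assoc f (load v Q) (loads xs Q) ⟨
      f ℚ.+ load v Q ℚ.+ loads xs Q                     ≡⟨ cong (ℚ._+ loads xs Q) (ℚₚ.+-comm f (load v Q)) ⟩
      load v Q ℚ.+ f ℚ.+ loads xs Q                     ≡⟨ ℚₚ.+-assoc (load v Q) f (loads xs Q) ⟩
      load v Q ℚ.+ (f ℚ.+ loads xs Q)                   ≤⟨ ℚₚ.+-mono-≤ (load-mono v {P} {f} {Q} 0≤f) (loads-hit {xs} {P} {f} {Q} hit 0≤f) ⟩
      load v ((P , f) ∷ Q) ℚ.+ loads xs ((P , f) ∷ Q)   ∎
      where open ℚₚ.≤-Reasoning

    loads-++ : ∀ xs Q R → Positive Q → loads xs R ℚ.≤ loads xs (Q ++ R)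
    loads-++ xs []      R []          = ℚₚ.≤-refl
    loads-++ xs ((P , f) ∷ Q) R (0≤f ∷ 0≤Q) = ℚₚ.≤-trans (loads-++ xs Q R 0≤Q) (loads-mono xs {P} {f} {Q ++ R} 0≤f)

    loads-++-hit : ∀ xs Q R → Positive Q → All (λ (P , _) → Hits xs P) Q →
                   weight Q ℚ.+ loads xs R ℚ.≤ loads xs (Q ++ R)
    loads-++-hit xs []            R []          []           = ℚₚ.≤-reflexive (ℚₚ.+-identityˡ _)
    loads-++-hit xs ((P , f) ∷ Q) R (0≤f ∷ 0≤Q) (hit ∷ hits) = begin
      f ℚ.+ weight Q ℚ.+ loads xs R   ≡⟨ ℚₚ.+-assoc f (weight Q) (loads xs R) ⟩
      f ℚ.+ (weight Q ℚ.+ loads xs R) ≤⟨ ℚₚ.+-monoʳ-≤ f (loads-++-hit xs Q R 0≤Q hits) ⟩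
      f ℚ.+ loads xs (Q ++ R)         ≤⟨ loads-hit {xs} {P} {f} {Q ++ R} hit 0≤f ⟩
      loads xs ((P , f) ∷ Q ++ R)     ∎
      where open ℚₚ.≤-Reasoning

    loads≥0 : ∀ xs → 0ℚ ℚ.≤ loads xs []
    loads≥0 []       = ℚₚ.≤-refl
    loads≥0 (v ∷ xs) = ℚₚ.≤-trans (loads≥0 xs) (≤-+ˡ ℚₚ.≤-refl)

    loads≤ : ∀ xs Q → (∀ v → load v Q ℚ.≤ 1ℚ) → loads xs Q ℚ.≤ multiple (length xs) 1ℚ
    loads≤ []       Q load≤ = ℚₚ.≤-refl
    loads≤ (v ∷ xs) Q load≤ = ℚₚ.+-mono-≤ (load≤ v) (loads≤ xs Q load≤)

  -- The flow of every pair in Y is counted at some vertex of X, and the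
  -- vertices of X have capacity 1.
  cut-capacity : (X : Subset n) (Y : Subset m) →
    (∀ {i} → i ∈ Y → ∀ {P} → IsPath (whole G) (source M i) (target M i) P → Any (_∈ X) P) →
    (+ ∣ Y ∣ / 1) ℚ.* w ℚ.≤ + ∣ X ∣ / 1
  cut-capacity X Y meets = begin
    (+ ∣ Y ∣ / 1) ℚ.* w                             ≡⟨ multiple≡* ∣ Y ∣ w ⟨
    multiple (∣ Y ∣) w                              ≤⟨ multiple-mono 0≤w (length-covers Y _ λ {i} i∈Y → ∈-filter⁺ (λ i → i ∈? Y) (∈-allFin i) i∈Y) ⟩
    multiple (length (filter (λ i → i ∈? Y) (allFin m))) w ≤⟨ accumulate (allFin m) ⟩
    loads xs (concatMap paths (allFin m))           ≤⟨ loads≤ xs (concatMap paths (allFin m)) capacity ⟩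
    multiple (length xs) 1ℚ                         ≡⟨ cong (λ k → multiple k 1ℚ) (length-elements X) ⟩
    multiple (∣ X ∣) 1ℚ                             ≡⟨ multiple≡* ∣ X ∣ 1ℚ ⟩
    (+ ∣ X ∣ / 1) ℚ.* 1ℚ                            ≡⟨ ℚₚ.*-identityʳ _ ⟩
    + ∣ X ∣ / 1                                     ∎
    where
    open ℚₚ.≤-Reasoning
    xs : List (Fin n)
    xs = elements X

    hits : ∀ {P} → Any (_∈ X) P → Hits xs P
    hits meet with _ , v∈P , v∈X ← find meet = lose (∈-elements⁺ X v∈X) v∈P

    accumulate : ∀ is → multiple (length (filter (λ i → i ∈? Y) is)) w ℚ.≤ loads xs (concatMap paths is)
    accumulate []       = loads≥0 xs
    accumulate (i ∷ is) with i ∈? Y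
    ... | no  _   = ℚₚ.≤-trans (accumulate is) (loads-++ xs (paths i) (concatMap paths is) (All.map proj₂ (routes i)))
    ... | yes i∈Y = ℚₚ.≤-trans
      (ℚₚ.+-mono-≤ (ℚₚ.≤-reflexive (sym (value i))) (accumulate is))
      (loads-++-hit xs (paths i) (concatMap paths is) (All.map proj₂ (routes i))
        (All.map (λ (path , _) → hits (meets i∈Y path)) (routes i)))

-- Well-linkedness

-- The smallest value of `l` digits is `2 ^ l - 1`, when all of them are 1. The largest is
-- `2 ^ (l + 1) - 2`, when all of them are 2; this is the extreme case of `≤2^length`.
2^length≤ : ∀ xs → 2 ℕ.^ length xs ℕ.≤ suc (val xs)
2^length≤ []           = ℕₚ.≤-refl
2^length≤ (true  ∷ xs) = ℕₚ.≤-trans (ℕₚ.*-monoʳ-≤ 2 (2^length≤ xs)) (ℕₚ.≤-reflexive (arith (val xs)))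
  where
  arith : ∀ v → 2 ℕ.* suc v ≡ suc (1 ℕ.+ 2 ℕ.* v)
  arith = solve-∀
2^length≤ (false ∷ xs) = ℕₚ.≤-trans (ℕₚ.*-monoʳ-≤ 2 (2^length≤ xs))
  (ℕₚ.≤-trans (ℕₚ.≤-reflexive (arith (val xs))) (ℕₚ.n≤1+n _))
  where
  arith : ∀ v → 2 ℕ.* suc v ≡ 2 ℕ.+ 2 ℕ.* v
  arith = solve-∀

≤2^length : ∀ xs → 2 ℕ.+ val xs ℕ.≤ 2 ℕ.^ suc (length xs)
≤2^length []           = ℕₚ.≤-refl
≤2^length (true  ∷ xs) = ℕₚ.≤-trans (ℕₚ.≤-trans (ℕₚ.n≤1+n _) (ℕₚ.≤-reflexive (arith (val xs)))) (ℕₚ.*-monoʳ-≤ 2 (≤2^length xs))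
  where
  arith : ∀ v → suc (2 ℕ.+ (1 ℕ.+ 2 ℕ.* v)) ≡ 2 ℕ.* (2 ℕ.+ v)
  arith = solve-∀
≤2^length (false ∷ xs) = ℕₚ.≤-trans (ℕₚ.≤-reflexive (arith (val xs))) (ℕₚ.*-monoʳ-≤ 2 (≤2^length xs))
  where
  arith : ∀ v → 2 ℕ.+ (2 ℕ.+ 2 ℕ.* v) ≡ 2 ℕ.* (2 ℕ.+ v)
  arith = solve-∀

module _ {k : ℕ} (2≤k : 2 ℕ.≤ k) where

  private
    len : ℕ
    len = length (digitsℕ k)

    2^len≤ : 2 ℕ.^ len ℕ.≤ suc k
    2^len≤ = subst (λ v → 2 ℕ.^ len ℕ.≤ suc v) (val-digits-fromℕ k) (2^length≤ (digitsℕ k))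

    ≤2^len : 2 ℕ.+ k ℕ.≤ 2 ℕ.^ suc len
    ≤2^len = subst (λ v → 2 ℕ.+ v ℕ.≤ 2 ℕ.^ suc len) (val-digits-fromℕ k) (≤2^length (digitsℕ k))

    len≥1 : 1 ℕ.≤ len
    len≥1 = positive-exponent len (ℕₚ.≤-trans (s≤s (s≤s (ℕₚ.≤-trans (s≤s z≤n) 2≤k))) ≤2^len)
      where
      positive-exponent : ∀ l → 3 ℕ.≤ 2 ℕ.^ suc l → 1 ℕ.≤ l
      positive-exponent zero    (s≤s (s≤s ()))
      positive-exponent (suc l) _ = s≤s z≤n

  -- For `len ≥ 2`, halving the power in `2 ^ len ≤ k + 1` absorbs the extra 1. Shorter numerals
  -- have `log k ≡ 1` and rely on `2 ≤ k`.
  2^log≤ : 2 ℕ.^ log k ℕ.≤ k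
  2^log≤ = cases len 2^len≤
    where
    cases : ∀ l → 2 ℕ.^ l ℕ.≤ suc k → 2 ℕ.^ suc (l ℕ.∸ 2) ℕ.≤ k
    cases zero          _ = 2≤k
    cases (suc zero)    _ = 2≤k
    cases (suc (suc l)) h = ℕₚ.≤-pred (ℕₚ.≤-trans
      (ℕₚ.≤-trans (ℕₚ.≤-reflexive (ℕₚ.+-comm 1 p)) (ℕₚ.+-monoʳ-≤ p (ℕₚ.≤-trans (ℕₚ.m^n>0 2 (suc l)) (ℕₚ.≤-reflexive (sym (ℕₚ.+-identityʳ p)))))) h)
      where
      p : ℕ
      p = 2 ℕ.^ suc l

  -- An `ℓ` for `loss`, as there are at most `2 k` terminals. The factor 4 is attained for numerals
  -- of length 2, where `ℓ` is 4 and `log k` is 1.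
  exponent : ∃[ ℓ ] (2 ℕ.* k ℕ.< 2 ℕ.^ ℓ × ℓ ℕ.≤ 4 ℕ.* log k)
  exponent = suc (suc len) , ℕₚ.<-≤-trans (ℕₚ.*-monoʳ-< 2 (ℕₚ.≤-trans (ℕₚ.n≤1+n _) ≤2^len)) ℕₚ.≤-refl , cases len len≥1
    where
    cases : ∀ l → 1 ℕ.≤ l → 2 ℕ.+ l ℕ.≤ 4 ℕ.* suc (l ℕ.∸ 2)
    cases (suc zero)    _ = s≤s (s≤s (s≤s z≤n))
    cases (suc (suc l)) _ = ℕₚ.≤-trans (ℕₚ.+-monoʳ-≤ 4 (ℕₚ.m≤n*m l 4)) (ℕₚ.≤-reflexive (sym (ℕₚ.*-suc 4 l)))

module _ {n : ℕ} (G : Graph n) (S : Subset n) where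

  edges : List (Fin n × Fin n)
  edges = filter (λ (u , v) → v ∈? restrict (nbrs G) S u) (cartesianProduct (allFin n) (allFin n))

  ∈-edges⁺ : ∀ {u v} → v ∈ restrict (nbrs G) S u → (u , v) ∈ᴸ edges
  ∈-edges⁺ {u} {v} = ∈-filter⁺ (λ (u , v) → v ∈? restrict (nbrs G) S u) (∈-cartesianProduct⁺ (∈-allFin u) (∈-allFin v))

  ∈-edges⁻ : ∀ {u v} → (u , v) ∈ᴸ edges → v ∈ restrict (nbrs G) S u
  ∈-edges⁻ e = proj₂ (∈-filter⁻ (λ (u , v) → v ∈? restrict (nbrs G) S u) {xs = cartesianProduct (allFin n) (allFin n)} e)

  walk⇒path : ∀ {s t vs} → s ∈ S → Walk edges s t vs → List.head vs ≡ just s × List.last vs ≡ just t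
              × All (_∈ S) vs × Linked (λ u v → v ∈ restrict (nbrs G) S u) vs
  walk⇒path s∈ [-]           = refl , refl , s∈ ∷ [] , [-]
  walk⇒path s∈ (e ∷ [-])     = let r = ∈-edges⁻ e; v∈ = proj₁ (proj₂ (∈-restrict⁻ (nbrs G) _ r)) in
    refl , refl , s∈ ∷ v∈ ∷ [] , r ∷ [-]
  walk⇒path s∈ (e ∷ w@(_ ∷ _)) =
    let r = ∈-edges⁻ e
        _ , last , inner , linked = walk⇒path (proj₁ (proj₂ (∈-restrict⁻ (nbrs G) _ r))) w
    in refl , last , s∈ ∷ inner , r ∷ linked

  separation⇒cut : ∀ {A B X} → Separation edges A B X → VertexCut (restrictGraph G S)
  separation⇒cut {X = X} sep = record
    { A      = R
    ; X      = X
    ; B      = ∁ (R ∪ X)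
    ; covers = covers
    ; A∩X    = λ (v , v∈) → let v∈R , v∈X = x∈p∩q⁻ R X v∈ in avoids v∈R v∈X
    ; A∩B    = λ (v , v∈) → let v∈R , v∉ = x∈p∩q⁻ R (∁ (R ∪ X)) v∈ in x∈∁p⇒x∉p v∉ (x∈p∪q⁺ (inj₁ v∈R))
    ; X∩B    = λ (v , v∈) → let v∈X , v∉ = x∈p∩q⁻ X (∁ (R ∪ X)) v∈ in x∈∁p⇒x∉p v∉ (x∈p∪q⁺ (inj₂ v∈X))
    ; noEdge = λ u∈R v∈B v∈nbrs → x∈∁p⇒x∉p v∈B (x∈p∪q⁺ (closed (∈-edges⁺ v∈nbrs) u∈R))
    }
    where
    open Separation sep
    covers : ∀ v → v ∈ R ⊎ v ∈ X ⊎ v ∈ ∁ (R ∪ X)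
    covers v with v ∈? R | v ∈? X
    ... | yes v∈R | _       = inj₁ v∈R
    ... | no  _   | yes v∈X = inj₂ (inj₁ v∈X)
    ... | no  v∉R | no  v∉X = inj₂ (inj₂ (x∉p⇒x∈∁p λ v∈ → [ v∉R , v∉X ]′ (x∈p∪q⁻ R X v∈)))

  -- Vertices of `T₁` lie in `R` or `X`, those of `T₂` outside `R`. So each of the two sets fits
  -- into its own side together with `X`, and `∣ X ∩ T ∣` can be pulled out of the minimum.
  separated≥ : ∀ {T T₁ T₂ X} (sep : Separation edges T₁ T₂ X) → T₁ ⊆ T → T₂ ⊆ T → ∣ T₁ ∣ ≡ ∣ T₂ ∣ →
               ∣ T₁ ∣ ℕ.≤ separated T (separation⇒cut sep)
  separated≥ {T} {T₁} {T₂} {X} sep T₁⊆T T₂⊆T ∣T₁∣≡∣T₂∣ = begin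
    ∣ T₁ ∣                                                      ≤⟨ ℕₚ.⊓-glb
      (side T₁ R T₁⊆T (λ v∉X v∈T₁ → [ id , (λ v∈X → contradiction v∈X v∉X) ]′ (from v∈T₁)))
      (ℕₚ.≤-trans (ℕₚ.≤-reflexive ∣T₁∣≡∣T₂∣)
        (side T₂ (∁ (R ∪ X)) T₂⊆T λ v∉X v∈T₂ → x∉p⇒x∈∁p λ v∈ → [ to v∈T₂ , v∉X ]′ (x∈p∪q⁻ R X v∈))) ⟩
    (∣ R ∩ T ∣ ℕ.+ ∣ X ∩ T ∣) ⊓ (∣ ∁ (R ∪ X) ∩ T ∣ ℕ.+ ∣ X ∩ T ∣) ≡⟨ ℕₚ.+-distribʳ-⊓ (∣ X ∩ T ∣) (∣ R ∩ T ∣) (∣ ∁ (R ∪ X) ∩ T ∣) ⟨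
    (∣ R ∩ T ∣ ⊓ ∣ ∁ (R ∪ X) ∩ T ∣) ℕ.+ ∣ X ∩ T ∣               ∎
    where
    open ℕₚ.≤-Reasoning
    open Separation sep
    side : ∀ T′ C → T′ ⊆ T → (∀ {v} → v ∉ X → v ∈ T′ → v ∈ C) → ∣ T′ ∣ ℕ.≤ ∣ C ∩ T ∣ ℕ.+ ∣ X ∩ T ∣
    side T′ C T′⊆T outside⇒C = ℕₚ.≤-trans (p⊆q⇒∣p∣≤∣q∣ covered) (∣p∪q∣≤∣p∣+∣q∣ (C ∩ T) (X ∩ T))
      where
      covered : T′ ⊆ (C ∩ T) ∪ (X ∩ T)
      covered {v} v∈ with v ∈? X
      ... | yes v∈X = x∈p∪q⁺ (inj₂ (x∈p∩q⁺ (v∈X , T′⊆T v∈)))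
      ... | no  v∉X = x∈p∪q⁺ (inj₁ (x∈p∩q⁺ (outside⇒C v∉X v∈ , T′⊆T v∈)))

-- log₂ k is only used through the integer L ≤ log₂ k.
≤·log₂ : ∀ {w s} {k L} → 0ℚ ℚ.≤ w → 0ℚ ℚ.≤ s → 2 ℕ.^ L ℕ.≤ k → w ℚ.≤ s ℚ.* (+ L / 1) → w ≤ s ·log₂ k
≤·log₂ {w} {s} {k} {L} 0≤w 0≤s 2^L≤k le = begin
  2 ℕ.^ (ℤ.∣ ↥ w ∣ ℕ.* ↧ₙ s)        ≤⟨ ℕₚ.^-monoʳ-≤ 2 cross ⟩
  2 ℕ.^ (L ℕ.* (ℤ.∣ ↥ s ∣ ℕ.* ↧ₙ w)) ≡⟨ ℕₚ.^-*-assoc 2 L _ ⟨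
  (2 ℕ.^ L) ℕ.^ (ℤ.∣ ↥ s ∣ ℕ.* ↧ₙ w) ≤⟨ ℕₚ.^-monoˡ-≤ (ℤ.∣ ↥ s ∣ ℕ.* ↧ₙ w) 2^L≤k ⟩
  k ℕ.^ (ℤ.∣ ↥ s ∣ ℕ.* ↧ₙ w)         ∎
  where
  open ℕₚ.≤-Reasoning
  a b c d : ℕ
  a = ℤ.∣ ↥ w ∣
  b = ↧ₙ w
  c = ℤ.∣ ↥ s ∣
  d = ↧ₙ s
  instance
    d1≢0 : NonZero (d ℕ.* 1)
    d1≢0 = ℕₚ.m*n≢0 d 1
  fractions : + a / b ℚ.≤ + (c ℕ.* L) / (d ℕ.* 1)
  fractions = subst₂ ℚ._≤_ (nonNegative≡/ w 0≤w)
    (trans (cong (ℚ._* (+ L / 1)) (nonNegative≡/ s 0≤s)) (/-*-/ c d L 1)) le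
  cross : a ℕ.* d ℕ.≤ L ℕ.* (c ℕ.* b)
  cross = ℕₚ.≤-trans (ℕₚ.≤-reflexive (cong (a ℕ.*_) (sym (ℕₚ.*-identityʳ d))))
    (ℕₚ.≤-trans (/-cancel-≤ a b (c ℕ.* L) (d ℕ.* 1) fractions) (ℕₚ.≤-reflexive (arith c L b)))
    where
    arith : ∀ c L b → c ℕ.* L ℕ.* b ≡ L ℕ.* (c ℕ.* b)
    arith = solve-∀

module _ (N L : ℕ) {w : ℚ} (0<w : 0ℚ ℚ.< w) where

  private
    0≤w : 0ℚ ℚ.≤ w
    0≤w = ℚₚ.<⇒≤ 0<w

    c : ℚ
    c = (+ N / 1) ℚ.* (+ L / 1)

    0≤c : 0ℚ ℚ.≤ c
    0≤c = subst (0ℚ ℚ.≤_) (sym (/-*-/ N 1 L 1)) (/-nonNegative (N ℕ.* L) 1)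

  fraction-bound : ∀ x s .{{_ : NonZero s}} → s ℕ.* ℤ.∣ ↥ w ∣ ℕ.≤ x ℕ.* (N ℕ.* L ℕ.* ↧ₙ w) →
                   w ℚ.≤ (+ x / s) ℚ.* ((+ N / 1) ℚ.* (+ L / 1))
  fraction-bound x s le = subst₂ ℚ._≤_ (sym (nonNegative≡/ w 0≤w))
    (sym (trans (cong ((+ x / s) ℚ.*_) (/-*-/ N 1 L 1)) (/-*-/ x s (N ℕ.* L) 1)))
    (/-mono-≤ num den (x ℕ.* (N ℕ.* L)) (s ℕ.* 1) {{_}} {{s1≢0}} cross)
    where
    num den : ℕ
    num = ℤ.∣ ↥ w ∣
    den = ↧ₙ w
    s1≢0 : NonZero (s ℕ.* 1)
    s1≢0 = ℕₚ.m*n≢0 s 1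
    cross : num ℕ.* (s ℕ.* 1) ℕ.≤ x ℕ.* (N ℕ.* L) ℕ.* den
    cross = ℕₚ.≤-trans (ℕₚ.≤-reflexive (trans (cong (num ℕ.*_) (ℕₚ.*-identityʳ s)) (ℕₚ.*-comm num s)))
      (ℕₚ.≤-trans le (ℕₚ.≤-reflexive (sym (ℕₚ.*-assoc x (N ℕ.* L) den))))

  -- The chain is `w / (N L) ≤ σ ≤ α σ′ ≤ α q` with `L ≤ log₂ k`. In the application `σ` is the
  -- sparsity of the oracle's cut, `σ′` that of the cut from Menger's theorem, and `q` the number of
  -- paths divided by `∣ T₁ ∣`.
  sparsity-bound : ∀ α σ σ′ q {k} → w ℚ.≤ σ ℚ.* ((+ N / 1) ℚ.* (+ L / 1)) → σ ℚ.≤ α ℚ.* σ′ → σ′ ℚ.≤ q → 0ℚ ℚ.≤ σ′ →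
                   2 ℕ.^ L ℕ.≤ k → w ≤ q ℚ.* ((+ N / 1) ℚ.* α) ·log₂ k
  sparsity-bound α σ σ′ q w≤σc σ≤ σ′≤q 0≤σ′ 2^L≤k =
    ≤·log₂ {L = L} 0≤w 0≤s 2^L≤k (ℚₚ.≤-trans w≤ (ℚₚ.≤-reflexive regroup))
    where
    w≤ασ′c : w ℚ.≤ α ℚ.* σ′ ℚ.* c
    w≤ασ′c = ℚₚ.≤-trans w≤σc (ℚₚ.*-monoʳ-≤-nonNeg c {{ℚ.nonNegative 0≤c}} σ≤)
    0≤q : 0ℚ ℚ.≤ q
    0≤q = ℚₚ.≤-trans 0≤σ′ σ′≤q
    0≤α : 0ℚ ℚ.≤ α
    -- A factor `α ≤ 0` would give `w ≤ α σ′ c ≤ 0`.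
    0≤α with ℚₚ.≤-total 0ℚ α
    ... | inj₁ 0≤α = 0≤α
    ... | inj₂ α≤0 = contradiction (ℚₚ.<-≤-trans 0<w (ℚₚ.≤-trans w≤ασ′c ασ′c≤0)) (ℚₚ.<-irrefl refl)
      where
      ασ′c≤0 : α ℚ.* σ′ ℚ.* c ℚ.≤ 0ℚ
      ασ′c≤0 = ℚₚ.≤-trans
        (ℚₚ.*-monoʳ-≤-nonNeg c {{ℚ.nonNegative 0≤c}}
          (ℚₚ.≤-trans (ℚₚ.*-monoʳ-≤-nonNeg σ′ {{ℚ.nonNegative 0≤σ′}} α≤0) (ℚₚ.≤-reflexive (ℚₚ.*-zeroˡ σ′))))
        (ℚₚ.≤-reflexive (ℚₚ.*-zeroˡ c))
    w≤ : w ℚ.≤ α ℚ.* q ℚ.* c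
    w≤ = ℚₚ.≤-trans w≤ασ′c (ℚₚ.*-monoʳ-≤-nonNeg c {{ℚ.nonNegative 0≤c}} (ℚₚ.*-monoˡ-≤-nonNeg α {{ℚ.nonNegative 0≤α}} σ′≤q))
    regroup : α ℚ.* q ℚ.* c ≡ q ℚ.* ((+ N / 1) ℚ.* α) ℚ.* (+ L / 1)
    regroup = begin
      α ℚ.* q ℚ.* ((+ N / 1) ℚ.* (+ L / 1)) ≡⟨ ℚₚ.*-assoc (α ℚ.* q) (+ N / 1) (+ L / 1) ⟨
      α ℚ.* q ℚ.* (+ N / 1) ℚ.* (+ L / 1)   ≡⟨ cong (ℚ._* (+ L / 1)) (trans (cong (ℚ._* (+ N / 1)) (ℚₚ.*-comm α q))
                                                (trans (ℚₚ.*-assoc q α (+ N / 1)) (cong (q ℚ.*_) (ℚₚ.*-comm α (+ N / 1))))) ⟩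
      q ℚ.* ((+ N / 1) ℚ.* α) ℚ.* (+ L / 1) ∎
      where open ≡-Reasoning
    0≤Nα : 0ℚ ℚ.≤ (+ N / 1) ℚ.* α
    0≤Nα = ℚₚ.≤-trans (ℚₚ.≤-reflexive (sym (ℚₚ.*-zeroʳ (+ N / 1))))
      (ℚₚ.*-monoˡ-≤-nonNeg (+ N / 1) {{ℚ.nonNegative (/-nonNegative N 1)}} 0≤α)
    0≤s : 0ℚ ℚ.≤ q ℚ.* ((+ N / 1) ℚ.* α)
    0≤s = ℚₚ.≤-trans (ℚₚ.≤-reflexive (sym (ℚₚ.*-zeroʳ q))) (ℚₚ.*-monoˡ-≤-nonNeg q {{ℚ.nonNegative 0≤q}} 0≤Nα)

-- The factor 8 between `N` and `c` absorbs the two terminals of each pair and the 4 in `ℓ ≤ 4 L`.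
loss-arithmetic : ∀ c N L {x d t ℓ u m} .{{_ : NonZero L}} → 8 ℕ.* N ≡ c →
                  x ℕ.* (c ℕ.* L ℕ.* d) ℕ.≤ t ℕ.* ℓ ℕ.* u → t ℕ.≤ 2 ℕ.* m → ℓ ℕ.≤ 4 ℕ.* L →
                  x ℕ.* (N ℕ.* d) ℕ.≤ u ℕ.* m
loss-arithmetic c N L {x} {d} {t} {ℓ} {u} {m} refl le t≤ ℓ≤ = ℕₚ.*-cancelˡ-≤ (8 ℕ.* L) {{ℕₚ.m*n≢0 8 L}} (begin
  8 ℕ.* L ℕ.* (x ℕ.* (N ℕ.* d))   ≡⟨ arith L x N d ⟩
  x ℕ.* (8 ℕ.* N ℕ.* L ℕ.* d)     ≤⟨ le ⟩
  t ℕ.* ℓ ℕ.* u                   ≤⟨ ℕₚ.*-monoˡ-≤ u (ℕₚ.*-mono-≤ t≤ ℓ≤) ⟩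
  2 ℕ.* m ℕ.* (4 ℕ.* L) ℕ.* u     ≡⟨ arith′ m L u ⟩
  8 ℕ.* L ℕ.* (u ℕ.* m)           ∎)
  where
  open ℕₚ.≤-Reasoning
  arith : ∀ L x N d → 8 ℕ.* L ℕ.* (x ℕ.* (N ℕ.* d)) ≡ x ℕ.* (8 ℕ.* N ℕ.* L ℕ.* d)
  arith = solve-∀
  arith′ : ∀ m L u → 2 ℕ.* m ℕ.* (4 ℕ.* L) ℕ.* u ≡ 8 ℕ.* L ℕ.* (u ℕ.* m)
  arith′ = solve-∀

-- The required properties of the decomposition

module Correctness {α : ℚ} (I : Instance) (adm : Admissible I)
                   (cut : ∀ S → VertexCut (restrictGraph (Instance.graph I) S))
                   (approx : ∀ S → ApproxSparsest (innerTerminals (Instance.pairs I) S) α (cut S)) where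

  open Instance I

  open Admissible adm hiding (once)
  open Splitting I cut
  open Pieces I cut

  -- Menger's theorem supplies the paths `Ps` and a separator `X` with at most as many vertices. The
  -- cut `C′` made from `X` separates at least `∣ T₁ ∣` terminals, so its sparsity is at most
  -- `length Ps / ∣ T₁ ∣`, while `α` times it is at least the sparsity of `cut S`, which failed the
  -- test.
  wellLinked-piece : ∀ S → sparse S ≡ false → WellLinked (induced graph S) (α-WL w α k) (TerminalOf pairs (innerPairs pairs S))
  wellLinked-piece S eq T₁ T₂ T₁⊆ T₂⊆ _ ∣T₁∣≡∣T₂∣ {{nz₁}} =
    Ps
    , All.map path (proj₁ linkage)
    , proj₂ linkage
    , sparsity-bound 512 (log k) 0<w α (sparsity T (cut S) {{nz}}) (sparsity T C′ {{nz′}}) (+ length Ps / ∣ T₁ ∣)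
        (fraction-bound 512 (log k) 0<w (∣ VertexCut.X (cut S) ∣) (sep S) {{nz}} (dense⇒≤ S eq))
        (proj₂ (approx S C′ {{nz′}}))
        (/-mono-≤ (∣ X ∣) (separated T C′) (length Ps) (∣ T₁ ∣) {{nz′}} (ℕₚ.*-mono-≤ X≤Ps ∣T₁∣≤))
        (/-nonNegative (∣ X ∣) (separated T C′) {{nz′}})
        (2^log≤ 2≤k)
    where
    separatedLinkage : ∃[ X ] ∃[ Ps ] (Linkage (edges graph S) T₁ T₂ Ps × ∣ X ∣ ℕ.≤ length Ps × Separation (edges graph S) T₁ T₂ X)
    separatedLinkage = menger (edges graph S) T₁ T₂
    X : Subset n
    X = proj₁ separatedLinkage
    Ps : List (List (Fin n))
    Ps = proj₁ (proj₂ separatedLinkage)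
    linkage : Linkage (edges graph S) T₁ T₂ Ps
    linkage = proj₁ (proj₂ (proj₂ separatedLinkage))
    X≤Ps : ∣ X ∣ ℕ.≤ length Ps
    X≤Ps = proj₁ (proj₂ (proj₂ (proj₂ separatedLinkage)))
    sepX : Separation (edges graph S) T₁ T₂ X
    sepX = proj₂ (proj₂ (proj₂ (proj₂ separatedLinkage)))
    path : ∀ {P} → PathBetween (edges graph S) T₁ T₂ P →
           ∃[ s ] ∃[ t ] (s ∈ T₁ × t ∈ T₂ × IsPath (induced graph S) s t P)
    path (s , t , s∈ , t∈ , walk , unique) =
      let starts , finishes , inner , steps = walk⇒path graph S (terminal∈ pairs (T₁⊆ s∈)) walk
      in s , t , s∈ , t∈ , record { starts = starts ; finishes = finishes ; inside = inner ; steps = steps ; simple = unique }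
    T : Subset n
    T = innerTerminals pairs S
    C′ : VertexCut (restrictGraph graph S)
    C′ = separation⇒cut graph S sepX
    ∣T₁∣≤ : ∣ T₁ ∣ ℕ.≤ separated T C′
    ∣T₁∣≤ = separated≥ graph S sepX (λ v∈ → TerminalOf⇒∈ pairs {S} (T₁⊆ v∈)) (λ v∈ → TerminalOf⇒∈ pairs {S} (T₂⊆ v∈)) ∣T₁∣≡∣T₂∣
    nz′ : NonZero (separated T C′)
    nz′ = ℕ.>-nonZero (ℕₚ.≤-trans (ℕ.>-nonZero⁻¹ (∣ T₁ ∣)) ∣T₁∣≤)
    nz : NonZero (sep S)
    -- Since `C′` separates something, the guarantee says that the oracle's cut does so too.
    nz = proj₁ (approx S C′ {{nz′}})

  module Assembly (ps : List (Subset n)) (apart-ps : AllPairs Apart ps) (dense : All (λ S → sparse S ≡ false) ps)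
                  (loss-bound : ∀ ℓ → ∣ innerTerminals pairs ⊤ ∣ ℕ.< 2 ℕ.^ ℓ →
                                ∣ ∁ (⋃ ps) ∣ ℕ.* K ℕ.≤ ∣ innerTerminals pairs ⊤ ∣ ℕ.* ℓ ℕ.* num) where

    clusters : Clusters I
    clusters = map cluster ps

    Lost : Subset n
    Lost = ∁ (⋃ ps)

    same-or-apart : ∀ {Ss} → AllPairs Apart Ss → ∀ {P Q} → P ∈ᴸ Ss → Q ∈ᴸ Ss → P ≡ Q ⊎ Apart P Q
    same-or-apart (a ∷ as) (here refl) (here refl) = inj₁ refl
    same-or-apart (a ∷ as) (here refl) (there Q∈)  = inj₂ (All.lookup a Q∈)
    same-or-apart (a ∷ as) (there P∈)  (here refl) = inj₂ λ u∈ v∈ →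
      let v≢u , u∉ = All.lookup a P∈ v∈ u∈ in v≢u ∘ sym , u∉ ∘ Graph.sym graph
    same-or-apart (a ∷ as) (there P∈)  (there Q∈)  = same-or-apart as P∈ Q∈

    -- The next vertex is not lost, so it lies in some piece, and no edge leads to a different
    -- piece.
    stays : ∀ {Q} → Q ∈ᴸ ps → ∀ {u vs} → Linked (λ u v → v ∈ nbrs graph u) (u ∷ vs) → All (_∉ Lost) vs →
            u ∈ Q → All (_∈ Q) (u ∷ vs)
    stays Q∈ [-]      []       u∈Q = u∈Q ∷ []
    stays {Q} Q∈ {u} (_∷_ {y = v} uv l) (v∉ ∷ vs) u∈Q = u∈Q ∷ stays Q∈ l vs v∈Q
      where
      v∈Q : v ∈ Q
      v∈Q with Q′ , Q′∈ , v∈Q′ ← find (∈-⋃⁻ ps (x∉∁p⇒x∈p v∉)) with same-or-apart apart-ps Q∈ Q′∈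
      ... | inj₁ refl  = v∈Q′
      ... | inj₂ apart = contradiction uv (proj₂ (apart u∈Q v∈Q′))

    last∈ : ∀ {t} (vs : List (Fin n)) → List.last vs ≡ just t → t ∈ᴸ vs
    last∈ (v ∷ [])         refl = here refl
    last∈ (v ∷ vs@(_ ∷ _)) eq   = there (last∈ vs eq)

    -- A path without lost vertices stays in the piece of its first vertex, so this piece contains
    -- both ends of the pair.
    meets-Lost : ∀ {i} → i ∈ ∁ (⋃ (map (innerPairs pairs) ps)) →
                 ∀ {P} → IsPath (whole graph) (source pairs i) (target pairs i) P → Any (_∈ Lost) P
    meets-Lost {i} i∈ {P} path with Any.any? (_∈? Lost) P
    ... | yes meets = meets
    ... | no  avoid = contradiction (inner P (IsPath.starts path) (IsPath.finishes path) (IsPath.steps path) (Allₚ.¬Any⇒All¬ P avoid))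
                                    (x∈∁p⇒x∉p i∈)
      where
      inner : ∀ P → List.head P ≡ just (source pairs i) → List.last P ≡ just (target pairs i) →
              Linked (λ u v → v ∈ nbrs graph u) P → All (_∉ Lost) P → i ∈ ⋃ (map (innerPairs pairs) ps)
      inner (u ∷ vs) refl last steps (u∉ ∷ vs∉)
        with Q , Q∈ , u∈Q ← find (∈-⋃⁻ ps (x∉∁p⇒x∈p u∉)) =
        ∈-⋃⁺ (lose (∈-map⁺ (innerPairs pairs) Q∈)
          (∈-innerPairs⁺ pairs u∈Q (All.lookup (stays Q∈ steps vs∉ u∈Q) (last∈ (u ∷ vs) last))))

    lost-vertices : ∣ Lost ∣ ℕ.* (64 ℕ.* den) ℕ.≤ num ℕ.* m
    lost-vertices = loss-arithmetic 512 64 (log k) {x = ∣ Lost ∣} {d = den} refl (loss-bound ℓ (ℕₚ.≤-<-trans ∣T∣≤2k 2k<)) (∣innerTerminals∣≤ pairs {⊤}) ℓ≤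
      where
      ℓ : ℕ
      ℓ = proj₁ (exponent 2≤k)
      2k< : 2 ℕ.* k ℕ.< 2 ℕ.^ ℓ
      2k< = proj₁ (proj₂ (exponent 2≤k))
      ℓ≤ : ℓ ℕ.≤ 4 ℕ.* log k
      ℓ≤ = proj₂ (proj₂ (exponent 2≤k))
      ∣T∣≤2k : ∣ innerTerminals pairs ⊤ ∣ ℕ.≤ 2 ℕ.* k
      ∣T∣≤2k = ℕₚ.≤-trans (∣innerTerminals∣≤ pairs {⊤}) (ℕₚ.*-monoʳ-≤ 2 m≤k)

    few-lost : (+ ∣ Lost ∣ / 1) ℚ.≤ w ℚ.* (+ m / 64)
    few-lost = bound 64 lost-vertices
      where
      bound : ∀ N .{{_ : NonZero N}} → ∣ Lost ∣ ℕ.* (N ℕ.* den) ℕ.≤ num ℕ.* m → (+ ∣ Lost ∣ / 1) ℚ.≤ w ℚ.* (+ m / N)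
      bound N le = subst ((+ ∣ Lost ∣ / 1) ℚ.≤_)
        (sym (trans (cong (ℚ._* (+ m / N)) (nonNegative≡/ w (ℚₚ.<⇒≤ 0<w))) (/-*-/ num den m N)))
        (/-mono-≤ (∣ Lost ∣) 1 (num ℕ.* m) (den ℕ.* N) {{_}} {{ℕₚ.m*n≢0 den N}}
          (ℕₚ.≤-trans (ℕₚ.≤-reflexive (cong (∣ Lost ∣ ℕ.*_) (ℕₚ.*-comm den N)))
            (ℕₚ.≤-trans le (ℕₚ.≤-reflexive (sym (ℕₚ.*-identityʳ (num ℕ.* m)))))))

    -- Comparing flow and capacity gives `∣ Y ∣ w ≤ ∣ Lost ∣ ≤ w m / 64`, where `w > 0` cancels.
    lost-pairs : 64 ℕ.* ∣ ∁ (⋃ (map (innerPairs pairs) ps)) ∣ ℕ.≤ m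
    lost-pairs = bound 64 few-lost
      where
      Y : Subset m
      Y = ∁ (⋃ (map (innerPairs pairs) ps))
      bound : ∀ N .{{_ : NonZero N}} → (+ ∣ Lost ∣ / 1) ℚ.≤ w ℚ.* (+ m / N) → N ℕ.* ∣ Y ∣ ℕ.≤ m
      bound N le = subst₂ ℕ._≤_ (ℕₚ.*-comm (∣ Y ∣) N) (ℕₚ.*-identityʳ m)
        (/-cancel-≤ (∣ Y ∣) 1 m N (ℚₚ.*-cancelʳ-≤-pos w {{ℚ.positive 0<w}}
          (ℚₚ.≤-trans (cut-capacity (ℚₚ.<⇒≤ 0<w) flow Lost Y meets-Lost)
            (ℚₚ.≤-trans le (ℚₚ.≤-reflexive (ℚₚ.*-comm w (+ m / N)))))))

    ∣⋃∣≤ : ∀ {l} (Ss : List (Subset l)) → ∣ ⋃ Ss ∣ ℕ.≤ sum (map ∣_∣ Ss)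
    ∣⋃∣≤ {l} []   = ℕₚ.≤-reflexive (∣⊥∣≡0 l)
    ∣⋃∣≤ (S ∷ Ss) = ℕₚ.≤-trans (∣p∪q∣≤∣p∣+∣q∣ S (⋃ Ss)) (ℕₚ.+-monoʳ-≤ (∣ S ∣) (∣⋃∣≤ Ss))

    many-pairs : 63 ℕ.* m ℕ.≤ 64 ℕ.* sum (map (λ (_ , J) → ∣ J ∣) clusters)
    many-pairs = ℕₚ.+-cancelʳ-≤ m (63 ℕ.* m) _ (begin
      63 ℕ.* m ℕ.+ m                    ≡⟨ arith m ⟩
      64 ℕ.* m                          ≤⟨ ℕₚ.*-monoʳ-≤ 64 m≤ ⟩
      64 ℕ.* (∣ U ∣ ℕ.+ ∣ ∁ U ∣)        ≡⟨ ℕₚ.*-distribˡ-+ 64 (∣ U ∣) (∣ ∁ U ∣) ⟩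
      64 ℕ.* ∣ U ∣ ℕ.+ 64 ℕ.* ∣ ∁ U ∣   ≤⟨ ℕₚ.+-mono-≤ (ℕₚ.*-monoʳ-≤ 64 (∣⋃∣≤ (map (innerPairs pairs) ps))) lost-pairs ⟩
      64 ℕ.* sum (map ∣_∣ (map (innerPairs pairs) ps)) ℕ.+ m
        ≡⟨ cong (λ l → 64 ℕ.* sum l ℕ.+ m) (trans (sym (map-∘ ps)) (map-∘ ps)) ⟩
      64 ℕ.* sum (map (λ (_ , J) → ∣ J ∣) clusters) ℕ.+ m ∎)
      where
      open ℕₚ.≤-Reasoning
      U : Subset m
      U = ⋃ (map (innerPairs pairs) ps)
      m≤ : m ℕ.≤ ∣ U ∣ ℕ.+ ∣ ∁ U ∣
      m≤ = ℕₚ.≤-trans (ℕₚ.≤-reflexive (trans (sym (∣⊤∣≡n m)) (cong ∣_∣ (sym (p∪∁p≡⊤ U))))) (∣p∪q∣≤∣p∣+∣q∣ U (∁ U))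
      arith : ∀ m → 63 ℕ.* m ℕ.+ m ≡ 64 ℕ.* m
      arith = solve-∀

    vertex-sets : map (λ (H , _) → verts H) clusters ≡ ps
    vertex-sets = trans (sym (map-∘ ps)) (map-id ps)

    at : ∀ {P : Subgraph graph × Subset m → Set} → (∀ {S} → S ∈ᴸ ps → P (cluster S)) → ∀ j → P (List.lookup clusters j)
    at {P} p j with S , S∈ , eq ← ∈-map⁻ cluster (∈-lookup {xs = clusters} j) = subst P (sym eq) (p S∈)

    apart-at : ∀ {A : Set} {f : A → Subset n} {xs : List A} → AllPairs (λ x y → Apart (f x) (f y)) xs →
               ∀ {i j} → i ≢ j → Apart (f (List.lookup xs i)) (f (List.lookup xs j))
    apart-at (a ∷ as) {fzero}  {fzero}  i≢j = contradiction refl i≢j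
    apart-at {f = f} (a ∷ as) {fzero}  {fsuc j} i≢j u∈ v∈ = All.lookup a (∈-lookup j) u∈ v∈
    apart-at {f = f} (a ∷ as) {fsuc i} {fzero}  i≢j u∈ v∈ =
      let v≢u , u∉ = All.lookup a (∈-lookup i) v∈ u∈ in v≢u ∘ sym , u∉ ∘ Graph.sym graph
    apart-at {f = f} (a ∷ as) {fsuc i} {fsuc j} i≢j u∈ v∈ = apart-at {f = f} as (i≢j ∘ cong fsuc) u∈ v∈

    clusters-apart : AllPairs (λ C C′ → Apart (verts (proj₁ C)) (verts (proj₁ C′))) clusters
    clusters-apart = AllPairsₚ.map⁺ apart-ps

    isDecomposition-clusters : IsDecomposition α I clusters
    isDecomposition-clusters = record
      { disjoint   = λ {j} {j′} j≢j′ (v , v∈) →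
          let v∈H , v∈H′ = x∈p∩q⁻ (verts (proj₁ (List.lookup clusters j))) _ v∈
          in proj₁ (apart-at {f = verts ∘ proj₁} clusters-apart j≢j′ v∈H v∈H′) refl
      ; terminals  = λ j {v} → at {λ (H , J) → ∀ {v} → TerminalOf pairs J v → v ∈ verts H} (λ _ → terminal∈ pairs) j {v}
      ; wellLinked = at {λ (H , J) → WellLinked H (α-WL w α k) (TerminalOf pairs J)} λ S∈ → wellLinked-piece _ (All.lookup dense S∈)
      ; noEdge     = λ j≢j′ u∈ v∈ → proj₂ (apart-at {f = verts ∘ proj₁} clusters-apart j≢j′ u∈ v∈)
      ; manyPairs  = many-pairs
      ; fewLost    = subst (λ Ss → (+ ∣ ∁ (⋃ Ss) ∣ / 1) ℚ.≤ w ℚ.* (+ m / 64)) (sym vertex-sets) few-lost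
      }

  isDecomposition : IsDecomposition α I decomposition
  isDecomposition = Assembly.isDecomposition-clusters (pieces n ⊤) (apart-pieces n ⊤)
    (dense-pieces n ⊤ (ℕₚ.≤-reflexive (∣⊤∣≡n n)))
    λ ℓ t< → ℕₚ.≤-trans (ℕₚ.*-monoˡ-≤ K (p⊆q⇒∣p∣≤∣q∣ {p = ∁ (⋃ (pieces n ⊤))} {q = lost (pieces n ⊤) ⊤} λ v∈ → x∈p∩q⁺ (∈⊤ , v∈)))
                        (loss n ⊤ ℓ t<)

theorem4p4 : (α-AKR : ℚ) → SparsestCutFactor α-AKR →
    PolyTimeSolvable encInstance encClusters Admissible (IsDecomposition α-AKR)
theorem4p4 α (p , a , b , solves) =
  prog algorithm , coeff (cost algorithm) , deg (cost algorithm) , λ I adm →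
    let t , run , t≤ = runs algorithm (I , adm) in
    Split.decomposition (I , adm) , t , run
    , ℕₚ.≤-trans t≤ (⟦⟧≤monomial (cost algorithm) (size (encInstance I)))
    , Correctness.isDecomposition I adm (cutOf (I , adm)) λ S →
        proj₂ (proj₂ (proj₂ (proj₂ (solves (n I , restrictGraph (graph I) S , innerTerminals (pairs I) S)
                                           (planar-restrict (graph I) S (Admissible.planar adm))))))
  where
  open Instance
  -- The drawing is an argument because the given solver returns a cut only where its promise holds.
  oracle : (i : CutInput) → Planar (proj₁ (proj₂ i)) → VertexCut (proj₁ (proj₂ i))
  oracle i D = proj₁ (solves i D)

  oracle-⊢ : _⊢_ {Σ CutInput λ (_ , G , _) → Planar G}
               (λ (i , _) → encCutInput i) (λ (i , D) → encCut i (oracle i D))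
  oracle-⊢ = computes p (monomial a b) λ (i , D) →
    let _ , t , run , t≤ , _ = solves i D
    in t , run , ℕₚ.≤-trans t≤ (ℕₚ.≤-reflexive (sym (⟦monomial⟧ a b (size (encCutInput i)))))

  open Oracle oracle oracle-⊢

  short : ∀ γ d → length (Split.pieces γ d ⊤) ℕ.≤ suc (n (proj₁ γ) ℕ.+ n (proj₁ γ))
  short γ@(I , _) d = ℕₚ.≤-trans (Pieces.length-pieces I (cutOf γ) d ⊤)
    (ℕₚ.≤-trans (ℕₚ.m⊔n≤m+n 1 _) (ℕₚ.≤-reflexive (cong (λ s → suc (s ℕ.+ s)) (∣⊤∣≡n (n I)))))

  algorithm : (λ (I , _) → encInstance I) ⊢ λ γ → encClusters (proj₁ γ) (Split.decomposition γ)
  algorithm = decomposition-⊢ short
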